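{- Let $p$ be a prime with $p\equiv 3\pmod 4$, $t\geq1$ an integer, $q=p^{2t}$ and $r=\frac{q-1}{4}$. Let $K(P^*(q))=K(P^*(q))_p\oplus K(P^*(q))_{p'}$ be the decomposition of the critical group of the Peisert graph $P^*(q)$ into its Sylow $p$-subgroup and its $p$-complement. Then $K(P^*(q))_{p'}\cong(\mathbb{Z}/r\mathbb{Z})^{2r}$, and the order of $K(P^*(q))_p$ is $q^{\frac{q-3}{2}}$.
   Context: Let $\beta$ be a primitive element of $\mathbb{F}_q$, $C_0$ the subgroup of nonzero fourth powers in $\mathbb{F}_q^\times$, and $S'=C_0\cup\beta C_0$. The Peisert graph $P^*(q)$ has vertex set $\mathbb{F}_q$, distinct $x,y$ adjacent iff $x-y\in S'$; it is regular of degree $\frac{q-1}{2}$. Its Laplacian is $L=\frac{q-1}{2}I-A$ with $A$ the adjacency matrix. The critical group $K(\Gamma)$ of a graph $\Gamma$ is the torsion subgroup of the cokernel of the Laplacian $L:\mathbb{Z}^{V}\to\mathbb{Z}^{V}$. -}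

module Defs where

open import Level using (0ℓ)
open import Data.Nat as ℕ using (ℕ; zero; suc; _∸_; _≥_)
open import Data.Nat.DivMod using (_/_)
open import Data.Nat.Coprimality using (Coprime)
open import Data.Integer as ℤ using (ℤ; +_)
open import Data.Integer.Divisibility using () renaming (_∣_ to _∣ℤ_)
open import Data.Fin as Fin using (Fin)
open import Data.Fin.Properties using (any?)
open import Data.Product using (Σ; ∃; ∃-syntax; _×_; _,_; proj₁; proj₂)
open import Data.Sum using (_⊎_; inj₁; inj₂)
open import Data.Bool using (Bool; true; false; if_then_else_; _∧_; not)
open import Relation.Nullary using (Dec; yes; no; ¬_; does)
open import Relation.Nullary.Decidable using (map′; _⊎-dec_; _×-dec_; ¬?)
open import Relation.Binary.PropositionalEquality using (_≡_; _≢_; refl; sym; trans; cong)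
open import Algebra.Structures using (IsCommutativeRing)
open import Function.Bundles using (_↔_; Inverse)

record FiniteField (q : ℕ) : Set₁ where
  infixl 7 _*_
  infixl 6 _+_ _-_
  infixr 8 _^_
  infix 4 _≟_
  field
    Carrier : Set
    _+_ _*_ : Carrier → Carrier → Carrier
    -_      : Carrier → Carrier
    0# 1#   : Carrier
    isCommutativeRing : IsCommutativeRing _≡_ _+_ _*_ -_ 0# 1#
    0≢1     : 0# ≢ 1#
    inverse : ∀ x → x ≢ 0# → ∃[ y ] (x * y ≡ 1#)
    enum    : Fin q ↔ Carrier

  _-_ : Carrier → Carrier → Carrier
  x - y = x + (- y)

  _^_ : Carrier → ℕ → Carrier
  x ^ zero  = 1#
  x ^ suc n = x * (x ^ n)

  IsPrimitive : Carrier → Set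
  IsPrimitive β = β ≢ 0# × (∀ x → x ≢ 0# → ∃[ n ] (β ^ n ≡ x))

  _≟_ : (x y : Carrier) → Dec (x ≡ y)
  x ≟ y = map′ inj (cong from) (from x Fin.≟ from y)
    where
    open Inverse enum
    tf : ∀ z → to (from z) ≡ z
    tf z = inverseˡ refl
    inj : from x ≡ from y → x ≡ y
    inj e = trans (sym (tf x)) (trans (cong to e) (tf y))

  InC₀ : Carrier → Set
  InC₀ z = ∃[ x ] (x ≢ 0# × x ^ 4 ≡ z)

  InS' : Carrier → Carrier → Set
  InS' β z = InC₀ z ⊎ ∃[ c ] (InC₀ c × β * c ≡ z)

  private
    open Inverse enum
    tf : ∀ z → to (from z) ≡ z
    tf z = inverseˡ refl

    P₀ : Carrier → Fin q → Set
    P₀ z i = ¬ (to i ≡ 0#) × to i ^ 4 ≡ z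

    P₀? : ∀ z i → Dec (P₀ z i)
    P₀? z i = ¬? (to i ≟ 0#) ×-dec (to i ^ 4 ≟ z)

  InC₀? : ∀ z → Dec (InC₀ z)
  InC₀? z = map′ (λ { (i , h) → to i , h })
                 (λ { (x , nz , e) → from x , (λ e' → nz (trans (sym (tf x)) e'))
                                          , trans (cong (λ w → w ^ 4) (tf x)) e })
                 (any? (P₀? z))

  InS'? : ∀ β z → Dec (InS' β z)
  InS'? β z = InC₀? z ⊎-dec
    map′ (λ { (i , h) → to i , h })
         (λ { (c , h , e) → from c , subst₂ h e })
         (any? (λ i → InC₀? (to i) ×-dec (β * to i ≟ z)))
    where
    subst₂ : ∀ {c} → InC₀ c → β * c ≡ z → InC₀ (to (from c)) × β * to (from c) ≡ z
    subst₂ {c} h e rewrite tf c = h , e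

module Peisert {q : ℕ} (F : FiniteField q) (β : FiniteField.Carrier F) where
  open FiniteField F

  V : Set
  V = Carrier

  adj : V → V → Bool
  adj x y = not (does (x ≟ y)) ∧ does (InS'? β (x - y))

  A : V → V → ℤ
  A x y = if adj x y then + 1 else + 0

  L : V → V → ℤ
  L x y = (if does (x ≟ y) then + ((q ∸ 1) / 2) else + 0) ℤ.- A x y

  ΣV : (V → ℤ) → ℤ
  ΣV f = go q (λ i → f (Inverse.to enum i))
    where
    go : (n : ℕ) → (Fin n → ℤ) → ℤ
    go zero    g = + 0
    go (suc n) g = g Fin.zero ℤ.+ go n (λ i → g (Fin.suc i))

  applyL : (V → ℤ) → (V → ℤ)
  applyL u x = ΣV (λ y → L x y ℤ.* u y)

  InImL : (V → ℤ) → Set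
  InImL v = ∃[ u ] (∀ x → v x ≡ applyL u x)

  _∼_ : (V → ℤ) → (V → ℤ) → Set
  v ∼ w = InImL (λ x → v x ℤ.- w x)

  _·_ : ℤ → (V → ℤ) → (V → ℤ)
  (n · v) x = n ℤ.* v x

  _⊕_ : (V → ℤ) → (V → ℤ) → (V → ℤ)
  (v ⊕ w) x = v x ℤ.+ w x

  -- elements of the critical group (torsion of coker L) of order a power of p
  InKp : ℕ → (V → ℤ) → Set
  InKp p v = ∃[ k ] InImL ((+ (p ℕ.^ k)) · v)

  InKp' : ℕ → (V → ℤ) → Set
  InKp' p v = ∃[ n ] (n ≥ 1 × Coprime n p × InImL ((+ n) · v))

-- (ℤ/rℤ)^m as vectors of integers modulo componentwise congruence mod r.

_≡[mod_]ᵥ_ : {m : ℕ} → (Fin m → ℤ) → ℕ → (Fin m → ℤ) → Set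
a ≡[mod r ]ᵥ b = ∀ i → (+ r) ∣ℤ (a i ℤ.- b i)

module _ {q : ℕ} (F : FiniteField q) (β : FiniteField.Carrier F) where
  open Peisert F β

  Kp'≅ZmodPow : (p r m : ℕ) → Set
  Kp'≅ZmodPow p r m =
    Σ ((V → ℤ) → (Fin m → ℤ)) λ f →
      (∀ v w → InKp' p v → InKp' p w → v ∼ w → f v ≡[mod r ]ᵥ f w) ×
      (∀ v w → InKp' p v → InKp' p w →
         f (v ⊕ w) ≡[mod r ]ᵥ (λ i → f v i ℤ.+ f w i)) ×
      (∀ v w → InKp' p v → InKp' p w → f v ≡[mod r ]ᵥ f w → v ∼ w) ×
      (∀ c → ∃[ v ] (InKp' p v × f v ≡[mod r ]ᵥ c))

  KpHasOrder : (p N : ℕ) → Set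
  KpHasOrder p N =
    Σ (Fin N → (V → ℤ)) λ g →
      (∀ i → InKp p (g i)) ×
      (∀ i j → g i ∼ g j → i ≡ j) ×
      (∀ v → InKp p v → ∃[ i ] (v ∼ g i))

{-# OPTIONS --safe #-}
module Submission where

{- Write q = 4r + 1 and L' = q − J − L, the Laplacian of the complementary graph.

   Strong regularity.  Let N(w) count the pairs in S' × (complement of S') with sum w. Multiplication by β²
   exchanges S' and its complement, so N(β²w) = N(w); since p ≡ 3 (mod 4), Frobenius maps S' to β⁻¹S', so
   N(wᵖ) = N(βw). As p is odd, N is constant on w ≠ 0, whence L L' = r(q − J). Moreover L and L' are conjugate under x ↦ β²x.

   Orders.  On the lattice G ≅ ℤ⁴ʳ of functions of sum zero, put Λ_d = {v : d ∣ L'v}. If d ∣ r or d = rq, then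
   [G : Λ_d] = [Λ_d : dG] by conjugacy, so [G : Λ_d] = d²ʳ. Here Λ_rq = LG has index q in Im L, and Λ_r / Im L is the
   Sylow p-subgroup; the tower G ⊇ Λ_r ⊇ Im L ⊇ Λ_rq therefore gives it the order q²ʳ⁻¹.

   Structure.  The p-complement is G / Λ_r. For every d ∣ r the index of Λ_r + dG is d²ʳ. Euclidean descent finds the
   gcd c of all coordinates of Λ_r as a coordinate of one of its members; comparing the index at d = c forces c = 1 as
   long as the rank exceeds 2r, so a rank-one summand inside Λ_r splits off, and at rank 2r the index at d = r
   leaves only Λ_r = rG. -}

-- No eigenvalue of L and no Smith normal form is computed. The relation L L' = r(q - J) makes L and
-- L' inverse to each other on G up to the factor rq, and their conjugacy stands in for equal
-- multiplicities: two equal factors of d⁴ʳ must both be d²ʳ. The torsion of the cokernel is G / Im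
-- L: a torsion class has sum zero because Im L lies in G, and rq annihilates G / Im L. As r and q
-- are coprime, Λ_r separates the two parts. The order and exponent of G / Λ_r do not determine it:
-- ℤ/4 × ℤ/2 × ℤ/2 and (ℤ/4)² agree in both. The indices at all divisors d of r exclude such
-- alternatives. Im L is larger than LG because LG is the image of the functions of sum zero only,
-- while a point mass has sum 1. This is the source of the index q, and so of the -1 in the exponent
-- 2r - 1.

open import Defs

-- Subgroups of ℤⁿ and their indices.

module IntegerVectors where

  open import Data.Integer using (ℤ; +_; -_; _+_; _-_; _*_; 0ℤ; 1ℤ; -1ℤ; ∣_∣)
  open import Data.Integer.Properties using (i-j≡0⇒i≡j; +-injective; ∣i∣≡0⇒i≡0; m-n≡m⊖n; ∣m⊝n∣≤m⊔n)
  open import Data.Integer.DivMod using (_%ℕ_; _/ℕ_; n%ℕd<d; a≡a%ℕn+[a/ℕn]*n)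
  open import Data.Integer.Divisibility.Signed using (_∣_; divides; ∣⇒∣ᵤ; ∣m∣n⇒∣m+n; ∣n⇒∣m*n)
  open import Data.Integer.Tactic.RingSolver using (solve-∀)
  open import Data.Nat as ℕ using (ℕ; zero; suc; NonZero)
  import Data.Nat.Properties as ℕ
  open import Data.Nat.Divisibility using (>⇒∤) renaming (_∣_ to _ℕ∣_)
  open import Data.Fin using (Fin; zero; suc; toℕ; fromℕ<; combine; remQuot; finToFun; funToFin)
  open import Data.Fin.Properties using (any?; toℕ-fromℕ<; toℕ-injective; toℕ<n; injective⇒≤; remQuot-combine; combine-remQuot; finToFun-funToFin; funToFin-finToFin)
  open import Data.Product using (Σ; ∃-syntax; _×_; _,_; proj₁; proj₂)
  open import Data.Unit using (tt)
  open import Data.Vec.Functional using (Vector)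
  open import Function using (_∘_)
  open import Relation.Nullary using (Dec; yes; no; contradiction)
  open import Relation.Unary using (Pred; U)
  open import Relation.Binary.PropositionalEquality using (_≡_; _≗_; refl; sym; trans; cong; cong₂; subst; module ≡-Reasoning)
  open import Level using (0ℓ)

  infixl 6 _⊝_

  _⊝_ : ∀ {n} → Vector ℤ n → Vector ℤ n → Vector ℤ n
  (v ⊝ w) i = v i - w i

  -- The vector w is anything pointwise equal to a u + b v, so a single field carries additivity,
  -- homogeneity and, without function extensionality, compatibility with `≗`. `Subgroup` has the
  -- same form for the same reason.
  record Linear {m n} (f : Vector ℤ m → Vector ℤ n) : Set where
    field
      comb : ∀ {u v w} a b → (∀ i → w i ≡ a * u i + b * v i) →
             ∀ i → f w i ≡ a * f u i + b * f v i

    f-cong : ∀ {u v} → u ≗ v → f u ≗ f v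
    f-cong {u} {v} e i =
      trans (comb {v} {v} 1ℤ 0ℤ (λ j → trans (e j) (one (v j))) i) (sym (one (f v i)))
      where
      one : ∀ x → x ≡ 1ℤ * x + 0ℤ * x
      one = solve-∀

    f-scale : ∀ a u → f (λ i → a * u i) ≗ (λ i → a * f u i)
    f-scale a u i = trans (comb {u} {u} a 0ℤ (λ j → id₁ a (u j)) i) (sym (id₁ a (f u i)))
      where
      id₁ : ∀ a x → a * x ≡ a * x + 0ℤ * x
      id₁ = solve-∀

    f-minus : ∀ u v → f (u ⊝ v) ≗ f u ⊝ f v
    f-minus u v i = trans (comb {u} {v} 1ℤ -1ℤ (λ j → id₂ (u j) (v j)) i) (sym (id₂ (f u i) (f v i)))
      where
      id₂ : ∀ x y → x - y ≡ 1ℤ * x + -1ℤ * y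
      id₂ = solve-∀

  open Linear public

  record Subgroup {n} (P : Pred (Vector ℤ n) 0ℓ) : Set where
    field
      has-zero : P (λ _ → 0ℤ)
      closed : ∀ {u v w} a b → P u → P v → (∀ i → w i ≡ a * u i + b * v i) → P w

    respects : ∀ {u v} → P u → v ≗ u → P v
    respects {u} {v} Pu e = closed {u} {u} 1ℤ 0ℤ Pu Pu (λ i → trans (e i) (one (u i)))
      where
      one : ∀ x → x ≡ 1ℤ * x + 0ℤ * x
      one = solve-∀

    congr-refl : ∀ u → P (u ⊝ u)
    congr-refl u = respects has-zero (λ i → cancel (u i))
      where
      cancel : ∀ x → x - x ≡ 0ℤ
      cancel = solve-∀

    congr-trans : ∀ u v w → P (u ⊝ v) → P (v ⊝ w) → P (u ⊝ w)
    congr-trans u v w p q = closed 1ℤ 1ℤ p q (λ i → tele (u i) (v i) (w i))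
      where
      tele : ∀ x y z → x - z ≡ 1ℤ * (x - y) + 1ℤ * (y - z)
      tele = solve-∀

    congr-sym : ∀ u v → P (u ⊝ v) → P (v ⊝ u)
    congr-sym u v p = closed 0ℤ -1ℤ p p (λ i → flip (u i) (v i))
      where
      flip : ∀ x y → y - x ≡ 0ℤ * (x - y) + -1ℤ * (x - y)
      flip = solve-∀

  open Subgroup public

  U-subgroup : ∀ {n} → Subgroup {n} U
  U-subgroup = record { has-zero = tt ; closed = λ _ _ _ _ _ → tt }

  divisible : ∀ {n} → ℤ → Pred (Vector ℤ n) 0ℓ
  divisible d v = ∀ i → d ∣ v i

  divisible-subgroup : ∀ {n} d → Subgroup {n} (divisible d)
  divisible-subgroup d = record
    { has-zero = λ _ → divides 0ℤ refl
    ; closed = λ a b du dv e i → subst (d ∣_) (sym (e i)) (∣m∣n⇒∣m+n (∣n⇒∣m*n a (du i)) (∣n⇒∣m*n b (dv i)))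
    }

  preimage-subgroup : ∀ {m n} {f : Vector ℤ m → Vector ℤ n} {P} → Linear f → Subgroup P → Subgroup (P ∘ f)
  preimage-subgroup {f = f} lin S = record
    { has-zero = respects S (has-zero S) (λ i → trans (f-scale lin 0ℤ (λ _ → 0ℤ) i) refl)
    ; closed = λ a b pu pv e → closed S a b pu pv (comb lin a b e)
    }

  -- A transversal of N vectors stands for [A : B] = N, so that the quotient is never formed;
  -- `KpHasOrder` has this shape too.
  record Index {n} (A B : Pred (Vector ℤ n) 0ℓ) (N : ℕ) : Set where
    field
      rep : Fin N → Vector ℤ n
      rep∈ : ∀ i → A (rep i)
      distinct : ∀ i j → B (rep i ⊝ rep j) → i ≡ j
      cover : ∀ v → A v → ∃[ i ] B (v ⊝ rep i)

  open Index public

  index-≤ : ∀ {n} {A B : Pred (Vector ℤ n) 0ℓ} {M N} → Subgroup B → Index A B M → Index A B N → M ℕ.≤ N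
  index-≤ {B = B} S X Y = injective⇒≤ {f = proj₁ ∘ hit} λ {i} {j} e →
    distinct X i j (congr-trans S (rep X i) (rep Y (proj₁ (hit i))) (rep X j) (proj₂ (hit i))
      (congr-sym S (rep X j) (rep Y (proj₁ (hit i)))
        (subst (λ k → B (rep X j ⊝ rep Y k)) (sym e) (proj₂ (hit j)))))
    where
    hit : ∀ i → ∃[ k ] B (rep X i ⊝ rep Y k)
    hit i = cover Y (rep X i) (rep∈ X i)

  index-unique : ∀ {n} {A B : Pred (Vector ℤ n) 0ℓ} {M N} → Subgroup B → Index A B M → Index A B N → M ≡ N
  index-unique S X Y = ℕ.≤-antisym (index-≤ S X Y) (index-≤ S Y X)

  index-cong : ∀ {n} {A B C : Pred (Vector ℤ n) 0ℓ} {N} → (∀ {v} → B v → C v) → (∀ {v} → C v → B v) →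
               Index A B N → Index A C N
  index-cong to from X = record
    { rep = rep X
    ; rep∈ = rep∈ X
    ; distinct = λ i j c → distinct X i j (from c)
    ; cover = λ v a → proj₁ (cover X v a) , to (proj₂ (cover X v a))
    }

  index-tower : ∀ {n} {A B C : Pred (Vector ℤ n) 0ℓ} {M N} → Subgroup A → Subgroup B → Subgroup C →
                (∀ {v} → B v → A v) → (∀ {v} → C v → B v) →
                Index A B M → Index B C N → Index A C (M ℕ.* N)
  index-tower {B = B} {C} {M} {N} SA SB SC B⊆A C⊆B X Y = record
    { rep = λ k → r (remQuot {M} N k)
    ; rep∈ = λ k → let i , j = remQuot {M} N k in
        closed SA 1ℤ 1ℤ (rep∈ X i) (B⊆A (rep∈ Y j)) (λ x → one (rep X i x) (rep Y j x))
    ; distinct = λ k l c → trans (sym (combine-remQuot {M} N k))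
        (trans (cong (λ p → combine (proj₁ p) (proj₂ p)) (inj (remQuot {M} N k) (remQuot {M} N l) c))
               (combine-remQuot {M} N l))
    ; cover = cov
    }
    where
    one : ∀ x y → x + y ≡ 1ℤ * x + 1ℤ * y
    one = solve-∀
    r : Fin M × Fin N → Vector ℤ _
    r (i , j) x = rep X i x + rep Y j x
    inj : ∀ p p' → C (r p ⊝ r p') → p ≡ p'
    inj (i , j) (i' , j') c with
      distinct X i i' (closed SB 1ℤ 1ℤ (C⊆B c) (closed SB 1ℤ -1ℤ (rep∈ Y j') (rep∈ Y j) (λ _ → refl))
        (λ x → id₁ (rep X i x) (rep X i' x) (rep Y j x) (rep Y j' x)))
      where
      id₁ : ∀ a a' b b' → a - a' ≡ 1ℤ * ((a + b) - (a' + b')) + 1ℤ * (1ℤ * b' + -1ℤ * b)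
      id₁ = solve-∀
    ... | refl = cong (i ,_) (distinct Y j j' (respects SC c (λ x → id₂ (rep X i x) (rep Y j x) (rep Y j' x))))
      where
      id₂ : ∀ a b b' → b - b' ≡ (a + b) - (a + b')
      id₂ = solve-∀
    cov : ∀ v → _ → ∃[ k ] C (v ⊝ r (remQuot {M} N k))
    cov v a with cover X v a
    ... | i , b with cover Y _ b
    ... | j , c = combine i j ,
      subst (λ p → C (v ⊝ r p)) (sym (remQuot-combine i j))
        (respects SC c (λ x → id₃ (v x) (rep X i x) (rep Y j x)))
      where
      id₃ : ∀ v a b → v - (a + b) ≡ v - a - b
      id₃ = solve-∀

  -- The hypotheses say that `h` induces an isomorphism A / B ≅ A' / B'. Surjectivity is asked only
  -- modulo B', which admits maps such as ℓ that are far from onto.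
  index-transport : ∀ {m n} {A B : Pred (Vector ℤ m) 0ℓ} {A' B' : Pred (Vector ℤ n) 0ℓ} {N}
                    (h : Vector ℤ m → Vector ℤ n) → Linear h → Subgroup B' →
                    (∀ {v} → A v → A' (h v)) → (∀ {v} → B v → B' (h v)) → (∀ {v} → B' (h v) → B v) →
                    (∀ w → A' w → ∃[ v ] (A v × B' (w ⊝ h v))) →
                    Index A B N → Index A' B' N
  index-transport h lin S AA BB BB⁻¹ onto X = record
    { rep = λ i → h (rep X i)
    ; rep∈ = λ i → AA (rep∈ X i)
    ; distinct = λ i j b → distinct X i j (BB⁻¹ (respects S b (f-minus lin (rep X i) (rep X j))))
    ; cover = λ w a → let v , Av , b = onto w a
                          i , c = cover X v Av
                      in i , congr-trans S w (h v) (h (rep X i)) b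
                               (respects S (BB c) (λ x → sym (f-minus lin v (rep X i) x)))
    }

  ∣-residues-injective : ∀ {d a b} → a ℕ.< d → b ℕ.< d → + d ∣ + a - + b → a ≡ b
  ∣-residues-injective {d} {a} {b} a<d b<d d∣ with ∣ + a - + b ∣ in eq
  ... | zero = +-injective (i-j≡0⇒i≡j (+ a) (+ b) (∣i∣≡0⇒i≡0 eq))
  ... | suc k = contradiction (subst (d ℕ∣_) eq (∣⇒∣ᵤ d∣)) (>⇒∤ (ℕ.≤-<-trans bound (ℕ.⊔-lub a<d b<d)))
    where
    bound : suc k ℕ.≤ a ℕ.⊔ b
    bound = subst (ℕ._≤ a ℕ.⊔ b) (trans (cong ∣_∣ (sym (m-n≡m⊖n a b))) eq) (∣m⊝n∣≤m⊔n a b)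

  box : ∀ {n d} → Fin (d ℕ.^ n) → Vector ℤ n
  box k i = + toℕ (finToFun k i)

  box-cover : ∀ {n} d .{{_ : NonZero d}} (v : Vector ℤ n) → ∃[ k ] divisible (+ d) (v ⊝ box k)
  box-cover d v = funToFin f , λ i → divides (v i /ℕ d) (begin
    v i - + toℕ (finToFun (funToFin f) i) ≡⟨ cong (λ x → v i - + toℕ x) (finToFun-funToFin f i) ⟩
    v i - + toℕ (f i) ≡⟨ cong (λ x → v i - + x) (toℕ-fromℕ< (n%ℕd<d (v i) d)) ⟩
    v i - + (v i %ℕ d) ≡⟨ cong (_- + (v i %ℕ d)) (a≡a%ℕn+[a/ℕn]*n (v i) d) ⟩
    + (v i %ℕ d) + (v i /ℕ d) * + d - + (v i %ℕ d) ≡⟨ cancel (+ (v i %ℕ d)) ((v i /ℕ d) * + d) ⟩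
    (v i /ℕ d) * + d ∎)
    where
    open ≡-Reasoning
    f : Fin _ → Fin d
    f i = fromℕ< (n%ℕd<d (v i) d)
    cancel : ∀ x y → x + y - x ≡ y
    cancel = solve-∀

  index-divisible : ∀ n d .{{_ : NonZero d}} → Index {n} U (divisible (+ d)) (d ℕ.^ n)
  index-divisible n d = record
    { rep = box
    ; rep∈ = λ _ → tt
    ; distinct = λ k l div → trans (sym (funToFin-finToFin {n} k)) (trans
        (funToFin-cong (λ i → toℕ-injective (∣-residues-injective (toℕ<n (finToFun {d} {n} k i)) (toℕ<n (finToFun {d} {n} l i)) (div i))))
        (funToFin-finToFin {n} l))
    ; cover = λ v _ → box-cover d v
    }
    where
    funToFin-cong : ∀ {m n} {f g : Fin m → Fin n} → f ≗ g → funToFin f ≡ funToFin g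
    funToFin-cong {zero} e = refl
    funToFin-cong {suc m} e = cong₂ combine (e zero) (funToFin-cong (e ∘ suc))

  -- A finite list that meets every class is thinned to a transversal by keeping a vector only if it
  -- is congruent to none of those kept already. The index must be known to exist before the
  -- equations that determine it can be written.
  index-exists : ∀ {n} {A B : Pred (Vector ℤ n) 0ℓ} {N} → Subgroup B → (∀ v → Dec (B v)) →
                 (f : Fin N → Vector ℤ n) → (∀ i → A (f i)) → (∀ v → A v → ∃[ i ] B (v ⊝ f i)) →
                 ∃[ M ] Index A B M
  index-exists {n} {A} {B} S B? f f∈ cov = let M , g , inj , hit = select _ f in M , record
    { rep = f ∘ g
    ; rep∈ = f∈ ∘ g
    ; distinct = inj
    ; cover = λ v a → let i , b = cov v a
                          k , c = hit i
                      in k , congr-trans S v (f i) (f (g k)) b c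
    }
    where
    select : ∀ N (f : Fin N → Vector ℤ n) → ∃[ M ] Σ (Fin M → Fin N) λ g →
             (∀ i j → B (f (g i) ⊝ f (g j)) → i ≡ j) × (∀ i → ∃[ k ] B (f i ⊝ f (g k)))
    select zero f = 0 , (λ ()) , (λ ()) , (λ ())
    select (suc N) f with select N (f ∘ suc)
    ... | M , g , inj , hit with any? (λ k → B? (f zero ⊝ f (suc (g k))))
    ... | yes (k , b) = M , suc ∘ g , inj , λ { zero → k , b ; (suc i) → hit i }
    ... | no ¬b = suc M , (λ { zero → zero ; (suc k) → suc (g k) }) ,
      (λ { zero zero _ → refl
         ; zero (suc j) b → contradiction (j , b) ¬b
         ; (suc i) zero b → contradiction (i , congr-sym S _ (f zero) b) ¬b
         ; (suc i) (suc j) b → cong suc (inj i j b) }) ,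
      (λ { zero → zero , congr-refl S (f zero) ; (suc i) → suc (proj₁ (hit i)) , proj₂ (hit i) })

-- Integer elimination and a criterion for ℤⁿ / Λ to be free over ℤ/r.

module Freeness where

  open IntegerVectors
  open import Data.Integer using (ℤ; +_; -_; _+_; _-_; _*_; 0ℤ; 1ℤ; -1ℤ)
  open import Data.Integer.Properties using (+-identityˡ; +-identityʳ; *-identityˡ; *-zeroʳ; +-inverseʳ; *-comm)
  open import Data.Integer.DivMod using (_%ℕ_; _/ℕ_; n%ℕd<d; a≡a%ℕn+[a/ℕn]*n)
  open import Data.Integer.Divisibility.Signed using (_∣_; _∣?_; divides; ∣⇒∣ᵤ; ∣-trans; ∣m∣n⇒∣m+n; ∣-refl)
  open import Data.Integer.Tactic.RingSolver using (solve-∀)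
  open import Data.Nat as ℕ using (ℕ; zero; suc; NonZero)
  import Data.Nat.Properties as ℕ
  import Data.Nat.Divisibility as ℕ
  open import Data.Nat.Induction using (<-wellFounded)
  open import Induction.WellFounded using (Acc; acc)
  open import Data.Fin using (Fin; zero; suc)
  open import Data.Fin.Properties using (any?; _≟_; injective⇒≤)
  open import Data.Product using (Σ; ∃-syntax; _×_; _,_; proj₁; proj₂)
  open import Data.Unit using (tt)
  open import Data.Vec.Functional using (Vector; _∷_; tail)
  open import Function using (_∘_; id)
  open import Relation.Nullary using (Dec; yes; no; ¬_; contradiction)
  open import Relation.Nullary.Decidable using (¬?; _×-dec_; decidable-stable)
  open import Relation.Unary using (Pred; U)
  open import Relation.Binary.PropositionalEquality using (_≡_; _≗_; refl; sym; trans; cong; cong₂; subst; module ≡-Reasoning)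
  open import Relation.Binary.Definitions using (tri<; tri≈; tri>)
  open import Level using (0ℓ)

  id-linear : ∀ {n} → Linear {n} id
  id-linear = record { comb = λ a b e → e }

  ∘-linear : ∀ {l m n} {g : Vector ℤ m → Vector ℤ n} {f : Vector ℤ l → Vector ℤ m} →
             Linear g → Linear f → Linear (g ∘ f)
  ∘-linear lg lf = record { comb = λ a b e → comb lg a b (comb lf a b e) }

  tail-linear : ∀ {n} → Linear {suc n} tail
  tail-linear = record { comb = λ a b e i → e (suc i) }

  0∷-linear : ∀ {n} → Linear {n} (0ℤ ∷_)
  0∷-linear = record { comb = λ { a b e zero → sym (trans (cong₂ _+_ (*-zeroʳ a) (*-zeroʳ b)) refl)
                                ; a b e (suc i) → e i } }

  linear-divisible : ∀ {m n} {f : Vector ℤ m → Vector ℤ n} → Linear f → ∀ {d v} → divisible d v → divisible d (f v)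
  linear-divisible {f = f} lin {d} {v} dv i = divides (f q i)
    (trans (f-cong lin (λ j → trans (_∣_.equality (dv j)) (*-comm (q j) d)) i)
      (trans (f-scale lin d q i) (*-comm d (f q i))))
    where
    q : Vector ℤ _
    q j = _∣_.quotient (dv j)

  -- Plays the role of a unimodular matrix: a change of basis of ℤⁿ together with its inverse.
  record Automorphism (n : ℕ) : Set where
    field
      fwd bwd : Vector ℤ n → Vector ℤ n
      fwd-linear : Linear fwd
      bwd-linear : Linear bwd
      fwd-bwd : ∀ u → fwd (bwd u) ≗ u
      bwd-fwd : ∀ u → bwd (fwd u) ≗ u

  open Automorphism

  idᵃ : ∀ {n} → Automorphism n
  idᵃ = record { fwd = id ; bwd = id ; fwd-linear = id-linear ; bwd-linear = id-linear
               ; fwd-bwd = λ _ _ → refl ; bwd-fwd = λ _ _ → refl }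

  _∘ᵃ_ : ∀ {n} → Automorphism n → Automorphism n → Automorphism n
  g ∘ᵃ f = record
    { fwd = fwd g ∘ fwd f
    ; bwd = bwd f ∘ bwd g
    ; fwd-linear = ∘-linear (fwd-linear g) (fwd-linear f)
    ; bwd-linear = ∘-linear (bwd-linear f) (bwd-linear g)
    ; fwd-bwd = λ u i → trans (f-cong (fwd-linear g) (fwd-bwd f (bwd g u)) i) (fwd-bwd g u i)
    ; bwd-fwd = λ u i → trans (f-cong (bwd-linear f) (bwd-fwd g (fwd f u)) i) (bwd-fwd f u i)
    }

  -- One of the two elementary operations of the elimination: it reduces the other coordinates by
  -- multiples of the leading one, and `swap` then brings a smaller remainder to the front.
  shear : ∀ {n} → Vector ℤ n → Automorphism (suc n)
  shear k = record
    { fwd = λ { u zero → u zero ; u (suc j) → u (suc j) - k j * u zero }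
    ; bwd = λ { u zero → u zero ; u (suc j) → u (suc j) + k j * u zero }
    ; fwd-linear = record { comb = λ
        { a b e zero → e zero
        ; {u} {v} a b e (suc j) → trans (cong₂ (λ x y → x - k j * y) (e (suc j)) (e zero))
            (id₁ a b (u (suc j)) (v (suc j)) (k j) (u zero) (v zero)) } }
    ; bwd-linear = record { comb = λ
        { a b e zero → e zero
        ; {u} {v} a b e (suc j) → trans (cong₂ (λ x y → x + k j * y) (e (suc j)) (e zero))
            (id₂ a b (u (suc j)) (v (suc j)) (k j) (u zero) (v zero)) } }
    ; fwd-bwd = λ { u zero → refl ; u (suc j) → id₃ (u (suc j)) (k j * u zero) }
    ; bwd-fwd = λ { u zero → refl ; u (suc j) → id₄ (u (suc j)) (k j * u zero) }
    }
    where
    id₁ : ∀ a b x y k z w → (a * x + b * y) - k * (a * z + b * w) ≡ a * (x - k * z) + b * (y - k * w)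
    id₁ = solve-∀
    id₂ : ∀ a b x y k z w → (a * x + b * y) + k * (a * z + b * w) ≡ a * (x + k * z) + b * (y + k * w)
    id₂ = solve-∀
    id₃ : ∀ x y → x + y - y ≡ x
    id₃ = solve-∀
    id₄ : ∀ x y → x - y + y ≡ x
    id₄ = solve-∀

  swap₀ : ∀ {n} → Fin n → Vector ℤ (suc n) → Vector ℤ (suc n)
  swap₀ j u zero = u (suc j)
  swap₀ j u (suc i) with i ≟ j
  ... | yes _ = u zero
  ... | no _ = u (suc i)

  swap₀-involutive : ∀ {n} (j : Fin n) u → swap₀ j (swap₀ j u) ≗ u
  swap₀-involutive j u zero with j ≟ j
  ... | yes _ = refl
  ... | no ¬e = contradiction refl ¬e
  swap₀-involutive j u (suc i) with i ≟ j in eq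
  ... | yes e = cong (u ∘ suc) (sym e)
  ... | no _ rewrite eq = refl

  swap₀-linear : ∀ {n} (j : Fin n) → Linear (swap₀ j)
  swap₀-linear j = record { comb = λ { a b e zero → e (suc j) ; {u} {v} {w} a b e (suc i) → go {u} {v} {w} a b e i } }
    where
    go : ∀ {u v w} a b → (∀ i → w i ≡ a * u i + b * v i) → ∀ i → swap₀ j w (suc i) ≡ a * swap₀ j u (suc i) + b * swap₀ j v (suc i)
    go a b e i with i ≟ j
    ... | yes _ = e zero
    ... | no _ = e (suc i)

  swap : ∀ {n} → Fin n → Automorphism (suc n)
  swap j = record
    { fwd = swap₀ j ; bwd = swap₀ j ; fwd-linear = swap₀-linear j ; bwd-linear = swap₀-linear j
    ; fwd-bwd = swap₀-involutive j ; bwd-fwd = swap₀-involutive j }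

  residue : ∀ c .{{_ : NonZero c}} a → ¬ (+ c ∣ a) → ∃[ k ] ∃[ m ] (a - k * + c ≡ + m × NonZero m × m ℕ.< c)
  residue c a ¬c∣a with a %ℕ c | n%ℕd<d a c | a≡a%ℕn+[a/ℕn]*n a c
  ... | zero | _ | e = contradiction (divides (a /ℕ c) (trans e (+-identityˡ _))) ¬c∣a
  ... | suc m | lt | e = a /ℕ c , suc m , trans (cong (_- (a /ℕ c) * + c) e) (cancel (+ suc m) ((a /ℕ c) * + c)) , _ , lt
    where
    cancel : ∀ x y → x + y - y ≡ x
    cancel = solve-∀

  -- The first elementary divisor of Λ, found by Euclidean descent on the leading coordinate of a member of Λ.
  record Pivot {n} (Λ : Pred (Vector ℤ (suc n)) 0ℓ) : Set where
    field
      aut : Automorphism (suc n)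
      pivot : Vector ℤ (suc n)
      pivot∈ : Λ pivot
      value : ℕ
      value≢0 : NonZero value
      head≡value : fwd aut pivot zero ≡ + value
      tail≡0 : ∀ j → fwd aut pivot (suc j) ≡ 0ℤ
      value∣Λ : ∀ v → Λ v → divisible (+ value) (fwd aut v)

  module _ {n} (Λ : Pred (Vector ℤ (suc n)) 0ℓ) (S : Subgroup Λ) (Λ? : ∀ v → Dec (Λ v))
           (r : ℕ) {{r≢0 : NonZero r}} (r⊆Λ : ∀ v → divisible (+ r) v → Λ v) where

    private
      -- The claim proved by well-founded induction on c. It is quantified over the basis `ψ` as
      -- well as the member v, because a step may change either of them.
      Descent : ℕ → Set
      Descent c = .{{NonZero c}} → (ψ : Automorphism (suc n)) (v : Vector ℤ (suc n)) → Λ v → fwd ψ v zero ≡ + c → Pivot Λ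

      subtract-multiple : ∀ {v w} → Λ v → Λ w → ∀ k → Λ (λ i → w i - k * v i)
      subtract-multiple {v} {w} Λv Λw k = closed S 1ℤ (- k) Λw Λv (λ i → id₁ (v i) (w i) k)
        where
        id₁ : ∀ v w k → w - k * v ≡ 1ℤ * w + (- k) * v
        id₁ = solve-∀

      fwd-subtract : ∀ (ψ : Automorphism (suc n)) v w k i → fwd ψ (λ j → w j - k * v j) i ≡ fwd ψ w i - k * fwd ψ v i
      fwd-subtract ψ v w k i = trans (comb (fwd-linear ψ) {w} {v} 1ℤ (- k) (λ j → id₁ (v j) (w j) k) i) (sym (id₁ (fwd ψ v i) (fwd ψ w i) k))
        where
        id₁ : ∀ v w k → w - k * v ≡ 1ℤ * w + (- k) * v
        id₁ = solve-∀

      module Step (c : ℕ) {{c≢0 : NonZero c}} (smaller : ∀ {m} → m ℕ.< c → Descent m) where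

        reduce-tail : (ψ : Automorphism (suc n)) (v : Vector ℤ (suc n)) → Λ v → fwd ψ v zero ≡ + c →
                      ∀ j → ¬ (+ c ∣ fwd ψ v (suc j)) → Pivot Λ
        reduce-tail ψ v Λv e j ¬div with residue c (fwd ψ v (suc j)) ¬div
        ... | k , m , em , m≢0 , m<c =
          -- The shear acts on all later coordinates alike, but only coordinate j matters: it
          -- becomes the remainder m, and the swap makes it the leading one.
          smaller m<c {{m≢0}} (swap j ∘ᵃ (shear (λ _ → k) ∘ᵃ ψ)) v Λv (trans (cong (λ x → fwd ψ v (suc j) - k * x) e) em)

        reduce-head : (ψ : Automorphism (suc n)) (v w : Vector ℤ (suc n)) → Λ v → Λ w → fwd ψ v zero ≡ + c →
                      ¬ (+ c ∣ fwd ψ w zero) → Pivot Λ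
        reduce-head ψ v w Λv Λw e ¬div with residue c (fwd ψ w zero) ¬div
        ... | k , m , em , m≢0 , m<c =
          smaller m<c {{m≢0}} ψ _ (subtract-multiple Λv Λw k)
            (trans (fwd-subtract ψ v w k zero) (trans (cong (λ x → fwd ψ w zero - k * x) e) em))

        reduce : (ψ : Automorphism (suc n)) (v w : Vector ℤ (suc n)) → Λ v → Λ w → fwd ψ v zero ≡ + c →
                 (∀ j → fwd ψ v (suc j) ≡ 0ℤ) → ∀ i → ¬ (+ c ∣ fwd ψ w i) → Pivot Λ
        reduce ψ v w Λv Λw e z zero ¬div = reduce-head ψ v w Λv Λw e ¬div
        reduce ψ v w Λv Λw e z (suc j) ¬div with + c ∣? fwd ψ w zero
        ... | no ¬div₀ = reduce-head ψ v w Λv Λw e ¬div₀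
        -- If w has head k c, subtracting (k - 1) v leaves the head c and, because v has zero tail,
        -- the tail of w. The entry not divisible by c then sits in a vector with leading coordinate
        -- c.
        ... | yes (divides k ek) = reduce-tail ψ x (subtract-multiple Λv Λw (k - 1ℤ)) headx j ¬divx
          where
          x : Vector ℤ (suc n)
          x i = w i - (k - 1ℤ) * v i
          headx : fwd ψ x zero ≡ + c
          headx = trans (fwd-subtract ψ v w (k - 1ℤ) zero) (trans (cong₂ (λ a b → a - (k - 1ℤ) * b) ek e) (id₁ k (+ c)))
            where
            id₁ : ∀ k c → k * c - (k - 1ℤ) * c ≡ c
            id₁ = solve-∀
          tailx : fwd ψ x (suc j) ≡ fwd ψ w (suc j)
          tailx = trans (fwd-subtract ψ v w (k - 1ℤ) (suc j)) (trans (cong (λ b → fwd ψ w (suc j) - (k - 1ℤ) * b) (z j)) (id₁ (fwd ψ w (suc j)) k))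
            where
            id₁ : ∀ a k → a - (k - 1ℤ) * 0ℤ ≡ a
            id₁ = solve-∀
          ¬divx : ¬ (+ c ∣ fwd ψ x (suc j))
          ¬divx d = ¬div (subst (+ c ∣_) tailx d)

        finish : (ψ : Automorphism (suc n)) (v : Vector ℤ (suc n)) → Λ v → fwd ψ v zero ≡ + c →
                 (∀ j → fwd ψ v (suc j) ≡ 0ℤ) → Pivot Λ
        finish ψ v Λv e z with + c ∣? + r
        -- In the coordinates of `ψ` this member of Λ has every entry equal to r, so its head is not
        -- divisible by c.
        ... | no c∤r = reduce-head ψ v (bwd ψ (λ _ → + r)) Λv
              (r⊆Λ _ (linear-divisible (bwd-linear ψ) (λ _ → ∣-refl))) e
              (λ d → c∤r (subst (+ c ∣_) (fwd-bwd ψ _ zero) d))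
        -- Once c divides r, divisibility by c depends only on residues modulo r, as does membership
        -- in Λ. Searching the finite box therefore decides whether c divides all of Λ.
        ... | yes c∣r with any? (λ k → Λ? (box {suc n} {r} k) ×-dec any? (λ i → ¬? (+ c ∣? fwd ψ (box k) i)))
        ... | yes (k , Λk , i , ¬div) = reduce ψ v (box k) Λv Λk e z i ¬div
        ... | no none = record
          { aut = ψ ; pivot = v ; pivot∈ = Λv ; value = c ; value≢0 = c≢0 ; head≡value = e ; tail≡0 = z
          ; value∣Λ = all-divisible }
          where
          all-divisible : ∀ w → Λ w → divisible (+ c) (fwd ψ w)
          all-divisible w Λw i = let k , div = box-cover r w in
            subst (+ c ∣_) (trans (cong₂ _+_ (f-minus (fwd-linear ψ) w (box k) i) refl) (id₁ (fwd ψ w i) (fwd ψ (box k) i)))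
              (∣m∣n⇒∣m+n (∣-trans c∣r (linear-divisible (fwd-linear ψ) div i))
                 (decidable-stable (+ c ∣? fwd ψ (box k) i) λ ¬div →
                   none (k , respects S (subtract-multiple (r⊆Λ _ div) Λw 1ℤ) (λ j → id₂ (w j) (box k j)) , i , ¬div)))
            where
            id₁ : ∀ a b → a - b + b ≡ a
            id₁ = solve-∀
            id₂ : ∀ a b → b ≡ a - 1ℤ * (a - b)
            id₂ = solve-∀

        step : Descent c
        step ψ v Λv e with any? (λ j → ¬? (+ c ∣? fwd ψ v (suc j)))
        ... | yes (j , ¬div) = reduce-tail ψ v Λv e j ¬div
        ... | no none = finish (shear k ∘ᵃ ψ) v Λv e λ j →
          trans (cong₂ (λ a b → a - k j * b) (_∣_.equality (div j)) e) (+-inverseʳ (k j * + c))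
          where
          div : ∀ j → + c ∣ fwd ψ v (suc j)
          div j = decidable-stable (+ c ∣? fwd ψ v (suc j)) λ ¬div → none (j , ¬div)
          k : Vector ℤ n
          k j = _∣_.quotient (div j)

      descend : ∀ c → Acc ℕ._<_ c → Descent c
      descend c (acc rs) {{c≢0}} = Step.step c {{ℕ.≢-nonZero (ℕ.≢-nonZero⁻¹ c)}} (λ m<c → descend _ (rs m<c))

    abstract
      find-pivot : Pivot Λ
      find-pivot = descend r (<-wellFounded r) idᵃ (λ _ → + r) (r⊆Λ _ (λ _ → ∣-refl)) refl

  -- The lattice Λ + dℤⁿ.
  _+mod_ : ∀ {n} → Pred (Vector ℤ n) 0ℓ → ℕ → Pred (Vector ℤ n) 0ℓ
  (Λ +mod d) v = ∃[ w ] (Λ w × divisible (+ d) (v ⊝ w))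

  +mod-subgroup : ∀ {n} {Λ : Pred (Vector ℤ n) 0ℓ} → Subgroup Λ → ∀ d → Subgroup (Λ +mod d)
  +mod-subgroup S d = record
    { has-zero = (λ _ → 0ℤ) , has-zero S , λ _ → divides 0ℤ refl
    ; closed = λ { {u} {v} a b (u' , Λu , du) (v' , Λv , dv) e →
        (λ i → a * u' i + b * v' i) , closed S a b Λu Λv (λ _ → refl) ,
        closed (divisible-subgroup (+ d)) a b du dv (λ i → trans (cong (_- (a * u' i + b * v' i)) (e i)) (id₁ a b (u i) (v i) (u' i) (v' i))) }
    }
    where
    id₁ : ∀ a b u v u' v' → a * u + b * v - (a * u' + b * v') ≡ a * (u - u') + b * (v - v')
    id₁ = solve-∀

  ^-injectiveʳ : ∀ c m n → c ℕ.> 1 → c ℕ.^ m ≡ c ℕ.^ n → m ≡ n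
  ^-injectiveʳ c m n c>1 e with ℕ.<-cmp m n
  ... | tri< m<n _ _ = contradiction e (ℕ.<⇒≢ (ℕ.^-monoʳ-< c c>1 m<n))
  ... | tri≈ _ eq _ = eq
  ... | tri> _ _ m>n = contradiction (sym e) (ℕ.<⇒≢ (ℕ.^-monoʳ-< c c>1 m>n))

  -- An isomorphism ℤⁿ / Λ ≅ (ℤ/r)ᵐ, presented by a surjection `φ` onto ℤᵐ for which Λ is the
  -- preimage of rℤᵐ. Integer-valued maps compose along the induction on n and fit the encoding of
  -- `Kp'≅ZmodPow`.
  FreeQuotient : ∀ {n} → Pred (Vector ℤ n) 0ℓ → ℕ → ℕ → Set
  FreeQuotient {n} Λ r m = Σ (Vector ℤ n → Vector ℤ m) λ φ → Linear φ × (∀ c → ∃[ v ] φ v ≗ c) ×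
    (∀ v → Λ v → divisible (+ r) (φ v)) × (∀ v → divisible (+ r) (φ v) → Λ v)

  -- If v ∈ Λ were not divisible by r, translating one representative by v would give rⁿ + 1 classes modulo r.
  index-full : ∀ {n} {Λ : Pred (Vector ℤ n) 0ℓ} → Subgroup Λ → ∀ r .{{_ : NonZero r}} →
               (∀ v → divisible (+ r) v → Λ v) → Index U Λ (r ℕ.^ n) → ∀ v → Λ v → divisible (+ r) v
  index-full {n} {Λ} S r r⊆Λ X v Λv i = decidable-stable (+ r ∣? v i) λ ¬div → ℕ.<-irrefl refl
    (injective⇒≤ {f = proj₁ ∘ hit} λ {k} {l} e → injective ¬div k l
      (congr-trans (divisible-subgroup (+ r)) (f k) (box (proj₁ (hit k))) (f l) (proj₂ (hit k))
        (congr-sym (divisible-subgroup (+ r)) (f l) (box (proj₁ (hit k)))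
          (subst (λ x → divisible (+ r) (f l ⊝ box x)) (sym e) (proj₂ (hit l))))))
    where
    i₀ : Fin (r ℕ.^ n)
    i₀ = proj₁ (cover X (λ _ → 0ℤ) tt)
    f : Fin (suc (r ℕ.^ n)) → Vector ℤ n
    f zero j = rep X i₀ j + v j
    f (suc k) = rep X k
    hit : ∀ k → ∃[ l ] divisible (+ r) (f k ⊝ box {n} {r} l)
    hit k = box-cover r (f k)
    twist : ∀ k → divisible (+ r) (f zero ⊝ rep X k) → i₀ ≡ k
    twist k d = distinct X i₀ k (closed S 1ℤ -1ℤ (r⊆Λ _ d) Λv (λ j → id₁ (rep X i₀ j) (rep X k j) (v j)))
      where
      id₁ : ∀ a b v → a - b ≡ 1ℤ * (a + v - b) + -1ℤ * v
      id₁ = solve-∀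
    clash : ∀ k → divisible (+ r) (f zero ⊝ rep X k) → + r ∣ v i
    clash k d with refl ← twist k d = subst (+ r ∣_) (id₁ (rep X i₀ i) (v i)) (d i)
      where
      id₁ : ∀ a v → a + v - a ≡ v
      id₁ = solve-∀
    injective : ¬ (+ r ∣ v i) → ∀ k l → divisible (+ r) (f k ⊝ f l) → k ≡ l
    injective ¬div zero zero _ = refl
    injective ¬div zero (suc l) d = contradiction (clash l d) ¬div
    injective ¬div (suc k) zero d = contradiction (clash k (congr-sym (divisible-subgroup (+ r)) (rep X k) (f zero) d)) ¬div
    injective ¬div (suc k) (suc l) d = cong suc (distinct X k l (r⊆Λ _ d))

  free-quotient : ∀ n (Λ : Pred (Vector ℤ n) 0ℓ) → Subgroup Λ → (∀ v → Dec (Λ v)) →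
                  ∀ r m → r ℕ.> 1 → (∀ v → divisible (+ r) v → Λ v) →
                  (∀ d → d ℕ.∣ r → Index U (Λ +mod d) (d ℕ.^ m)) → FreeQuotient Λ r m
  free-quotient n Λ S Λ? r m r>1 r⊆Λ indices with n ℕ.≟ m
  -- Since Λ contains rℤⁿ, the lattice Λ + rℤⁿ is Λ itself, so the hypothesis at d = r gives the
  -- index of Λ.
  ... | yes refl = id , id-linear , (λ c → c , λ _ → refl) ,
    index-full S r {{r≢0}} r⊆Λ (index-cong
      (λ { {v} (w , Λw , d) → closed S 1ℤ 1ℤ (r⊆Λ _ d) Λw (λ i → id₁ (v i) (w i)) })
      (λ {v} Λv → v , Λv , congr-refl (divisible-subgroup (+ r)) v)
      (indices r ℕ.∣-refl)) , r⊆Λ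
    where
    r≢0 : NonZero r
    r≢0 = ℕ.>-nonZero (ℕ.<-trans ℕ.z<s r>1)
    id₁ : ∀ v w → v ≡ 1ℤ * (v - w) + 1ℤ * w
    id₁ = solve-∀
  -- In rank 0 the index is 1 = rᵐ, which r > 1 forbids unless m = 0. A rank that starts below m
  -- also ends in this contradiction.
  free-quotient zero Λ S Λ? r m r>1 r⊆Λ indices | no n≢m = contradiction
    (^-injectiveʳ r 0 m r>1 (index-unique (+mod-subgroup S r)
      (index-cong (λ _ → (λ ()) , respects S (has-zero S) (λ ()) , λ ()) (λ _ ()) (index-divisible 0 r {{r≢0}}))
      (indices r ℕ.∣-refl))) n≢m
    where
    r≢0 : NonZero r
    r≢0 = ℕ.>-nonZero (ℕ.<-trans ℕ.z<s r>1)
  free-quotient (suc n) Λ S Λ? r m r>1 r⊆Λ indices | no n≢m =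
    let φ , φ-linear , onto , Λ⇒ , ⇒Λ = free-quotient n Λ₁ S₁ (λ u → Λ? (bwd aut (0ℤ ∷ u))) r m r>1 r⊆Λ₁ indices₁
    in φ ∘ h , ∘-linear φ-linear h-linear ,
       (λ c → let u , e = onto c in bwd aut (0ℤ ∷ u) , λ i → trans (f-cong φ-linear (h-section u) i) (e i)) ,
       (λ v Λv → Λ⇒ (h v) (Λ⇒Λ₁ v Λv)) , (λ v d → Λ₁⇒Λ v (⇒Λ (h v) d))
    where
    instance
      r≢0 : NonZero r
      r≢0 = ℕ.>-nonZero (ℕ.<-trans ℕ.z<s r>1)
    open Pivot (find-pivot Λ S Λ? r r⊆Λ)
    instance
      c≢0 : NonZero value
      c≢0 = value≢0

    value∣r : value ℕ.∣ r
    value∣r = ∣⇒∣ᵤ (subst (+ value ∣_) (fwd-bwd aut _ zero)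
      (value∣Λ _ (r⊆Λ _ (linear-divisible (bwd-linear aut) {+ r} {λ _ → + r} (λ _ → ∣-refl))) zero))

    from-fwd : ∀ d v → divisible d (fwd aut v) → divisible d v
    from-fwd d v div i = subst (d ∣_) (bwd-fwd aut v i) (linear-divisible (bwd-linear aut) div i)

    -- All of Λ lies in cℤⁿ⁺¹ for c = `value`, so Λ + cℤⁿ⁺¹ has index cⁿ⁺¹, while the hypothesis
    -- says cᵐ. As n + 1 ≠ m, this excludes c > 1.
    value≡1 : value ≡ 1
    value≡1 with value ℕ.≟ 1
    ... | yes e = e
    ... | no ¬e = contradiction (^-injectiveʳ value (suc n) m (ℕ.≤∧≢⇒< (ℕ.>-nonZero⁻¹ value) (¬e ∘ sym))
            (index-unique (divisible-subgroup (+ value)) (index-divisible (suc n) value)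
              (index-cong
                (λ { {v} (w , Λw , d) → closed (divisible-subgroup (+ value)) 1ℤ 1ℤ d (from-fwd _ w (value∣Λ w Λw)) (λ i → id₁ (v i) (w i)) })
                (λ {v} d → (λ _ → 0ℤ) , has-zero S , λ i → subst (+ value ∣_) (sym (+-identityʳ (v i))) (d i))
                (indices value value∣r)))) n≢m
      where
      id₁ : ∀ v w → v ≡ 1ℤ * (v - w) + 1ℤ * w
      id₁ = solve-∀

    h : Vector ℤ (suc n) → Vector ℤ n
    h = tail ∘ fwd aut
    h-linear : Linear h
    h-linear = ∘-linear tail-linear (fwd-linear aut)
    lift-linear : Linear (λ u → bwd aut (0ℤ ∷ u))
    lift-linear = ∘-linear (bwd-linear aut) 0∷-linear
    h-section : ∀ u → h (bwd aut (0ℤ ∷ u)) ≗ u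
    h-section u j = fwd-bwd aut (0ℤ ∷ u) (suc j)

    -- The intersection of Λ with the complement of the pivot line. Because the pivot belongs to Λ,
    -- this is also the image of Λ under `h`.
    Λ₁ : Pred (Vector ℤ n) 0ℓ
    Λ₁ u = Λ (bwd aut (0ℤ ∷ u))
    S₁ : Subgroup Λ₁
    S₁ = preimage-subgroup lift-linear S
    r⊆Λ₁ : ∀ u → divisible (+ r) u → Λ₁ u
    r⊆Λ₁ u d = r⊆Λ _ (linear-divisible lift-linear d)

    -- In the new basis the pivot is (1, 0, ..., 0), so removing the right multiple of it leaves a
    -- vector of the complement.
    split : ∀ v → v ≗ (λ i → bwd aut (0ℤ ∷ h v) i + fwd aut v zero * pivot i)
    split v i = begin
      v i ≡⟨ bwd-fwd aut v i ⟨
      bwd aut (fwd aut v) i ≡⟨ comb (bwd-linear aut) 1ℤ (fwd aut v zero) parts i ⟩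
      1ℤ * bwd aut (0ℤ ∷ h v) i + fwd aut v zero * bwd aut (fwd aut pivot) i
        ≡⟨ cong₂ (λ a b → a + fwd aut v zero * b) (*-identityˡ (bwd aut (0ℤ ∷ h v) i)) (bwd-fwd aut pivot i) ⟩
      bwd aut (0ℤ ∷ h v) i + fwd aut v zero * pivot i ∎
      where
      open ≡-Reasoning
      id₁ : ∀ x → x ≡ 1ℤ * 0ℤ + x * 1ℤ
      id₁ = solve-∀
      id₂ : ∀ x y → y ≡ 1ℤ * y + x * 0ℤ
      id₂ = solve-∀
      parts : ∀ i → fwd aut v i ≡ 1ℤ * (0ℤ ∷ h v) i + fwd aut v zero * fwd aut pivot i
      parts zero = trans (id₁ (fwd aut v zero)) (cong (λ x → 1ℤ * 0ℤ + fwd aut v zero * x) (sym (trans head≡value (cong +_ value≡1))))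
      parts (suc j) = trans (id₂ (fwd aut v zero) (h v j)) (cong (λ x → 1ℤ * h v j + fwd aut v zero * x) (sym (tail≡0 j)))

    Λ⇒Λ₁ : ∀ v → Λ v → Λ₁ (h v)
    Λ⇒Λ₁ v Λv = closed S 1ℤ (- fwd aut v zero) Λv pivot∈ λ i →
      trans (id₁ (bwd aut (0ℤ ∷ h v) i) (fwd aut v zero) (pivot i)) (cong (λ x → 1ℤ * x + (- fwd aut v zero) * pivot i) (sym (split v i)))
      where
      id₁ : ∀ b x p → b ≡ 1ℤ * (b + x * p) + (- x) * p
      id₁ = solve-∀
    Λ₁⇒Λ : ∀ v → Λ₁ (h v) → Λ v
    Λ₁⇒Λ v l = closed S 1ℤ (fwd aut v zero) l pivot∈ λ i →
      trans (split v i) (cong (_+ fwd aut v zero * pivot i) (sym (*-identityˡ (bwd aut (0ℤ ∷ h v) i))))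

    -- The kernel of `h` is the pivot line, which lies in Λ; hence `h` identifies the quotients by Λ
    -- + dℤⁿ⁺¹ and by Λ₁ + dℤⁿ.
    indices₁ : ∀ d → d ℕ.∣ r → Index U (Λ₁ +mod d) (d ℕ.^ m)
    indices₁ d d∣r = index-transport h h-linear (+mod-subgroup S₁ d) (λ _ → tt)
      (λ { {v} (w , Λw , div) → h w , Λ⇒Λ₁ w Λw ,
           λ i → subst (+ d ∣_) (f-minus h-linear v w i) (linear-divisible h-linear div i) })
      (λ { {v} (u , Λu , div) →
           (λ i → bwd aut (0ℤ ∷ u) i + fwd aut v zero * pivot i) ,
           closed S 1ℤ (fwd aut v zero) Λu pivot∈ (λ i → cong (_+ fwd aut v zero * pivot i) (sym (*-identityˡ (bwd aut (0ℤ ∷ u) i)))) ,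
           λ i → subst (+ d ∣_) (trans (f-minus lift-linear (h v) u i)
                   (trans (id₁ (bwd aut (0ℤ ∷ h v) i) (bwd aut (0ℤ ∷ u) i) (fwd aut v zero * pivot i))
                     (cong (_- (bwd aut (0ℤ ∷ u) i + fwd aut v zero * pivot i)) (sym (split v i)))))
                 (linear-divisible lift-linear div i) })
      (λ w _ → bwd aut (0ℤ ∷ w) , tt , respects (+mod-subgroup S₁ d) (has-zero (+mod-subgroup S₁ d))
         (λ i → trans (cong (λ x → w i - x) (h-section w i)) (+-inverseʳ (w i))))
      (indices d d∣r)
      where
      id₁ : ∀ a b c → a - b ≡ a + c - (b + c)
      id₁ = solve-∀

-- Indices forced by a quadratic operator conjugate to its complement.

module Spectral where

  open IntegerVectors
  open Freeness
  open import Data.Integer using (ℤ; +_; -_; _+_; _-_; _*_; 0ℤ; 1ℤ; -1ℤ)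
  open import Data.Integer.Properties using (pos-*; *-cancelˡ-≡; *-cancelʳ-≡; *-comm)
  open import Data.Integer.DivMod using (_%ℕ_; _/ℕ_; n%ℕd<d; a≡a%ℕn+[a/ℕn]*n)
  open import Data.Integer.Divisibility.Signed using (_∣_; _∣?_; divides; ∣ᵤ⇒∣; ∣-trans; ∣m∣n⇒∣m-n; ∣m⇒∣m*n; ∣-refl)
  open import Data.Integer.Tactic.RingSolver using (solve-∀)
  open import Data.Nat as ℕ using (ℕ; zero; suc; NonZero)
  import Data.Nat.Properties as ℕ
  import Data.Nat.Divisibility as ℕ
  open import Data.Nat.Tactic.RingSolver using () renaming (solve-∀ to ℕ-solve-∀)
  open import Data.Fin using (Fin; toℕ; fromℕ<)
  open import Data.Fin.Properties using (any?; all?; toℕ-fromℕ<; toℕ-injective; toℕ<n)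
  open import Data.Product using (∃-syntax; _,_; proj₁; proj₂)
  open import Data.Unit using (tt)
  open import Data.Vec.Functional using (Vector)
  open import Relation.Nullary using (Dec; contradiction)
  open import Relation.Nullary.Decidable using (map′)
  open import Relation.Unary using (Pred; U)
  open import Relation.Binary.Definitions using (tri<; tri≈; tri>)
  open import Relation.Binary.PropositionalEquality using (_≡_; _≗_; refl; sym; trans; cong; cong₂; subst; module ≡-Reasoning)
  open import Level using (0ℓ)

  square-injective : ∀ m n → m ℕ.* m ≡ n ℕ.* n → m ≡ n
  square-injective m n e with ℕ.<-cmp m n
  ... | tri< m<n _ _ = contradiction e (ℕ.<⇒≢ (ℕ.*-mono-< m<n m<n))
  ... | tri≈ _ m≡n _ = m≡n
  ... | tri> _ _ m>n = contradiction (sym e) (ℕ.<⇒≢ (ℕ.*-mono-< m>n m>n))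

  *-^ : ∀ m n k → (m ℕ.* n) ℕ.^ k ≡ m ℕ.^ k ℕ.* n ℕ.^ k
  *-^ m n zero = refl
  *-^ m n (suc k) = trans (cong (m ℕ.* n ℕ.*_) (*-^ m n k)) (id₁ m n (m ℕ.^ k) (n ℕ.^ k))
    where
    id₁ : ∀ m n x y → m ℕ.* n ℕ.* (x ℕ.* y) ≡ m ℕ.* x ℕ.* (n ℕ.* y)
    id₁ = ℕ-solve-∀

  -- The graph enters only through ℓ² = qℓ - rq, through the conjugacy of ℓ with q - ℓ by `τ`, and
  -- through a vector `g₀` whose class modulo ℓG has order q.
  module Quadratic
    (r : ℕ) (r>1 : r ℕ.> 1)
    (ℓ : Vector ℤ (4 ℕ.* r) → Vector ℤ (4 ℕ.* r)) (ℓ-linear : Linear ℓ)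
    (quadratic : ∀ u i → ℓ (ℓ u) i ≡ (+ 4 * + r + 1ℤ) * ℓ u i - + r * (+ 4 * + r + 1ℤ) * u i)
    (τ σ : Vector ℤ (4 ℕ.* r) → Vector ℤ (4 ℕ.* r)) (τ-linear : Linear τ) (σ-linear : Linear σ)
    (τσ : ∀ u → τ (σ u) ≗ u) (στ : ∀ u → σ (τ u) ≗ u)
    (τℓ : ∀ u i → τ (ℓ u) i ≡ (+ 4 * + r + 1ℤ) * τ u i - ℓ (τ u) i)
    (g₀ w₀ : Vector ℤ (4 ℕ.* r)) (g₀-multiple : ∀ i → (+ 4 * + r + 1ℤ) * g₀ i ≡ ℓ w₀ i)
    (i₀ : Fin (4 ℕ.* r)) (w₀-unit : w₀ i₀ ≡ -1ℤ)
    where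

    private
      instance
        r≢0 : NonZero r
        r≢0 = ℕ.>-nonZero (ℕ.<-trans ℕ.z<s r>1)

    q : ℕ
    q = suc (4 ℕ.* r)

    ρ Q : ℤ
    ρ = + r
    Q = + 4 * ρ + 1ℤ

    +q≡Q : + q ≡ Q
    +q≡Q = trans (cong +_ (ℕ.+-comm 1 (4 ℕ.* r))) (cong (_+ 1ℤ) (pos-* 4 r))

    cancel-Q : ∀ {x y} → Q * x ≡ Q * y → x ≡ y
    cancel-Q {x} {y} e = *-cancelˡ-≡ (+ q) x y (trans (cong (_* x) +q≡Q) (trans e (cong (_* y) (sym +q≡Q))))

    cancel-ρ : ∀ {x y} → ρ * x ≡ ρ * y → x ≡ y
    cancel-ρ {x} {y} e = *-cancelˡ-≡ ρ x y {{r≢0}} e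

    -- On functions of sum zero J vanishes, so this is L' = q - J - L there.
    ℓ' : Vector ℤ (4 ℕ.* r) → Vector ℤ (4 ℕ.* r)
    ℓ' u i = Q * u i - ℓ u i

    ℓ'-linear : Linear ℓ'
    ℓ'-linear = record { comb = λ {u} {v} a b e i →
      trans (cong₂ (λ x y → Q * x - y) (e i) (comb ℓ-linear a b e i)) (id₁ Q a b (u i) (v i) (ℓ u i) (ℓ v i)) }
      where
      id₁ : ∀ q a b u v x y → q * (a * u + b * v) - (a * x + b * y) ≡ a * (q * u - x) + b * (q * v - y)
      id₁ = solve-∀

    ℓ'ℓ : ∀ u i → ℓ' (ℓ u) i ≡ ρ * Q * u i
    ℓ'ℓ u i = trans (cong (λ x → Q * ℓ u i - x) (quadratic u i)) (id₁ (Q * ℓ u i) (ρ * Q * u i))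
      where
      id₁ : ∀ a b → a - (a - b) ≡ b
      id₁ = solve-∀

    ℓℓ' : ∀ u i → ℓ (ℓ' u) i ≡ ρ * Q * u i
    ℓℓ' u i = trans (comb ℓ-linear {u} {ℓ u} Q -1ℤ (λ j → id₁ (Q * u j) (ℓ u j)) i)
      (trans (cong (λ x → Q * ℓ u i + -1ℤ * x) (quadratic u i)) (id₂ (Q * ℓ u i) (ρ * Q * u i)))
      where
      id₁ : ∀ x y → x - y ≡ x + -1ℤ * y
      id₁ = solve-∀
      id₂ : ∀ a b → a + -1ℤ * (a - b) ≡ b
      id₂ = solve-∀

    Λ : ℕ → Pred (Vector ℤ (4 ℕ.* r)) 0ℓ
    Λ d v = divisible (+ d) (ℓ' v)

    Λ-subgroup : ∀ d → Subgroup (Λ d)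
    Λ-subgroup d = preimage-subgroup ℓ'-linear (divisible-subgroup (+ d))

    Λ? : ∀ d v → Dec (Λ d v)
    Λ? d v = all? (λ i → + d ∣? ℓ' v i)

    -- ℓ and ℓ' are conjugate and Λ d / d ≅ G / {v : d ∣ ℓ v} via ℓ, so both factors of
    -- [G : dG] = [G : Λ d] [Λ d : dG] are equal.
    index-Λ : ∀ d .{{_ : NonZero d}} → (∀ u → divisible (+ d) (ℓ' (ℓ u))) →
              (∀ v → Λ d v → ∃[ w ] divisible (+ d) (v ⊝ ℓ w)) → Index U (Λ d) (d ℕ.^ (2 ℕ.* r))
    index-Λ d ℓ'ℓ-div lift = subst (Index U (Λ d)) M≡ X
      where
      exists : ∃[ M ] Index U (Λ d) M
      exists = index-exists {N = d ℕ.^ (4 ℕ.* r)} (Λ-subgroup d) (Λ? d) (box {d = d}) (λ _ → tt)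
        (λ v _ → let k , div = box-cover d v in k , linear-divisible ℓ'-linear {+ d} {v ⊝ box k} div)
      M : ℕ
      M = proj₁ exists
      X : Index U (Λ d) M
      X = proj₂ exists
      τℓσ : ∀ v → τ (ℓ (σ v)) ≗ ℓ' v
      τℓσ v i = trans (τℓ (σ v) i) (f-cong ℓ'-linear (τσ v) i)
      ℓσ : ∀ v → ℓ (σ v) ≗ σ (ℓ' v)
      ℓσ v i = trans (sym (στ (ℓ (σ v)) i)) (f-cong σ-linear (τℓσ v) i)
      X' : Index U (λ v → divisible (+ d) (ℓ v)) M
      X' = index-transport σ σ-linear (preimage-subgroup ℓ-linear (divisible-subgroup (+ d))) (λ _ → tt)
        (λ {v} div i → subst (+ d ∣_) (sym (ℓσ v i)) (linear-divisible σ-linear {v = ℓ' v} div i))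
        (λ {v} div i → subst (+ d ∣_) (τℓσ v i) (linear-divisible τ-linear {v = ℓ (σ v)} div i))
        (λ w _ → τ w , tt , respects S' (congr-refl S' w) (λ i → cong (λ x → w i - x) (στ w i)))
        X
        where
        S' : Subgroup (λ v → divisible (+ d) (ℓ v))
        S' = preimage-subgroup ℓ-linear (divisible-subgroup (+ d))
      Y : Index (Λ d) (divisible (+ d)) M
      Y = index-transport ℓ ℓ-linear (divisible-subgroup (+ d)) (λ {v} _ → ℓ'ℓ-div v) (λ div → div) (λ div → div)
        (λ w Λw → let u , div = lift w Λw in u , tt , div) X'
      M≡ : M ≡ d ℕ.^ (2 ℕ.* r)
      M≡ = square-injective M (d ℕ.^ (2 ℕ.* r)) (trans
        (index-unique (divisible-subgroup (+ d))
          (index-tower U-subgroup (Λ-subgroup d) (divisible-subgroup (+ d)) (λ _ → tt) (linear-divisible ℓ'-linear) X Y)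
          (index-divisible (4 ℕ.* r) d))
        (trans (cong (d ℕ.^_) (id₁ r)) (ℕ.^-distribˡ-+-* d (2 ℕ.* r) (2 ℕ.* r))))
        where
        id₁ : ∀ r → 4 ℕ.* r ≡ 2 ℕ.* r ℕ.+ 2 ℕ.* r
        id₁ = ℕ-solve-∀

    -- Modulo a divisor d of r one has q = 4r + 1 ≡ 1, so ℓ' v = q v - ℓ v ≡ v - ℓ v. On Λ d the
    -- operator ℓ is therefore the identity modulo d.
    v≡ℓv-modΛ : ∀ d → + d ∣ ρ → ∀ v → Λ d v → divisible (+ d) (v ⊝ ℓ v)
    v≡ℓv-modΛ d d∣ρ v Λv i = subst (+ d ∣_) (id₁ ρ (v i) (ℓ v i)) (∣m∣n⇒∣m-n (Λv i) (∣m⇒∣m*n (+ 4 * v i) d∣ρ))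
      where
      id₁ : ∀ ρ v x → ((+ 4 * ρ + 1ℤ) * v - x) - ρ * (+ 4 * v) ≡ v - x
      id₁ = solve-∀

    ∣ρ⇒∣ℓ'ℓ : ∀ d → + d ∣ ρ → ∀ u → divisible (+ d) (ℓ' (ℓ u))
    ∣ρ⇒∣ℓ'ℓ d d∣ρ u i = subst (+ d ∣_) (sym (ℓ'ℓ u i)) (∣m⇒∣m*n (u i) (∣m⇒∣m*n Q d∣ρ))

    index-Λ-divisor : ∀ d → d ℕ.∣ r → Index U (Λ d) (d ℕ.^ (2 ℕ.* r))
    index-Λ-divisor d d∣r = index-Λ d {{d≢0}} (∣ρ⇒∣ℓ'ℓ d (∣ᵤ⇒∣ d∣r)) (λ v Λv → v , v≡ℓv-modΛ d (∣ᵤ⇒∣ d∣r) v Λv)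
      where
      d≢0 : NonZero d
      d≢0 = ℕ.≢-nonZero λ { refl → ℕ.≢-nonZero⁻¹ r (ℕ.0∣⇒≡0 d∣r) }

    -- Applying ℓ to ℓ' v = rq u gives rq v = rq ℓ u, because ℓ ℓ' = rq. Together with `ℓ'ℓ-rq` this
    -- identifies Λ (rq) with ℓG.
    Λrq-image : ∀ v → Λ (r ℕ.* q) v → ∃[ u ] v ≗ ℓ u
    Λrq-image v div = u , λ i → cancel-Q (cancel-ρ (begin
      ρ * (Q * v i) ≡⟨ id₁ ρ Q (v i) ⟩
      ρ * Q * v i ≡⟨ ℓℓ' v i ⟨
      ℓ (ℓ' v) i ≡⟨ f-cong ℓ-linear (λ j → trans (_∣_.equality (div j)) (trans (*-comm (u j) (+ (r ℕ.* q))) (cong (_* u j) rq))) i ⟩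
      ℓ (λ j → ρ * Q * u j) i ≡⟨ f-scale ℓ-linear (ρ * Q) u i ⟩
      ρ * Q * ℓ u i ≡⟨ id₁ ρ Q (ℓ u i) ⟨
      ρ * (Q * ℓ u i) ∎))
      where
      open ≡-Reasoning
      u : Vector ℤ (4 ℕ.* r)
      u j = _∣_.quotient (div j)
      rq : + (r ℕ.* q) ≡ ρ * Q
      rq = trans (pos-* r q) (cong (ρ *_) +q≡Q)
      id₁ : ∀ a b c → a * (b * c) ≡ a * b * c
      id₁ = solve-∀

    ℓ'ℓ-rq : ∀ u → Λ (r ℕ.* q) (ℓ u)
    ℓ'ℓ-rq u i = divides (u i) (trans (ℓ'ℓ u i) (trans (cong (_* u i) (sym rq)) (*-comm (+ (r ℕ.* q)) (u i))))
      where
      rq : + (r ℕ.* q) ≡ ρ * Q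
      rq = trans (pos-* r q) (cong (ρ *_) +q≡Q)

    index-Λrq : Index U (Λ (r ℕ.* q)) ((r ℕ.* q) ℕ.^ (2 ℕ.* r))
    index-Λrq = index-Λ (r ℕ.* q) {{ℕ.m*n≢0 r q}} ℓ'ℓ-rq
      λ v Λv → let u , e = Λrq-image v Λv in u , respects S (congr-refl S v) (λ i → cong (λ x → v i - x) (sym (e i)))
      where
      S : Subgroup (divisible {4 ℕ.* r} (+ (r ℕ.* q)))
      S = divisible-subgroup (+ (r ℕ.* q))

    Λr-free : FreeQuotient (Λ r) r (2 ℕ.* r)
    Λr-free = free-quotient (4 ℕ.* r) (Λ r) (Λ-subgroup r) (Λ? r) r (2 ℕ.* r) r>1
      (λ v div → linear-divisible ℓ'-linear {v = v} div)
      (λ d d∣r → index-cong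
        -- For d dividing r the lattice Λ r + dG is Λ d. The witness ℓ v lies in Λ r because ℓ' ℓ =
        -- rq, and it is congruent to v modulo d.
        (λ {v} Λv → ℓ v , ∣ρ⇒∣ℓ'ℓ r ∣-refl v , v≡ℓv-modΛ d (∣ᵤ⇒∣ d∣r) v Λv)
        (λ { {v} (w , Λw , div) → closed (Λ-subgroup d) 1ℤ 1ℤ (linear-divisible ℓ'-linear {v = v ⊝ w} div)
               (λ i → ∣-trans (∣ᵤ⇒∣ {+ d} {ρ} d∣r) (Λw i)) (λ i → id₁ (v i) (w i)) })
        (index-Λ-divisor d d∣r))
      where
      id₁ : ∀ v w → v ≡ 1ℤ * (v - w) + 1ℤ * w
      id₁ = solve-∀

    -- The image of L in coordinates: an integer function is a multiple of a point mass plus a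
    -- function of sum zero, and `g₀` is the image of that point mass.
    Image : Pred (Vector ℤ (4 ℕ.* r)) 0ℓ
    Image v = ∃[ c ] ∃[ w ] (∀ i → v i ≡ c * g₀ i + ℓ w i)

    image-subgroup : Subgroup Image
    image-subgroup = record
      { has-zero = 0ℤ , (λ _ → 0ℤ) , λ i → sym (trans (cong (λ x → 0ℤ * g₀ i + x) (f-scale ℓ-linear 0ℤ (λ _ → 0ℤ) i)) (id₁ (g₀ i) (ℓ (λ _ → 0ℤ) i)))
      ; closed = λ { {u} {v} a b (c , w , e) (c' , w' , e') f → a * c + b * c' , (λ i → a * w i + b * w' i) , λ i →
          trans (f i) (trans (cong₂ (λ x y → a * x + b * y) (e i) (e' i))
            (trans (id₂ a b c c' (g₀ i) (ℓ w i) (ℓ w' i)) (cong (λ x → (a * c + b * c') * g₀ i + x) (sym (comb ℓ-linear a b (λ _ → refl) i))))) }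
      }
      where
      id₁ : ∀ a b → 0ℤ * a + 0ℤ * b ≡ 0ℤ
      id₁ = solve-∀
      id₂ : ∀ a b c c' g x y → a * (c * g + x) + b * (c' * g + y) ≡ (a * c + b * c') * g + (a * x + b * y)
      id₂ = solve-∀

    ℓ∈Image : ∀ u {v} → v ≗ ℓ u → Image v
    ℓ∈Image u {v} e = 0ℤ , u , λ i → trans (e i) (id₁ (g₀ i) (ℓ u i))
      where
      id₁ : ∀ g x → x ≡ 0ℤ * g + x
      id₁ = solve-∀

    Λrq⊆Image : ∀ v → Λ (r ℕ.* q) v → Image v
    Λrq⊆Image v Λv = let u , e = Λrq-image v Λv in ℓ∈Image u e

    -- Multiplied by q, the left side becomes ℓ' ℓ w₀ = rq w₀. This places `g₀`, and with it all of
    -- `Image`, inside Λ r.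
    ℓ'g₀ : ∀ i → ℓ' g₀ i ≡ ρ * w₀ i
    ℓ'g₀ i = cancel-Q (begin
      Q * ℓ' g₀ i ≡⟨ f-scale ℓ'-linear Q g₀ i ⟨
      ℓ' (λ j → Q * g₀ j) i ≡⟨ f-cong ℓ'-linear g₀-multiple i ⟩
      ℓ' (ℓ w₀) i ≡⟨ ℓ'ℓ w₀ i ⟩
      ρ * Q * w₀ i ≡⟨ id₁ ρ Q (w₀ i) ⟩
      Q * (ρ * w₀ i) ∎)
      where
      open ≡-Reasoning
      id₁ : ∀ a b c → a * b * c ≡ b * (a * c)
      id₁ = solve-∀

    Image⊆Λr : ∀ v → Image v → Λ r v
    Image⊆Λr v (c , w , e) i = divides (c * w₀ i + Q * w i) (begin
      ℓ' v i ≡⟨ comb ℓ'-linear {g₀} {ℓ w} c 1ℤ (λ j → trans (e j) (id₁ (c * g₀ j) (ℓ w j))) i ⟩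
      c * ℓ' g₀ i + 1ℤ * ℓ' (ℓ w) i ≡⟨ cong₂ (λ x y → c * x + 1ℤ * y) (ℓ'g₀ i) (ℓ'ℓ w i) ⟩
      c * (ρ * w₀ i) + 1ℤ * (ρ * Q * w i) ≡⟨ id₂ c ρ (w₀ i) Q (w i) ⟩
      (c * w₀ i + Q * w i) * ρ ∎)
      where
      open ≡-Reasoning
      id₁ : ∀ x y → x + y ≡ x + 1ℤ * y
      id₁ = solve-∀
      id₂ : ∀ c ρ w Q x → c * (ρ * w) + 1ℤ * (ρ * Q * x) ≡ (c * w + Q * x) * ρ
      id₂ = solve-∀

    -- If ℓ' v = r u, then rq v = ℓ ℓ' v = r ℓ u, so q v = ℓ u. Hence q annihilates Λ r / Image,
    -- which makes that quotient a p-group once q is a power of p.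
    QΛr⊆Image : ∀ v → Λ r v → Image (λ i → Q * v i)
    QΛr⊆Image v Λv = ℓ∈Image u λ i → cancel-ρ (begin
      ρ * (Q * v i) ≡⟨ id₁ ρ Q (v i) ⟩
      ρ * Q * v i ≡⟨ ℓℓ' v i ⟨
      ℓ (ℓ' v) i ≡⟨ f-cong ℓ-linear (λ j → trans (_∣_.equality (Λv j)) (*-comm (u j) ρ)) i ⟩
      ℓ (λ j → ρ * u j) i ≡⟨ f-scale ℓ-linear ρ u i ⟩
      ρ * ℓ u i ∎)
      where
      open ≡-Reasoning
      u : Vector ℤ (4 ℕ.* r)
      u j = _∣_.quotient (Λv j)
      id₁ : ∀ a b c → a * (b * c) ≡ a * b * c
      id₁ = solve-∀

    ρQ∈Image : ∀ v → Image (λ i → ρ * Q * v i)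
    ρQ∈Image v = ℓ∈Image (ℓ' v) (λ i → sym (ℓℓ' v i))

    ℓ-injective : ∀ u v → ℓ u ≗ ℓ v → u ≗ v
    ℓ-injective u v e i = cancel-Q (cancel-ρ (trans (id₁ ρ Q (u i)) (trans (sym (ℓ'ℓ u i)) (trans (f-cong ℓ'-linear e i) (trans (ℓ'ℓ v i) (sym (id₁ ρ Q (v i))))))))
      where
      id₁ : ∀ a b c → a * (b * c) ≡ a * b * c
      id₁ = solve-∀

    -- Modulo ℓG = Λ (rq), `Image` is cyclic on `g₀`, and q g₀ = ℓ w₀. If (a - b) g₀ = ℓ u,
    -- injectivity of ℓ gives (a - b) w₀ = q u, and the entry -1 of `w₀` makes q divide a - b.
    index-Image-Λrq : Index Image (Λ (r ℕ.* q)) q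
    index-Image-Λrq = record
      { rep = λ k i → + toℕ k * g₀ i
      ; rep∈ = λ k → + toℕ k , (λ _ → 0ℤ) , λ i → sym (trans (cong (λ x → + toℕ k * g₀ i + x) (f-scale ℓ-linear 0ℤ (λ _ → 0ℤ) i)) (id₁ (+ toℕ k * g₀ i) (ℓ (λ _ → 0ℤ) i)))
      ; distinct = λ k l Λv → toℕ-injective (∣-residues-injective (toℕ<n k) (toℕ<n l) (q∣ (+ toℕ k) (+ toℕ l) Λv))
      ; cover = λ { v (c , w , e) → fromℕ< (n%ℕd<d c q) , respects (Λ-subgroup (r ℕ.* q))
          (ℓ'ℓ-rq (λ i → (c /ℕ q) * w₀ i + 1ℤ * w i)) (λ i → begin
            v i - + toℕ (fromℕ< (n%ℕd<d c q)) * g₀ i ≡⟨ cong₂ (λ x y → x - + y * g₀ i) (trans (e i) (cong (λ x → x * g₀ i + ℓ w i) (a≡a%ℕn+[a/ℕn]*n c q))) (toℕ-fromℕ< (n%ℕd<d c q)) ⟩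
            (+ (c %ℕ q) + (c /ℕ q) * + q) * g₀ i + ℓ w i - + (c %ℕ q) * g₀ i ≡⟨ id₂ (+ (c %ℕ q)) (c /ℕ q) (+ q) (g₀ i) (ℓ w i) ⟩
            (c /ℕ q) * (+ q * g₀ i) + 1ℤ * ℓ w i ≡⟨ cong (λ x → (c /ℕ q) * x + 1ℤ * ℓ w i) (trans (cong (_* g₀ i) +q≡Q) (g₀-multiple i)) ⟩
            (c /ℕ q) * ℓ w₀ i + 1ℤ * ℓ w i ≡⟨ comb ℓ-linear (c /ℕ q) 1ℤ (λ _ → refl) i ⟨
            ℓ (λ i → (c /ℕ q) * w₀ i + 1ℤ * w i) i ∎) }
      }
      where
      open ≡-Reasoning
      id₁ : ∀ x y → x + 0ℤ * y ≡ x
      id₁ = solve-∀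
      id₂ : ∀ m k q g x → (m + k * q) * g + x - m * g ≡ k * (q * g) + 1ℤ * x
      id₂ = solve-∀
      q∣ : ∀ a b → Λ (r ℕ.* q) (λ i → a * g₀ i - b * g₀ i) → + q ∣ a - b
      q∣ a b Λv = let u , e = Λrq-image _ Λv in divides (- u i₀) (begin
        a - b ≡⟨ id₃ a b ⟩
        - ((a - b) * -1ℤ) ≡⟨ cong (λ x → - ((a - b) * x)) w₀-unit ⟨
        - ((a - b) * w₀ i₀) ≡⟨ cong -_ (ℓ-injective (λ i → (a - b) * w₀ i) (λ i → Q * u i) (λ i → begin
            ℓ (λ i → (a - b) * w₀ i) i ≡⟨ f-scale ℓ-linear (a - b) w₀ i ⟩
            (a - b) * ℓ w₀ i ≡⟨ cong ((a - b) *_) (g₀-multiple i) ⟨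
            (a - b) * (Q * g₀ i) ≡⟨ id₄ a b Q (g₀ i) ⟩
            Q * (a * g₀ i - b * g₀ i) ≡⟨ cong (Q *_) (e i) ⟩
            Q * ℓ u i ≡⟨ f-scale ℓ-linear Q u i ⟨
            ℓ (λ i → Q * u i) i ∎) i₀) ⟩
        - (Q * u i₀) ≡⟨ id₅ Q (u i₀) ⟩
        - u i₀ * Q ≡⟨ cong (- u i₀ *_) +q≡Q ⟨
        - u i₀ * + q ∎)
        where
        id₃ : ∀ a b → a - b ≡ - ((a - b) * -1ℤ)
        id₃ = solve-∀
        id₄ : ∀ a b q g → (a - b) * (q * g) ≡ q * (a * g - b * g)
        id₄ = solve-∀
        id₅ : ∀ q u → - (q * u) ≡ - u * q
        id₅ = solve-∀

    -- An existential over integers and vectors cannot be searched directly, so `Image` is decided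
    -- as the union of q cosets of the decidable Λ (rq).
    Image? : ∀ v → Dec (Image v)
    Image? v = map′
      (λ { (k , Λv) → closed image-subgroup 1ℤ 1ℤ (Λrq⊆Image _ Λv) (rep∈ index-Image-Λrq k) (λ i → id₁ (v i) (rep index-Image-Λrq k i)) })
      (cover index-Image-Λrq v)
      (any? (λ k → Λ? (r ℕ.* q) (v ⊝ rep index-Image-Λrq k)))
      where
      id₁ : ∀ v w → v ≡ 1ℤ * (v - w) + 1ℤ * w
      id₁ = solve-∀

    index-Λr-Image : Index (Λ r) Image (q ℕ.^ (2 ℕ.* r ℕ.∸ 1))
    index-Λr-Image = subst (Index (Λ r) Image) N≡ X
      where
      exists : ∃[ N ] Index (Λ r) Image N
      -- Scaling the box by -4r puts it inside Λ r without losing a class. For v in Λ r, q v lies in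
      -- `Image`, so v ≡ -4r v; and if rq divides v - b, then v - b lies in `Image`, so -4r v ≡ -4r
      -- b.
      exists = index-exists {N = (r ℕ.* q) ℕ.^ (4 ℕ.* r)} image-subgroup Image? (λ k i → - (+ 4 * ρ) * box {d = r ℕ.* q} k i)
        (λ k → linear-divisible ℓ'-linear {v = λ i → - (+ 4 * ρ) * box {d = r ℕ.* q} k i}
                 (λ i → divides (- (+ 4) * box {d = r ℕ.* q} k i) (id₁ ρ (box {d = r ℕ.* q} k i))))
        (λ v Λv → let k , div = box-cover (r ℕ.* q) {{ℕ.m*n≢0 r q}} v in k ,
          closed image-subgroup 1ℤ (- (+ 4 * ρ)) (QΛr⊆Image v Λv)
            (respects image-subgroup (ρQ∈Image (λ i → _∣_.quotient (div i))) (λ i → trans (_∣_.equality (div i))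
              (trans (*-comm (_∣_.quotient (div i)) (+ (r ℕ.* q))) (cong (_* _∣_.quotient (div i)) rq))))
            (λ i → id₂ ρ (v i) (box {d = r ℕ.* q} k i)))
        where
        id₁ : ∀ ρ b → - (+ 4 * ρ) * b ≡ - (+ 4) * b * ρ
        id₁ = solve-∀
        id₂ : ∀ ρ v b → v - - (+ 4 * ρ) * b ≡ 1ℤ * ((+ 4 * ρ + 1ℤ) * v) + - (+ 4 * ρ) * (v - b)
        id₂ = solve-∀
        rq : + (r ℕ.* q) ≡ ρ * Q
        rq = trans (pos-* r q) (cong (ρ *_) +q≡Q)
      N : ℕ
      N = proj₁ exists
      X : Index (Λ r) Image N
      X = proj₂ exists
      N≡ : N ≡ q ℕ.^ (2 ℕ.* r ℕ.∸ 1)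
      N≡ = ℕ.*-cancelʳ-≡ N (q ℕ.^ (2 ℕ.* r ℕ.∸ 1)) q (ℕ.*-cancelˡ-≡ (N ℕ.* q) (q ℕ.^ (2 ℕ.* r ℕ.∸ 1) ℕ.* q) (r ℕ.^ (2 ℕ.* r)) {{ℕ.m^n≢0 r (2 ℕ.* r)}} (begin
        r ℕ.^ (2 ℕ.* r) ℕ.* (N ℕ.* q)
          ≡⟨ index-unique (Λ-subgroup (r ℕ.* q))
               (index-tower U-subgroup (Λ-subgroup r) (Λ-subgroup (r ℕ.* q)) (λ _ → tt) (λ {v} Λv → Image⊆Λr v (Λrq⊆Image v Λv))
                 (index-Λ-divisor r ℕ.∣-refl)
                 (index-tower (Λ-subgroup r) image-subgroup (Λ-subgroup (r ℕ.* q)) (λ {v} → Image⊆Λr v) (λ {v} → Λrq⊆Image v) X index-Image-Λrq))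
               index-Λrq ⟩
        (r ℕ.* q) ℕ.^ (2 ℕ.* r) ≡⟨ *-^ r q (2 ℕ.* r) ⟩
        r ℕ.^ (2 ℕ.* r) ℕ.* q ℕ.^ (2 ℕ.* r) ≡⟨ cong (r ℕ.^ (2 ℕ.* r) ℕ.*_) (trans (cong (q ℕ.^_) (sym (ℕ.m+[n∸m]≡n {1} {2 ℕ.* r} (ℕ.>-nonZero⁻¹ (2 ℕ.* r) {{ℕ.m*n≢0 2 r}})))) (ℕ.*-comm q (q ℕ.^ (2 ℕ.* r ℕ.∸ 1)))) ⟩
        r ℕ.^ (2 ℕ.* r) ℕ.* (q ℕ.^ (2 ℕ.* r ℕ.∸ 1) ℕ.* q) ∎))
        where open ≡-Reasoning

-- Binomial coefficients divisible by a prime.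

module BinomialPrime where

  open import Data.Nat using (zero; suc; _*_; _∸_; _<_; _!)
  open import Data.Nat.Properties
  open import Data.Nat.Divisibility using (_∣_; m∣m*n; ∣1⇒≡1; >⇒∤)
  open import Data.Nat.DivMod using (m/n*n≡m)
  open import Data.Nat.Primality using (Prime; euclidsLemma; ¬prime[1]; ¬prime[0])
  open import Data.Nat.Combinatorics using (_C_; nCk≡n!/k![n-k]!; k![n∸k]!∣n!)
  open import Data.Sum using (inj₁; inj₂)
  open import Relation.Nullary using (¬_; contradiction)
  open import Relation.Binary.PropositionalEquality using (_≡_; refl; sym; trans; cong; subst)

  prime∤! : ∀ {p} → Prime p → ∀ m → m < p → ¬ (p ∣ m !)
  prime∤! pp zero m<p p∣1 with refl ← ∣1⇒≡1 p∣1 = ¬prime[1] pp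
  prime∤! pp (suc m) m<p p∣ with euclidsLemma (suc m) (m !) pp p∣
  ... | inj₁ p∣m = >⇒∤ m<p p∣m
  ... | inj₂ p∣m! = prime∤! pp m (<-trans (n<1+n m) m<p) p∣m!

  prime∣binomial : ∀ {p} → Prime p → ∀ k → 0 < k → k < p → p ∣ p C k
  prime∣binomial {zero} pp = contradiction pp ¬prime[0]
  prime∣binomial {suc m} pp k 0<k k<p with euclidsLemma (suc m C k) (k ! * (suc m ∸ k) !) pp p∣
    where
    C*k! : (suc m C k) * (k ! * (suc m ∸ k) !) ≡ suc m !
    C*k! = trans (cong (_* (k ! * (suc m ∸ k) !)) (nCk≡n!/k![n-k]! (<⇒≤ k<p)))
      (m/n*n≡m {{k !* (suc m ∸ k) !≢0}} (k![n∸k]!∣n! (<⇒≤ k<p)))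
    p∣ : suc m ∣ (suc m C k) * (k ! * (suc m ∸ k) !)
    p∣ = subst (suc m ∣_) (sym C*k!) (m∣m*n (m !))
  ... | inj₁ d = d
  ... | inj₂ d with euclidsLemma (k !) ((suc m ∸ k) !) pp d
  ... | inj₁ d' = contradiction d' (prime∤! pp k k<p)
  ... | inj₂ d' = contradiction d' (prime∤! pp (suc m ∸ k) (∸-monoʳ-< 0<k (<⇒≤ k<p)))

-- Finite fields: characteristic, Frobenius and the order of a primitive element.

module FieldArithmetic where

  open BinomialPrime
  open import Algebra.Bundles using (CommutativeRing)
  import Algebra.Properties.Group as GroupProperties
  import Algebra.Properties.Ring as RingProperties
  import Algebra.Properties.Semiring.Sum as Sum
  import Algebra.Properties.Semiring.Exp as Exp
  import Algebra.Properties.Semiring.Mult as Mult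
  import Algebra.Properties.CommutativeSemiring.Exp as CommutativeExp
  import Algebra.Properties.CommutativeSemiring.Binomial as Binomial
  open import Data.Nat as ℕ using (ℕ; zero; suc; NonZero; _∸_)
  import Data.Nat.Properties as ℕ
  open import Data.Nat.Divisibility using (_∣_; divides; m%n≡0⇒n∣m)
  open import Data.Nat.DivMod using (_%_; _/_; m≡m%n+[m/n]*n; m%n<n)
  open import Data.Nat.Primality using (Prime; ¬prime[0])
  open import Data.Nat.Combinatorics using (_C_; nCn≡1)
  open import Data.Fin using (Fin; zero; suc; toℕ; fromℕ; fromℕ<; inject₁; punchIn; punchOut)
  open import Data.Fin.Properties using (toℕ-fromℕ<; toℕ-fromℕ; toℕ-inject₁; toℕ<n; punchInᵢ≢i; punchIn-injective; punchOut-injective; pigeonhole; injective⇒≤)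
  open import Data.Fin.Permutation using (permutation)
  open import Data.Product using (∃-syntax; _,_; proj₁; proj₂)
  open import Function.Bundles using (Inverse)
  open import Relation.Nullary using (yes; no; contradiction)
  open import Relation.Binary.PropositionalEquality using (_≡_; _≢_; refl; sym; trans; cong; cong₂; subst; module ≡-Reasoning)
  open import Level using (0ℓ)

  module Field {n} (F : FiniteField (suc n)) where

    open FiniteField F public
    open Inverse enum using (to; from) public

    to-from : ∀ x → to (from x) ≡ x
    to-from x = Inverse.inverseˡ enum refl

    from-to : ∀ i → from (to i) ≡ i
    from-to i = Inverse.inverseʳ enum refl

    ring : CommutativeRing 0ℓ 0ℓ
    ring = record { isCommutativeRing = isCommutativeRing }

    open CommutativeRing ring public using (+-assoc; +-comm; +-identityˡ; +-identityʳ; *-assoc; *-comm; *-identityˡ; *-identityʳ; zeroˡ; zeroʳ; -‿inverseʳ; semiring; commutativeSemiring; +-group)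
    open RingProperties (CommutativeRing.ring ring) public using (-1*x≈-x; x[y-z]≈xy-xz)
    open GroupProperties +-group public using () renaming (⁻¹-involutive to -‿involutive; x∙y⁻¹≈ε⇒x≈y to x-y≡0⇒x≡y; ∙-cancelʳ to +-cancelʳ; //-rightDividesˡ to x-y+y≡x; ε⁻¹≈ε to -0≡0)

    *-cancel-0 : ∀ {x y} → x * y ≡ 0# → x ≢ 0# → y ≡ 0#
    *-cancel-0 {x} {y} xy≡0 x≢0 = let x⁻¹ , e = inverse x x≢0 in begin
      y ≡⟨ *-identityˡ y ⟨
      1# * y ≡⟨ cong (_* y) (trans (*-comm x⁻¹ x) e) ⟨
      x⁻¹ * x * y ≡⟨ *-assoc x⁻¹ x y ⟩
      x⁻¹ * (x * y) ≡⟨ cong (x⁻¹ *_) xy≡0 ⟩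
      x⁻¹ * 0# ≡⟨ zeroʳ x⁻¹ ⟩
      0# ∎
      where open ≡-Reasoning

    *-cancelˡ : ∀ {x y z} → x ≢ 0# → x * y ≡ x * z → y ≡ z
    *-cancelˡ {x} {y} {z} x≢0 e = x-y≡0⇒x≡y y z (*-cancel-0 (trans (x[y-z]≈xy-xz x y z)
      (trans (cong (_- x * z) e) (-‿inverseʳ (x * z)))) x≢0)

    ^≡ : ∀ x k → x ^ k ≡ Exp._^_ semiring x k
    ^≡ x zero = refl
    ^≡ x (suc k) = cong (x *_) (^≡ x k)

    ^-+ : ∀ x k l → x ^ (k ℕ.+ l) ≡ x ^ k * x ^ l
    ^-+ x k l = trans (^≡ x (k ℕ.+ l)) (trans (Exp.^-homo-* semiring x k l) (sym (cong₂ _*_ (^≡ x k) (^≡ x l))))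

    ^-* : ∀ x k l → (x ^ k) ^ l ≡ x ^ (k ℕ.* l)
    ^-* x k l = trans (trans (^≡ (x ^ k) l) (cong (λ y → Exp._^_ semiring y l) (^≡ x k)))
      (trans (Exp.^-assocʳ semiring x k l) (sym (^≡ x (k ℕ.* l))))

    ^-distrib-* : ∀ x y k → (x * y) ^ k ≡ x ^ k * y ^ k
    ^-distrib-* x y k = trans (^≡ (x * y) k) (trans (CommutativeExp.^-distrib-* commutativeSemiring x y k) (sym (cong₂ _*_ (^≡ x k) (^≡ y k))))

    1^ : ∀ k → 1# ^ k ≡ 1#
    1^ zero = refl
    1^ (suc k) = trans (*-identityˡ (1# ^ k)) (1^ k)

    ^≢0 : ∀ {x} → x ≢ 0# → ∀ k → x ^ k ≢ 0#
    ^≢0 x≢0 zero e = 0≢1 (sym e)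
    ^≢0 x≢0 (suc k) e = ^≢0 x≢0 k (*-cancel-0 e x≢0)

    0^ : ∀ k .{{_ : NonZero k}} → 0# ^ k ≡ 0#
    0^ (suc k) = zeroˡ (0# ^ k)

    open Mult semiring using (×1-homo-*; ×-assoc-*; ×-assocˡ; ×-congʳ) renaming (_×_ to _·_)

    -- Translation by 1 permutes F, so ∑ x = ∑ (x + 1) = ∑ x + q · 1.
    cardinality·1≡0 : suc n · 1# ≡ 0#
    cardinality·1≡0 = +-cancelʳ (S.sum to) (suc n · 1#) 0# (begin
      suc n · 1# + S.sum to ≡⟨ +-comm (suc n · 1#) (S.sum to) ⟩
      S.sum to + suc n · 1# ≡⟨ cong (S.sum to +_) (S.sum-replicate (suc n)) ⟨
      S.sum to + S.sum {suc n} (λ _ → 1#) ≡⟨ S.∑-distrib-+ to (λ _ → 1#) ⟨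
      S.sum (λ i → to i + 1#) ≡⟨ S.sum-cong-≗ (λ i → to-from (to i + 1#)) ⟨
      S.sum (λ i → to (from (to i + 1#))) ≡⟨ S.sum-permute to shift ⟨
      S.sum to ≡⟨ +-identityˡ (S.sum to) ⟨
      0# + S.sum to ∎)
      where
      open ≡-Reasoning
      module S = Sum semiring
      shift = permutation (λ i → from (to i + 1#)) (λ i → from (to i - 1#))
        (λ i → trans (cong from (trans (cong (_+ 1#) (to-from (to i - 1#))) (x-y+y≡x 1# (to i)))) (from-to i))
        (λ i → trans (cong from (trans (cong (_- 1#) (to-from (to i + 1#))) (trans (+-assoc (to i) 1# (- 1#)) (trans (cong (to i +_) (-‿inverseʳ 1#)) (+-identityʳ (to i)))))) (from-to i))

    -- If p · 1 were nonzero, its k-th power would be nonzero too; but that power is pᵏ · 1 = q · 1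
    -- = 0.
    characteristic : ∀ p k → suc n ≡ p ℕ.^ k → p · 1# ≡ 0#
    characteristic p k e with p · 1# ≟ 0#
    ... | yes p1≡0 = p1≡0
    ... | no p1≢0 = contradiction (trans (sym (power k)) (trans (cong (_· 1#) (sym e)) cardinality·1≡0)) (^≢0 p1≢0 k)
      where
      power : ∀ k → (p ℕ.^ k) · 1# ≡ (p · 1#) ^ k
      power zero = +-identityʳ 1#
      power (suc k) = trans (×1-homo-* p (p ℕ.^ k)) (cong (p · 1# *_) (power k))

    module Characteristic {p} (p-prime : Prime p) (p1≡0 : p · 1# ≡ 0#) where

      p·≡0 : ∀ x → p · x ≡ 0#
      p·≡0 x = begin
        p · x ≡⟨ ×-congʳ p (*-identityˡ x) ⟨
        p · (1# * x) ≡⟨ ×-assoc-* p 1# x ⟨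
        p · 1# * x ≡⟨ cong (_* x) p1≡0 ⟩
        0# * x ≡⟨ zeroˡ x ⟩
        0# ∎
        where open ≡-Reasoning

      frobenius-+ : ∀ x y → (x + y) ^ p ≡ x ^ p + y ^ p
      frobenius-+ x y = go p p-prime p·≡0 (λ k → prime∣binomial p-prime k)
        where
        open ≡-Reasoning
        module S = Sum semiring
        go : ∀ p → Prime p → (∀ x → p · x ≡ 0#) → (∀ k → 0 ℕ.< k → k ℕ.< p → p ∣ p C k) → (x + y) ^ p ≡ x ^ p + y ^ p
        go zero pp _ _ = contradiction pp ¬prime[0]
        go (suc m) pp p·≡0 p∣ = begin
          (x + y) ^ suc m ≡⟨ ^≡ (x + y) (suc m) ⟩
          Exp._^_ semiring (x + y) (suc m) ≡⟨ Binomial.theorem commutativeSemiring (suc m) x y ⟩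
          term zero + S.sum (λ i → term (suc i)) ≡⟨ cong (term zero +_) (S.sum-init-last (λ i → term (suc i))) ⟩
          term zero + (S.sum (λ i → term (suc (inject₁ i))) + term (suc (fromℕ m)))
            ≡⟨ cong₂ (λ a b → a + (b + term (suc (fromℕ m)))) first (trans (S.sum-cong-≗ middle) (S.sum-replicate-zero m)) ⟩
          y ^ suc m + (0# + term (suc (fromℕ m))) ≡⟨ cong (y ^ suc m +_) (trans (+-identityˡ _) last) ⟩
          y ^ suc m + x ^ suc m ≡⟨ +-comm (y ^ suc m) (x ^ suc m) ⟩
          x ^ suc m + y ^ suc m ∎
          where
          term : Fin (suc (suc m)) → Carrier
          term = Binomial.binomialTerm commutativeSemiring x y (suc m)
          first : term zero ≡ y ^ suc m
          first = trans (+-identityʳ _) (trans (*-identityˡ _) (sym (^≡ y (suc m))))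
          middle : ∀ i → term (suc (inject₁ i)) ≡ 0#
          middle i = multiple≡0 (Binomial.binomial commutativeSemiring x y (suc m) (suc (inject₁ i)))
            (p∣ (suc (toℕ (inject₁ i))) ℕ.z<s (ℕ.s≤s (subst (ℕ._< m) (sym (toℕ-inject₁ i)) (toℕ<n i))))
            where
            multiple≡0 : ∀ {k} z → suc m ∣ k → k · z ≡ 0#
            multiple≡0 z (divides k refl) = trans (cong (_· z) (ℕ.*-comm k (suc m))) (trans (sym (×-assocˡ z (suc m) k)) (p·≡0 (k · z)))
          last : term (suc (fromℕ m)) ≡ x ^ suc m
          last = begin
            term (suc (fromℕ m)) ≡⟨ cong (λ k → (suc m C suc k) · (Exp._^_ semiring x (suc k) * Exp._^_ semiring y (m ∸ k))) (toℕ-fromℕ m) ⟩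
            (suc m C suc m) · (Exp._^_ semiring x (suc m) * Exp._^_ semiring y (m ∸ m)) ≡⟨ cong₂ (λ k l → k · (Exp._^_ semiring x (suc m) * Exp._^_ semiring y l)) (nCn≡1 (suc m)) (ℕ.n∸n≡0 m) ⟩
            1 · (Exp._^_ semiring x (suc m) * 1#) ≡⟨ +-identityʳ _ ⟩
            Exp._^_ semiring x (suc m) * 1# ≡⟨ *-identityʳ _ ⟩
            Exp._^_ semiring x (suc m) ≡⟨ ^≡ x (suc m) ⟨
            x ^ suc m ∎

    module Primitive (β : Carrier) (β-primitive : IsPrimitive β) where

      β≢0 : β ≢ 0#
      β≢0 = proj₁ β-primitive

      log : ∀ x → x ≢ 0# → ∃[ k ] β ^ k ≡ x
      log = proj₂ β-primitive

      ^-mod : ∀ m .{{_ : NonZero m}} → β ^ m ≡ 1# → ∀ k → β ^ k ≡ β ^ (k % m)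
      ^-mod m βᵐ≡1 k = begin
        β ^ k ≡⟨ cong (β ^_) (m≡m%n+[m/n]*n k m) ⟩
        β ^ (k % m ℕ.+ k / m ℕ.* m) ≡⟨ ^-+ β (k % m) (k / m ℕ.* m) ⟩
        β ^ (k % m) * β ^ (k / m ℕ.* m) ≡⟨ cong (λ l → β ^ (k % m) * β ^ l) (ℕ.*-comm (k / m) m) ⟩
        β ^ (k % m) * β ^ (m ℕ.* (k / m)) ≡⟨ cong (β ^ (k % m) *_) (^-* β m (k / m)) ⟨
        β ^ (k % m) * (β ^ m) ^ (k / m) ≡⟨ cong (λ x → β ^ (k % m) * x ^ (k / m)) βᵐ≡1 ⟩
        β ^ (k % m) * 1# ^ (k / m) ≡⟨ cong (β ^ (k % m) *_) (1^ (k / m)) ⟩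
        β ^ (k % m) * 1# ≡⟨ *-identityʳ (β ^ (k % m)) ⟩
        β ^ (k % m) ∎
        where open ≡-Reasoning

      -- The n nonzero elements are all powers of β, and when βᵐ = 1 their exponents must be
      -- distinct modulo m.
      order≥ : ∀ m .{{_ : NonZero m}} → β ^ m ≡ 1# → n ℕ.≤ m
      order≥ m βᵐ≡1 = injective⇒≤ {f = λ i → fromℕ< (m%n<n (exponent i) m)} λ {i} {j} e →
        punchIn-injective (from 0#) i j (trans (sym (from-to _)) (trans (cong from (same i j
          (trans (sym (toℕ-fromℕ< (m%n<n (exponent i) m))) (trans (cong toℕ e) (toℕ-fromℕ< (m%n<n (exponent j) m)))))) (from-to _)))
        where
        element : Fin n → Carrier
        element i = to (punchIn (from 0#) i)
        element≢0 : ∀ i → element i ≢ 0#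
        element≢0 i e = punchInᵢ≢i (from 0#) i (trans (sym (from-to _)) (cong from e))
        exponent : Fin n → ℕ
        exponent i = proj₁ (log (element i) (element≢0 i))
        reduced : ∀ i → element i ≡ β ^ (exponent i % m)
        reduced i = trans (sym (proj₂ (log (element i) (element≢0 i)))) (^-mod m βᵐ≡1 (exponent i))
        same : ∀ i j → exponent i % m ≡ exponent j % m → element i ≡ element j
        same i j e = trans (reduced i) (trans (cong (β ^_) e) (sym (reduced j)))

      ^-cancel : ∀ i j → β ^ i ≡ β ^ (i ℕ.+ j) → β ^ j ≡ 1#
      ^-cancel i j e = *-cancelˡ (^≢0 β≢0 i) (trans (sym (^-+ β i j)) (trans (sym e) (sym (*-identityʳ (β ^ i)))))

      -- Among the n + 1 powers β⁰, ..., βⁿ of the n nonzero elements two coincide, so βᵈ = 1 for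
      -- some positive d ≤ n; `order≥` then forces d = n.
      βⁿ≡1 : β ^ n ≡ 1#
      βⁿ≡1 with pigeonhole (ℕ.n<1+n n) (λ i → punchOut (power≢0 (toℕ i)))
        where
        power≢0 : ∀ k → from 0# ≢ from (β ^ k)
        power≢0 k e = ^≢0 β≢0 k (trans (sym (to-from (β ^ k))) (trans (cong to (sym e)) (to-from 0#)))
      ... | i , j , i<j , e = subst (λ k → β ^ k ≡ 1#) (ℕ.≤-antisym d≤n (order≥ d {{ℕ.>-nonZero (ℕ.m<n⇒0<n∸m i<j)}} βᵈ≡1)) βᵈ≡1
        where
        d : ℕ
        d = toℕ j ∸ toℕ i
        d≤n : d ℕ.≤ n
        d≤n = ℕ.≤-trans (ℕ.m∸n≤m (toℕ j) (toℕ i)) (ℕ.≤-pred (toℕ<n j))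
        βᵈ≡1 : β ^ d ≡ 1#
        βᵈ≡1 = ^-cancel (toℕ i) d (trans
          (trans (sym (to-from _)) (trans (cong to (punchOut-injective {i = from 0#} _ _ e)) (to-from _)))
          (cong (β ^_) (sym (ℕ.m+[n∸m]≡n (ℕ.<⇒≤ i<j)))))

      order∣ : .{{_ : NonZero n}} → ∀ m → β ^ m ≡ 1# → n ∣ m
      order∣ m e with m % n in eq | m%n<n m n
      ... | zero | _ = m%n≡0⇒n∣m m n eq
      ... | suc k | lt = contradiction (order≥ (suc k) (trans (cong (β ^_) (sym eq)) (trans (sym (^-mod n βⁿ≡1 m)) e))) (ℕ.<⇒≱ lt)

-- Fourth-power classes and the convolution of S' with its complement.

module Cyclotomy where

  open FieldArithmetic
  open import Data.Nat as ℕ using (ℕ; zero; suc; NonZero; _∸_)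
  import Data.Nat.Properties as ℕ
  open import Data.Nat.Divisibility as ℕ using (divides)
  open import Data.Nat.Primality using (Prime; prime⇒nonZero)
  open import Data.Nat.Tactic.RingSolver using () renaming (solve-∀ to ℕ-solve-∀)
  open import Data.Integer as ℤ using (ℤ; +_; 0ℤ; 1ℤ; -1ℤ) renaming (_+_ to infixl 6 _⊕_; _-_ to infixl 6 _⊖_; _*_ to infixl 7 _⊗_)
  import Data.Integer.Properties as ℤ
  open import Data.Integer.Tactic.RingSolver using (solve-∀)
  import Algebra.Properties.Semiring.Sum ℤ.+-*-semiring as ℤ-Sum
  open import Data.Bool using (if_then_else_)
  open import Data.Fin using (Fin; zero; suc; punchIn)
  open import Data.Fin.Properties using (punchInᵢ≢i)
  open import Data.Fin.Permutation using (permutation)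
  open import Data.Product using (∃-syntax; _,_; proj₁; proj₂)
  open import Data.Sum using (inj₁; inj₂)
  open import Function using (_∘_)
  open import Relation.Nullary using (Dec; yes; no; ¬_; contradiction; does)
  open import Relation.Binary.PropositionalEquality using (_≡_; _≢_; _≗_; refl; sym; trans; cong; cong₂; subst; module ≡-Reasoning)

  module Summation {n} (F : FiniteField (suc n)) where

    open Field F

    abstract
      ∑ : (Carrier → ℤ) → ℤ
      ∑ f = ℤ-Sum.sum (f ∘ to)

      ∑-def : ∀ f → ∑ f ≡ ℤ-Sum.sum (f ∘ to)
      ∑-def f = refl

      ∑-cong : ∀ {f g : Carrier → ℤ} → f ≗ g → ∑ f ≡ ∑ g
      ∑-cong e = ℤ-Sum.sum-cong-≗ (e ∘ to)

      ∑-+ : ∀ f g → ∑ (λ x → f x ⊕ g x) ≡ ∑ f ⊕ ∑ g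
      ∑-+ f g = ℤ-Sum.∑-distrib-+ (f ∘ to) (g ∘ to)

      ∑-*ˡ : ∀ c f → ∑ (λ x → c ⊗ f x) ≡ c ⊗ ∑ f
      ∑-*ˡ c f = sym (ℤ-Sum.*-distribˡ-sum c (f ∘ to))

      ∑-comb : ∀ a b f g → ∑ (λ x → a ⊗ f x ⊕ b ⊗ g x) ≡ a ⊗ ∑ f ⊕ b ⊗ ∑ g
      ∑-comb a b f g = trans (∑-+ (λ x → a ⊗ f x) (λ x → b ⊗ g x)) (cong₂ _⊕_ (∑-*ˡ a f) (∑-*ˡ b g))

      ∑-comm : ∀ (f : Carrier → Carrier → ℤ) → ∑ (λ x → ∑ (f x)) ≡ ∑ (λ y → ∑ (λ x → f x y))
      ∑-comm f = ℤ-Sum.∑-comm (λ i j → f (to i) (to j))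

      ∑-const : ∀ c → ∑ (λ _ → c) ≡ + suc n ⊗ c
      ∑-const c = go (suc n)
        where
        id₁ : ∀ m c → c ⊕ m ⊗ c ≡ (1ℤ ⊕ m) ⊗ c
        id₁ = solve-∀
        go : ∀ m → ℤ-Sum.sum {m} (λ _ → c) ≡ + m ⊗ c
        go zero = sym (ℤ.*-zeroˡ c)
        go (suc m) = trans (cong (λ x → c ⊕ x) (go m)) (id₁ (+ m) c)

      ∑-reindex : ∀ (g g⁻¹ : Carrier → Carrier) → (∀ x → g (g⁻¹ x) ≡ x) → (∀ x → g⁻¹ (g x) ≡ x) → ∀ f → ∑ (f ∘ g) ≡ ∑ f
      ∑-reindex g g⁻¹ gg⁻¹ g⁻¹g f = sym (trans (ℤ-Sum.sum-permute (f ∘ to)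
        (permutation (from ∘ g ∘ to) (from ∘ g⁻¹ ∘ to) (inv g g⁻¹ gg⁻¹) (inv g⁻¹ g g⁻¹g)))
        (ℤ-Sum.sum-cong-≗ (λ i → cong f (to-from (g (to i))))))
        where
        inv : ∀ (g h : Carrier → Carrier) → (∀ x → g (h x) ≡ x) → ∀ i → from (g (to (from (h (to i))))) ≡ i
        inv g h gh i = trans (cong (from ∘ g) (to-from (h (to i)))) (trans (cong from (gh (to i))) (from-to i))

      ∑-single : ∀ a f → (∀ x → x ≢ a → f x ≡ 0ℤ) → ∑ f ≡ f a
      ∑-single a f z = begin
        ∑ f ≡⟨ ℤ-Sum.sum-remove {i = from a} (f ∘ to) ⟩
        f (to (from a)) ⊕ ℤ-Sum.sum (λ j → f (to (punchIn (from a) j)))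
          ≡⟨ cong₂ _⊕_ (cong f (to-from a)) (trans (ℤ-Sum.sum-cong-≗ (λ j → z _ (away j))) (ℤ-Sum.sum-replicate-zero n)) ⟩
        f a ⊕ 0ℤ ≡⟨ ℤ.+-identityʳ (f a) ⟩
        f a ∎
        where
        open ≡-Reasoning
        away : ∀ j → to (punchIn (from a) j) ≢ a
        away j e = punchInᵢ≢i (from a) j (trans (sym (from-to _)) (cong from e))

  indicator : ∀ {P : Set} (P? : Dec P) {x} → (P → x ≡ 1ℤ) → (¬ P → x ≡ 0ℤ) → (if does P? then 1ℤ else 0ℤ) ≡ x
  indicator (yes z) e _ = sym (e z)
  indicator (no ¬z) _ e = sym (e ¬z)

  -- The indicator of S' read on exponents: βⁱ lies in C₀ or βC₀ exactly when i is 0 or 1 modulo 4.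
  σ : ℕ → ℤ
  σ 0 = 1ℤ
  σ 1 = 1ℤ
  σ 2 = 0ℤ
  σ 3 = 0ℤ
  σ (suc (suc (suc (suc i)))) = σ i

  σ-period : ∀ k i → σ (4 ℕ.* k ℕ.+ i) ≡ σ i
  σ-period zero i = refl
  σ-period (suc k) i = trans (cong σ (id₁ k i)) (σ-period k i)
    where
    id₁ : ∀ k i → 4 ℕ.* suc k ℕ.+ i ≡ 4 ℕ.+ (4 ℕ.* k ℕ.+ i)
    id₁ = ℕ-solve-∀

  σ-shift : ∀ i → σ (2 ℕ.+ i) ≡ 1ℤ ⊖ σ i
  σ-shift 0 = refl
  σ-shift 1 = refl
  σ-shift 2 = refl
  σ-shift 3 = refl
  σ-shift (suc (suc (suc (suc i)))) = σ-shift i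

  -- Modulo 4, both 3i ∈ {0, 1} and i + 1 ∈ {0, 1} mean i ∈ {0, 3}.
  σ-triple : ∀ i → σ (3 ℕ.* i) ≡ σ (1 ℕ.+ i)
  σ-triple 0 = refl
  σ-triple 1 = refl
  σ-triple 2 = refl
  σ-triple 3 = refl
  σ-triple (suc (suc (suc (suc i)))) = trans (cong σ (id₁ i)) (trans (σ-period 3 (3 ℕ.* i)) (σ-triple i))
    where
    id₁ : ∀ i → 3 ℕ.* (4 ℕ.+ i) ≡ 4 ℕ.* 3 ℕ.+ 3 ℕ.* i
    id₁ = ℕ-solve-∀

  module Indicator (r : ℕ) (r≢0 : NonZero r) (r' : ℕ) (r≡2r' : r ≡ 2 ℕ.* r')
    (F : FiniteField (suc (4 ℕ.* r))) (β : FiniteField.Carrier F) (β-primitive : FiniteField.IsPrimitive F β)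
    (p k t : ℕ) (p-prime : Prime p) (p≡4k+3 : p ≡ 4 ℕ.* k ℕ.+ 3) (q≡pᵗ : suc (4 ℕ.* r) ≡ p ℕ.^ suc t) where

    open Field F
    open Primitive β β-primitive
    open Characteristic p-prime (characteristic p (suc t) q≡pᵗ)
    open Summation F

    private
      instance
        n≢0 : NonZero (4 ℕ.* r)
        n≢0 = ℕ.m*n≢0 4 r {{_}} {{r≢0}}

    -- The order 4r of β is a multiple of the period of `σ`, so `σ` descends from exponents to
    -- nonzero field elements.
    σ-unique-≤ : ∀ i j → i ℕ.≤ j → β ^ i ≡ β ^ j → σ i ≡ σ j
    σ-unique-≤ i j i≤j e with order∣ (j ∸ i) (^-cancel i (j ∸ i) (trans e (cong (β ^_) (sym (ℕ.m+[n∸m]≡n i≤j)))))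
    ... | divides c eq = sym (trans (cong σ (trans (sym (ℕ.m∸n+n≡m i≤j)) (cong (ℕ._+ i) (trans eq (id₁ c r))))) (σ-period (c ℕ.* r) i))
      where
      id₁ : ∀ c r → c ℕ.* (4 ℕ.* r) ≡ 4 ℕ.* (c ℕ.* r)
      id₁ = ℕ-solve-∀

    σ-unique : ∀ i j → β ^ i ≡ β ^ j → σ i ≡ σ j
    σ-unique i j e with ℕ.≤-total i j
    ... | inj₁ i≤j = σ-unique-≤ i j i≤j e
    ... | inj₂ j≤i = sym (σ-unique-≤ j i j≤i (sym e))

    abstract
      s : Carrier → ℤ
      s x = if does (InS'? β x) then 1ℤ else 0ℤ

      s-def : ∀ x → s x ≡ (if does (InS'? β x) then 1ℤ else 0ℤ)
      s-def x = refl

      δ : Carrier → ℤ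
      δ x = if does (x ≟ 0#) then 1ℤ else 0ℤ

      δ-0 : δ 0# ≡ 1ℤ
      δ-0 = indicator (0# ≟ 0#) (λ _ → refl) (λ ne → contradiction refl ne)

      δ-≢0 : ∀ {x} → x ≢ 0# → δ x ≡ 0ℤ
      δ-≢0 {x} x≢0 = indicator (x ≟ 0#) (λ e → contradiction e x≢0) (λ _ → refl)

    -- The indicator of β²S', the connection set of the complementary graph.
    s' : Carrier → ℤ
    s' x = 1ℤ ⊖ δ x ⊖ s x

    4th-power : ∀ {x} → x ≢ 0# → ∃[ j ] x ^ 4 ≡ β ^ (4 ℕ.* j)
    4th-power {x} x≢0 = let j , e = log x x≢0 in
      j , trans (cong (_^ 4) (sym e)) (trans (^-* β j 4) (cong (β ^_) (ℕ.*-comm j 4)))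

    InS'⇒σ : ∀ i → InS' β (β ^ i) → σ i ≡ 1ℤ
    InS'⇒σ i (inj₁ (x , x≢0 , e)) = let j , e' = 4th-power x≢0 in
      trans (σ-unique i (4 ℕ.* j ℕ.+ 0) (trans (sym e) (trans e' (cong (β ^_) (sym (ℕ.+-identityʳ (4 ℕ.* j))))))) (σ-period j 0)
    InS'⇒σ i (inj₂ (c , (x , x≢0 , e) , e₁)) = let j , e' = 4th-power x≢0 in
      trans (σ-unique i (4 ℕ.* j ℕ.+ 1) (trans (sym e₁) (trans (cong (β *_) (trans (sym e) e')) (cong (β ^_) (ℕ.+-comm 1 (4 ℕ.* j)))))) (σ-period j 1)

    InC₀-β⁴ : ∀ {z} → InC₀ z → InC₀ (β ^ 4 * z)
    InC₀-β⁴ (x , x≢0 , e) = β * x , (λ βx≡0 → x≢0 (*-cancel-0 βx≡0 β≢0)) , trans (^-distrib-* β x 4) (cong (β ^ 4 *_) e)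

    InS'-β⁴ : ∀ i → InS' β (β ^ i) → InS' β (β ^ (4 ℕ.+ i))
    InS'-β⁴ i (inj₁ z) = inj₁ (subst InC₀ (sym (^-+ β 4 i)) (InC₀-β⁴ z))
    InS'-β⁴ i (inj₂ (c , z , e)) = inj₂ (β ^ 4 * c , InC₀-β⁴ z , (begin
      β * (β ^ 4 * c) ≡⟨ *-assoc β (β ^ 4) c ⟨
      β * β ^ 4 * c ≡⟨ cong (_* c) (*-comm β (β ^ 4)) ⟩
      β ^ 4 * β * c ≡⟨ *-assoc (β ^ 4) β c ⟩
      β ^ 4 * (β * c) ≡⟨ cong (β ^ 4 *_) e ⟩
      β ^ 4 * β ^ i ≡⟨ ^-+ β 4 i ⟨
      β ^ (4 ℕ.+ i) ∎))
      where open ≡-Reasoning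

    σ⇒InS' : ∀ i → σ i ≡ 1ℤ → InS' β (β ^ i)
    σ⇒InS' 0 _ = inj₁ (1# , 0≢1 ∘ sym , 1^ 4)
    σ⇒InS' 1 _ = inj₂ (1# , (1# , 0≢1 ∘ sym , 1^ 4) , refl)
    σ⇒InS' (suc (suc (suc (suc i)))) e = InS'-β⁴ i (σ⇒InS' i e)

    σ-values : ∀ i → σ i ≢ 1ℤ → σ i ≡ 0ℤ
    σ-values 0 ne = contradiction refl ne
    σ-values 1 ne = contradiction refl ne
    σ-values 2 ne = refl
    σ-values 3 ne = refl
    σ-values (suc (suc (suc (suc i)))) ne = σ-values i ne

    s-power : ∀ i → s (β ^ i) ≡ σ i
    s-power i = trans (s-def (β ^ i)) (indicator (InS'? β (β ^ i)) (InS'⇒σ i) (λ ¬z → σ-values i (¬z ∘ σ⇒InS' i)))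

    ¬InS'-0 : ¬ InS' β 0#
    ¬InS'-0 (inj₁ (x , x≢0 , e)) = ^≢0 x≢0 4 e
    ¬InS'-0 (inj₂ (c , (x , x≢0 , e) , e₁)) = ^≢0 x≢0 4 (trans e (*-cancel-0 e₁ β≢0))

    s-0 : s 0# ≡ 0ℤ
    s-0 = trans (s-def 0#) (indicator (InS'? β 0#) (λ z → contradiction z ¬InS'-0) (λ _ → refl))

    -- Identities between functions on the field are checked at 0 and at powers of β, where they
    -- become identities of `σ`.
    data Polar : Carrier → Set where
      origin : Polar 0#
      power : ∀ i → Polar (β ^ i)

    polar : ∀ x → Polar x
    polar x with x ≟ 0#
    ... | yes refl = origin
    ... | no x≢0 = let i , e = log x x≢0 in subst Polar e (power i)

    s'-power : ∀ i → s' (β ^ i) ≡ 1ℤ ⊖ σ i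
    s'-power i = cong₂ (λ a b → 1ℤ ⊖ a ⊖ b) (δ-≢0 (^≢0 β≢0 i)) (s-power i)

    s'-0 : s' 0# ≡ 0ℤ
    s'-0 = cong₂ (λ a b → 1ℤ ⊖ a ⊖ b) δ-0 s-0

    s-β² : ∀ x → s (β ^ 2 * x) ≡ s' x
    s-β² x with polar x
    ... | origin = trans (cong s (zeroʳ (β ^ 2))) (trans s-0 (sym s'-0))
    ... | power i = trans (cong s (sym (^-+ β 2 i))) (trans (s-power (2 ℕ.+ i)) (trans (σ-shift i) (sym (s'-power i))))

    s'-β² : ∀ x → s' (β ^ 2 * x) ≡ s x
    s'-β² x with polar x
    ... | origin = trans (cong s' (zeroʳ (β ^ 2))) (trans s'-0 (sym s-0))
    ... | power i = trans (cong s' (sym (^-+ β 2 i))) (trans (s'-power (2 ℕ.+ i))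
      (trans (trans (cong (1ℤ ⊖_) (σ-shift i)) (id₁ (σ i))) (sym (s-power i))))
      where
      id₁ : ∀ x → 1ℤ ⊖ (1ℤ ⊖ x) ≡ x
      id₁ = solve-∀

    σ-frobenius : ∀ i → σ (i ℕ.* p) ≡ σ (1 ℕ.+ i)
    σ-frobenius i = trans (cong σ (trans (cong (i ℕ.*_) p≡4k+3) (id₁ i k))) (trans (σ-period (i ℕ.* k) (3 ℕ.* i)) (σ-triple i))
      where
      id₁ : ∀ i k → i ℕ.* (4 ℕ.* k ℕ.+ 3) ≡ 4 ℕ.* (i ℕ.* k) ℕ.+ 3 ℕ.* i
      id₁ = ℕ-solve-∀

    0^p : 0# ^ p ≡ 0#
    0^p = 0^ p {{prime⇒nonZero p-prime}}

    -- Frobenius fixes C₀ and C₂ and exchanges C₁ and C₃, because p ≡ 3 (mod 4).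
    s-frobenius : ∀ x → s (x ^ p) ≡ s (β * x)
    s-frobenius x with polar x
    ... | origin = cong s (trans 0^p (sym (zeroʳ β)))
    ... | power i = trans (cong s (^-* β i p)) (trans (s-power (i ℕ.* p)) (trans (σ-frobenius i) (sym (s-power (1 ℕ.+ i)))))

    s'-frobenius : ∀ x → s' (x ^ p) ≡ s' (β * x)
    s'-frobenius x with polar x
    ... | origin = cong s' (trans 0^p (sym (zeroʳ β)))
    ... | power i = trans (cong s' (^-* β i p)) (trans (s'-power (i ℕ.* p)) (trans (cong (1ℤ ⊖_) (σ-frobenius i)) (sym (s'-power (1 ℕ.+ i)))))

    -- −1 is a fourth power because 8 ∣ q − 1.
    s-neg : ∀ x → s (- x) ≡ s x
    s-neg x with polar x
    ... | origin = cong s -0≡0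
    ... | power i = let j , e = log (- 1#) -1≢0 in sign j e
      where
      -1≢0 : - 1# ≢ 0#
      -1≢0 e = 0≢1 (trans (sym -0≡0) (trans (cong -_ (sym e)) (-‿involutive 1#)))
      sign : ∀ j → β ^ j ≡ - 1# → s (- (β ^ i)) ≡ s (β ^ i)
      sign j e with order∣ (j ℕ.+ j) (trans (^-+ β j j) (trans (cong₂ _*_ e e) (trans (-1*x≈-x (- 1#)) (-‿involutive 1#))))
      ... | divides c eq = begin
        s (- (β ^ i)) ≡⟨ cong s (-1*x≈-x (β ^ i)) ⟨
        s (- 1# * β ^ i) ≡⟨ cong (λ y → s (y * β ^ i)) e ⟨
        s (β ^ j * β ^ i) ≡⟨ cong s (^-+ β j i) ⟨
        s (β ^ (j ℕ.+ i)) ≡⟨ s-power (j ℕ.+ i) ⟩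
        σ (j ℕ.+ i) ≡⟨ cong (λ j → σ (j ℕ.+ i)) j≡ ⟩
        σ (4 ℕ.* (c ℕ.* r') ℕ.+ i) ≡⟨ σ-period (c ℕ.* r') i ⟩
        σ i ≡⟨ s-power i ⟨
        s (β ^ i) ∎
        where
        open ≡-Reasoning
        id₁ : ∀ j → j ℕ.+ j ≡ 2 ℕ.* j
        id₁ = ℕ-solve-∀
        id₂ : ∀ c r → c ℕ.* (4 ℕ.* (2 ℕ.* r)) ≡ 2 ℕ.* (4 ℕ.* (c ℕ.* r))
        id₂ = ℕ-solve-∀
        j≡ : j ≡ 4 ℕ.* (c ℕ.* r')
        j≡ = ℕ.*-cancelˡ-≡ j (4 ℕ.* (c ℕ.* r')) 2 (trans (sym (id₁ j)) (trans eq (trans (cong (λ r → c ℕ.* (4 ℕ.* r)) r≡2r') (id₂ c r'))))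

    β² β⁻² : Carrier
    β² = β ^ 2
    β⁻² = proj₁ (inverse β² (^≢0 β≢0 2))

    β²β⁻² : ∀ x → β² * (β⁻² * x) ≡ x
    β²β⁻² x = trans (sym (*-assoc β² β⁻² x)) (trans (cong (_* x) (proj₂ (inverse β² (^≢0 β≢0 2)))) (*-identityˡ x))

    β⁻²β² : ∀ x → β⁻² * (β² * x) ≡ x
    β⁻²β² x = trans (sym (*-assoc β⁻² β² x)) (trans (cong (_* x) (trans (*-comm β⁻² β²) (proj₂ (inverse β² (^≢0 β≢0 2))))) (*-identityˡ x))

    β⁻¹ : Carrier
    β⁻¹ = proj₁ (inverse β β≢0)

    ∑-β² : ∀ f → ∑ (λ x → f (β² * x)) ≡ ∑ f
    ∑-β² = ∑-reindex (β² *_) (β⁻² *_) β²β⁻² β⁻²β²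

    ∑-β : ∀ f → ∑ (λ x → f (β * x)) ≡ ∑ f
    ∑-β = ∑-reindex (β *_) (β⁻¹ *_)
      (λ x → trans (sym (*-assoc β β⁻¹ x)) (trans (cong (_* x) (proj₂ (inverse β β≢0))) (*-identityˡ x)))
      (λ x → trans (sym (*-assoc β⁻¹ β x)) (trans (cong (_* x) (trans (*-comm β⁻¹ β) (proj₂ (inverse β β≢0)))) (*-identityˡ x)))

    a-[a-x]≡x : ∀ a x → a - (a - x) ≡ x
    a-[a-x]≡x a x = x-y≡0⇒x≡y _ x (begin
      a - (a - x) - x ≡⟨ +-assoc a (- (a - x)) (- x) ⟩
      a + (- (a - x) + - x) ≡⟨ cong (λ y → a + y) (+-comm (- (a - x)) (- x)) ⟩
      a + (- x + - (a - x)) ≡⟨ +-assoc a (- x) (- (a - x)) ⟨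
      a - x - (a - x) ≡⟨ -‿inverseʳ (a - x) ⟩
      0# ∎)
      where open ≡-Reasoning

    ∑-reflect : ∀ a f → ∑ (λ x → f (a - x)) ≡ ∑ f
    ∑-reflect a = ∑-reindex (λ x → a - x) (λ x → a - x) (a-[a-x]≡x a) (a-[a-x]≡x a)

    ∑-translate : ∀ a f → ∑ (λ x → f (x - a)) ≡ ∑ f
    ∑-translate a = ∑-reindex (λ x → x - a) (λ x → x + a)
      (λ x → trans (+-assoc x a (- a)) (trans (cong (λ y → x + y) (-‿inverseʳ a)) (+-identityʳ x))) (x-y+y≡x a)

    x^q≡x : ∀ x → x ^ suc (4 ℕ.* r) ≡ x
    x^q≡x x with polar x
    ... | origin = 0^ (suc (4 ℕ.* r))
    ... | power i = trans (cong (β ^ i *_) (begin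
      (β ^ i) ^ (4 ℕ.* r) ≡⟨ ^-* β i (4 ℕ.* r) ⟩
      β ^ (i ℕ.* (4 ℕ.* r)) ≡⟨ cong (β ^_) (ℕ.*-comm i (4 ℕ.* r)) ⟩
      β ^ (4 ℕ.* r ℕ.* i) ≡⟨ ^-* β (4 ℕ.* r) i ⟨
      (β ^ (4 ℕ.* r)) ^ i ≡⟨ cong (_^ i) βⁿ≡1 ⟩
      1# ^ i ≡⟨ 1^ i ⟩
      1# ∎)) (*-identityʳ (β ^ i))
      where open ≡-Reasoning

    -- The exponent here satisfies q = p · pᵗ, so xᵠ = x with ᵠ standing for q makes the pᵗ-th power
    -- map inverse to Frobenius.
    ∑-frobenius : ∀ f → ∑ (λ x → f (x ^ p)) ≡ ∑ f
    ∑-frobenius = ∑-reindex (_^ p) (_^ (p ℕ.^ t))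
      (λ x → trans (^-* x (p ℕ.^ t) p) (trans (cong (x ^_) (trans (ℕ.*-comm (p ℕ.^ t) p) (sym q≡pᵗ))) (x^q≡x x)))
      (λ x → trans (^-* x p (p ℕ.^ t)) (trans (cong (x ^_) (sym q≡pᵗ)) (x^q≡x x)))

    frobenius-minus : ∀ w u → w ^ p - u ^ p ≡ (w - u) ^ p
    frobenius-minus w u = begin
      w ^ p - u ^ p ≡⟨ cong (λ x → x ^ p - u ^ p) (x-y+y≡x u w) ⟨
      (w - u + u) ^ p - u ^ p ≡⟨ cong (_- u ^ p) (frobenius-+ (w - u) u) ⟩
      (w - u) ^ p + u ^ p - u ^ p ≡⟨ +-assoc _ _ _ ⟩
      (w - u) ^ p + (u ^ p - u ^ p) ≡⟨ cong (λ y → (w - u) ^ p + y) (-‿inverseʳ (u ^ p)) ⟩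
      (w - u) ^ p + 0# ≡⟨ +-identityʳ _ ⟩
      (w - u) ^ p ∎
      where open ≡-Reasoning

    N : Carrier → ℤ
    N w = ∑ (λ u → s (w - u) ⊗ s' u)

    N-β² : ∀ w → N (β² * w) ≡ N w
    N-β² w = begin
      ∑ (λ u → s (β² * w - u) ⊗ s' u) ≡⟨ ∑-β² (λ u → s (β² * w - u) ⊗ s' u) ⟨
      ∑ (λ u → s (β² * w - β² * u) ⊗ s' (β² * u))
        ≡⟨ ∑-cong (λ u → cong₂ _⊗_ (trans (cong s (sym (x[y-z]≈xy-xz β² w u))) (s-β² (w - u))) (s'-β² u)) ⟩
      -- The dilation has interchanged s and s'; reflecting u to w - u restores their order.
      ∑ (λ u → s' (w - u) ⊗ s u) ≡⟨ ∑-reflect w (λ u → s' (w - u) ⊗ s u) ⟨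
      ∑ (λ u → s' (w - (w - u)) ⊗ s (w - u))
        ≡⟨ ∑-cong (λ u → trans (cong (λ x → s' x ⊗ s (w - u)) (a-[a-x]≡x w u)) (ℤ.*-comm (s' u) (s (w - u)))) ⟩
      ∑ (λ u → s (w - u) ⊗ s' u) ∎
      where open ≡-Reasoning

    N-frobenius : ∀ w → N (w ^ p) ≡ N (β * w)
    N-frobenius w = begin
      ∑ (λ u → s (w ^ p - u) ⊗ s' u) ≡⟨ ∑-frobenius (λ u → s (w ^ p - u) ⊗ s' u) ⟨
      ∑ (λ u → s (w ^ p - u ^ p) ⊗ s' (u ^ p))
        ≡⟨ ∑-cong (λ u → cong₂ _⊗_ (trans (cong s (frobenius-minus w u)) (trans (s-frobenius (w - u)) (cong s (x[y-z]≈xy-xz β w u)))) (s'-frobenius u)) ⟩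
      ∑ (λ u → s (β * w - β * u) ⊗ s' (β * u)) ≡⟨ ∑-β (λ u → s (β * w - u) ⊗ s' u) ⟩
      ∑ (λ u → s (β * w - u) ⊗ s' u) ∎
      where open ≡-Reasoning

    N-even : ∀ j i → N (β ^ (2 ℕ.* j ℕ.+ i)) ≡ N (β ^ i)
    N-even zero i = refl
    N-even (suc j) i = trans (cong (λ l → N (β ^ l)) (id₁ j i)) (trans (cong N (^-+ β 2 (2 ℕ.* j ℕ.+ i))) (trans (N-β² (β ^ (2 ℕ.* j ℕ.+ i))) (N-even j i)))
      where
      id₁ : ∀ j i → 2 ℕ.* suc j ℕ.+ i ≡ 2 ℕ.+ (2 ℕ.* j ℕ.+ i)
      id₁ = ℕ-solve-∀

    -- p is odd, so βⁱᵖ and βⁱ differ by a power of β², while Frobenius sends N at βⁱᵖ to N at βⁱ⁺¹.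
    N-suc : ∀ i → N (β ^ suc i) ≡ N (β ^ i)
    N-suc i = begin
      N (β * β ^ i) ≡⟨ N-frobenius (β ^ i) ⟨
      N ((β ^ i) ^ p) ≡⟨ cong N (^-* β i p) ⟩
      N (β ^ (i ℕ.* p)) ≡⟨ cong (λ l → N (β ^ l)) (trans (cong (i ℕ.*_) p≡4k+3) (id₁ i k)) ⟩
      N (β ^ (2 ℕ.* (i ℕ.* (2 ℕ.* k ℕ.+ 1)) ℕ.+ i)) ≡⟨ N-even (i ℕ.* (2 ℕ.* k ℕ.+ 1)) i ⟩
      N (β ^ i) ∎
      where
      open ≡-Reasoning
      id₁ : ∀ i k → i ℕ.* (4 ℕ.* k ℕ.+ 3) ≡ 2 ℕ.* (i ℕ.* (2 ℕ.* k ℕ.+ 1)) ℕ.+ i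
      id₁ = ℕ-solve-∀

    N-power : ∀ i → N (β ^ i) ≡ N 1#
    N-power zero = refl
    N-power (suc i) = trans (N-suc i) (N-power i)

    -- A pair of sum 0 has the form (-u, u), and S' = -S' is disjoint from its complement.
    N-0 : N 0# ≡ 0ℤ
    N-0 = trans (∑-cong vanish) (trans (∑-const 0ℤ) (ℤ.*-zeroʳ (+ suc (4 ℕ.* r))))
      where
      disjoint : ∀ u → s u ⊗ s' u ≡ 0ℤ
      disjoint u with polar u
      ... | origin = trans (cong (s 0# ⊗_) s'-0) (ℤ.*-zeroʳ (s 0#))
      ... | power i = trans (cong₂ _⊗_ (s-power i) (s'-power i)) (σσ' i)
        where
        σσ' : ∀ i → σ i ⊗ (1ℤ ⊖ σ i) ≡ 0ℤ
        σσ' 0 = refl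
        σσ' 1 = refl
        σσ' 2 = refl
        σσ' 3 = refl
        σσ' (suc (suc (suc (suc i)))) = σσ' i
      vanish : ∀ u → s (0# - u) ⊗ s' u ≡ 0ℤ
      vanish u = trans (cong (λ x → x ⊗ s' u) (trans (cong s (+-identityˡ (- u))) (s-neg u))) (disjoint u)

    ρ : ℤ
    ρ = + r

    +q≡ : + suc (4 ℕ.* r) ≡ + 4 ⊗ ρ ⊕ 1ℤ
    +q≡ = trans (cong +_ (ℕ.+-comm 1 (4 ℕ.* r))) (cong (_⊕ 1ℤ) (ℤ.pos-* 4 r))

    ∑δ : ∑ δ ≡ 1ℤ
    ∑δ = trans (∑-single 0# δ (λ _ → δ-≢0)) δ-0

    ∑s≡∑s' : ∑ s' ≡ ∑ s
    ∑s≡∑s' = trans (sym (∑-cong s-β²)) (∑-β² s)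

    ∑s' : ∑ s' ≡ + 4 ⊗ ρ ⊖ ∑ s
    ∑s' = begin
      ∑ s' ≡⟨ ∑-cong (λ x → id₁ (δ x) (s x)) ⟩
      ∑ (λ x → 1ℤ ⊗ (-1ℤ ⊗ δ x ⊕ -1ℤ ⊗ s x) ⊕ 1ℤ ⊗ 1ℤ) ≡⟨ ∑-comb 1ℤ 1ℤ (λ x → -1ℤ ⊗ δ x ⊕ -1ℤ ⊗ s x) (λ _ → 1ℤ) ⟩
      1ℤ ⊗ ∑ (λ x → -1ℤ ⊗ δ x ⊕ -1ℤ ⊗ s x) ⊕ 1ℤ ⊗ ∑ (λ _ → 1ℤ)
        ≡⟨ cong₂ (λ a b → 1ℤ ⊗ a ⊕ 1ℤ ⊗ b) (trans (∑-comb -1ℤ -1ℤ δ s) (cong (λ x → -1ℤ ⊗ x ⊕ -1ℤ ⊗ ∑ s) ∑δ)) (trans (∑-const 1ℤ) (cong (_⊗ 1ℤ) +q≡)) ⟩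
      1ℤ ⊗ (-1ℤ ⊗ 1ℤ ⊕ -1ℤ ⊗ ∑ s) ⊕ 1ℤ ⊗ ((+ 4 ⊗ ρ ⊕ 1ℤ) ⊗ 1ℤ) ≡⟨ id₂ ρ (∑ s) ⟩
      + 4 ⊗ ρ ⊖ ∑ s ∎
      where
      open ≡-Reasoning
      id₁ : ∀ d s → 1ℤ ⊖ d ⊖ s ≡ 1ℤ ⊗ (-1ℤ ⊗ d ⊕ -1ℤ ⊗ s) ⊕ 1ℤ ⊗ 1ℤ
      id₁ = solve-∀
      id₂ : ∀ ρ S → 1ℤ ⊗ (-1ℤ ⊗ 1ℤ ⊕ -1ℤ ⊗ S) ⊕ 1ℤ ⊗ ((+ 4 ⊗ ρ ⊕ 1ℤ) ⊗ 1ℤ) ≡ + 4 ⊗ ρ ⊖ S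
      id₂ = solve-∀

    ∑s : ∑ s ≡ + 2 ⊗ ρ
    ∑s = ℤ.*-cancelˡ-≡ (+ 2) (∑ s) (+ 2 ⊗ ρ) (trans (id₁ (∑ s)) (trans (cong (λ x → ∑ s ⊕ x) (trans (sym ∑s≡∑s') ∑s')) (id₂ (∑ s) ρ)))
      where
      id₁ : ∀ S → + 2 ⊗ S ≡ S ⊕ S
      id₁ = solve-∀
      id₂ : ∀ S ρ → S ⊕ (+ 4 ⊗ ρ ⊖ S) ≡ + 2 ⊗ (+ 2 ⊗ ρ)
      id₂ = solve-∀

    N-δ : ∀ w → N w ≡ N 1# ⊕ (ℤ.- N 1#) ⊗ δ w
    N-δ w with polar w
    ... | origin = trans N-0 (sym (trans (cong (λ d → N 1# ⊕ (ℤ.- N 1#) ⊗ d) δ-0) (id₁ (N 1#))))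
      where
      id₁ : ∀ x → x ⊕ (ℤ.- x) ⊗ 1ℤ ≡ 0ℤ
      id₁ = solve-∀
    ... | power i = trans (N-power i) (sym (trans (cong (λ d → N 1# ⊕ (ℤ.- N 1#) ⊗ d) (δ-≢0 (^≢0 β≢0 i))) (id₁ (N 1#))))
      where
      id₁ : ∀ x → x ⊕ (ℤ.- x) ⊗ 0ℤ ≡ x
      id₁ = solve-∀

    ∑N : ∑ N ≡ ∑ s ⊗ ∑ s'
    ∑N = begin
      ∑ (λ w → ∑ (λ u → s (w - u) ⊗ s' u)) ≡⟨ ∑-comm (λ w u → s (w - u) ⊗ s' u) ⟩
      ∑ (λ u → ∑ (λ w → s (w - u) ⊗ s' u)) ≡⟨ ∑-cong (λ u → trans (∑-cong (λ w → ℤ.*-comm (s (w - u)) (s' u)))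
          (trans (∑-*ˡ (s' u) (λ w → s (w - u))) (trans (cong (s' u ⊗_) (∑-translate u s)) (ℤ.*-comm (s' u) (∑ s))))) ⟩
      ∑ (λ u → ∑ s ⊗ s' u) ≡⟨ ∑-*ˡ (∑ s) s' ⟩
      ∑ s ⊗ ∑ s' ∎
      where open ≡-Reasoning

    -- Double counting: the sum of N over all w is |S'| times the size of its complement, so 4r N(1)
    -- = (2r)².
    N-1 : N 1# ≡ ρ
    N-1 = ℤ.*-cancelˡ-≡ ρ (N 1#) ρ {{r≢0}} (ℤ.*-cancelˡ-≡ (+ 4) (ρ ⊗ N 1#) (ρ ⊗ ρ) (begin
      + 4 ⊗ (ρ ⊗ N 1#) ≡⟨ id₁ ρ (N 1#) ⟩
      (+ 4 ⊗ ρ ⊕ 1ℤ) ⊗ N 1# ⊕ (ℤ.- N 1#) ⊗ 1ℤ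
        ≡⟨ cong₂ (λ a b → a ⊕ (ℤ.- N 1#) ⊗ b) (trans (cong (_⊗ N 1#) (sym +q≡)) (sym (∑-const (N 1#)))) (sym ∑δ) ⟩
      ∑ (λ _ → N 1#) ⊕ (ℤ.- N 1#) ⊗ ∑ δ ≡⟨ cong (λ x → ∑ (λ _ → N 1#) ⊕ x) (∑-*ˡ (ℤ.- N 1#) δ) ⟨
      ∑ (λ _ → N 1#) ⊕ ∑ (λ w → (ℤ.- N 1#) ⊗ δ w) ≡⟨ ∑-+ (λ _ → N 1#) (λ w → (ℤ.- N 1#) ⊗ δ w) ⟨
      ∑ (λ w → N 1# ⊕ (ℤ.- N 1#) ⊗ δ w) ≡⟨ ∑-cong N-δ ⟨
      ∑ N ≡⟨ ∑N ⟩
      ∑ s ⊗ ∑ s' ≡⟨ cong₂ _⊗_ ∑s (trans ∑s≡∑s' ∑s) ⟩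
      + 2 ⊗ ρ ⊗ (+ 2 ⊗ ρ) ≡⟨ id₂ ρ ⟩
      + 4 ⊗ (ρ ⊗ ρ) ∎))
      where
      open ≡-Reasoning
      id₁ : ∀ ρ N → + 4 ⊗ (ρ ⊗ N) ≡ (+ 4 ⊗ ρ ⊕ 1ℤ) ⊗ N ⊕ (ℤ.- N) ⊗ 1ℤ
      id₁ = solve-∀
      id₂ : ∀ ρ → + 2 ⊗ ρ ⊗ (+ 2 ⊗ ρ) ≡ + 4 ⊗ (ρ ⊗ ρ)
      id₂ = solve-∀

-- The Laplacian as a convolution operator and its quadratic relation.

module Laplacian where

  open IntegerVectors
  open FieldArithmetic
  open Cyclotomy
  open import Data.Nat as ℕ using (ℕ; zero; suc; NonZero)
  import Data.Nat.Properties as ℕ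
  import Data.Nat.DivMod as ℕ
  open import Data.Nat.Primality using (Prime)
  open import Data.Nat.Tactic.RingSolver using () renaming (solve-∀ to ℕ-solve-∀)
  open import Data.Integer as ℤ using (ℤ; +_; 0ℤ; 1ℤ; -1ℤ) renaming (_+_ to infixl 6 _⊕_; _-_ to infixl 6 _⊖_; _*_ to infixl 7 _⊗_)
  import Data.Integer.Properties as ℤ
  open import Data.Integer.Tactic.RingSolver using (solve-∀)
  import Algebra.Properties.Semiring.Sum ℤ.+-*-semiring as ℤ-Sum
  open import Data.Bool using (if_then_else_; not; _∧_)
  open import Data.Fin using (Fin; zero; suc)
  open import Function using (_∘_)
  open import Relation.Nullary using (Dec; yes; no; does)
  open import Relation.Binary.PropositionalEquality using (_≡_; _≗_; refl; sym; trans; cong; cong₂; module ≡-Reasoning)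
  open import Function.Bundles using (Inverse)

  -- The recursion inside ΣV has no name in scope. Its name is recovered as the omitted left-hand side of ΣV-tail,
  -- which Agda infers from ΣV≡sum once abstracting suc n has separated the number of summands from the cardinality.
  mutual
    ΣV-tail : ∀ {q} (F : FiniteField q) (β : FiniteField.Carrier F) (f : FiniteField.Carrier F → ℤ) n (g : Fin n → ℤ) →
              _ ≡ ℤ-Sum.sum g

    ΣV≡sum : ∀ n (F : FiniteField (suc n)) (β : FiniteField.Carrier F) (f : FiniteField.Carrier F → ℤ) →
             Peisert.ΣV F β f ≡ ℤ-Sum.sum (λ i → f (Inverse.to (FiniteField.enum F) i))
    ΣV≡sum n F β f with f (Inverse.to (FiniteField.enum F) zero) | (λ i → f (Inverse.to (FiniteField.enum F) (suc i)))
    ... | x | g with suc n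
    ... | _ = cong (λ y → x ⊕ y) (ΣV-tail F β f n g)

    ΣV-tail F β f zero g = refl
    ΣV-tail F β f (suc n) g = cong (λ y → g zero ⊕ y) (ΣV-tail F β f n (λ i → g (suc i)))

  module Operator (r : ℕ) (r≢0 : NonZero r) (r' : ℕ) (r≡2r' : r ≡ 2 ℕ.* r')
    (F : FiniteField (suc (4 ℕ.* r))) (β : FiniteField.Carrier F) (β-primitive : FiniteField.IsPrimitive F β)
    (p k t : ℕ) (p-prime : Prime p) (p≡4k+3 : p ≡ 4 ℕ.* k ℕ.+ 3) (q≡pᵗ : suc (4 ℕ.* r) ≡ p ℕ.^ suc t) where

    open Field F
    open Primitive β β-primitive
    open Summation F
    open Indicator r r≢0 r' r≡2r' F β β-primitive p k t p-prime p≡4k+3 q≡pᵗ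
    open Peisert F β using (applyL; L; ΣV)

    Q : ℤ
    Q = + 4 ⊗ ρ ⊕ 1ℤ

    -- The adjacency operator: A(x, y) = s(x - y) even on the diagonal, since s vanishes at 0.
    T : (Carrier → ℤ) → Carrier → ℤ
    T u x = ∑ (λ y → s (x - y) ⊗ u y)

    T-comb : ∀ {u v w} a b → (∀ x → w x ≡ a ⊗ u x ⊕ b ⊗ v x) → ∀ x → T w x ≡ a ⊗ T u x ⊕ b ⊗ T v x
    T-comb {u} {v} a b e x = trans (∑-cong (λ y → trans (cong (s (x - y) ⊗_) (e y)) (id₁ (s (x - y)) a b (u y) (v y))))
      (∑-comb a b (λ y → s (x - y) ⊗ u y) (λ y → s (x - y) ⊗ v y))
      where
      id₁ : ∀ s a b u v → s ⊗ (a ⊗ u ⊕ b ⊗ v) ≡ a ⊗ (s ⊗ u) ⊕ b ⊗ (s ⊗ v)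
      id₁ = solve-∀

    [x-z]-[y-z]≡x-y : ∀ x y z → x - z - (y - z) ≡ x - y
    [x-z]-[y-z]≡x-y x y z = +-cancelʳ (y - z) _ _ (begin
      x - z - (y - z) + (y - z) ≡⟨ x-y+y≡x (y - z) (x - z) ⟩
      x - z ≡⟨ cong (_- z) (x-y+y≡x y x) ⟨
      x - y + y - z ≡⟨ +-assoc (x - y) y (- z) ⟩
      x - y + (y - z) ∎)
      where open ≡-Reasoning

    δ-pick : ∀ x (f : Carrier → ℤ) → ∑ (λ y → δ (x - y) ⊗ f y) ≡ f x
    δ-pick x f = trans (∑-single x (λ y → δ (x - y) ⊗ f y) (λ y y≢x → trans
        (cong (_⊗ f y) (δ-≢0 (λ e → y≢x (sym (x-y≡0⇒x≡y x y e))))) (ℤ.*-zeroˡ (f y))))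
      (trans (cong (λ z → z ⊗ f x) (trans (cong δ (-‿inverseʳ x)) δ-0)) (ℤ.*-identityˡ (f x)))

    -- Writing the second factor as 1 - δ - s' gives 2r - s(w) - N(w). The values 2r, r - 1 and r at
    -- 0, on S' and elsewhere are the parameters of a strongly regular graph.
    s*s : ∀ w → ∑ (λ v → s (w - v) ⊗ s v) ≡ ρ ⊖ s w ⊕ ρ ⊗ δ w
    s*s w = begin
      ∑ (λ v → s (w - v) ⊗ s v) ≡⟨ ∑-cong (λ v → id₁ (s (w - v)) (s v) (δ v)) ⟩
      ∑ (λ v → 1ℤ ⊗ (1ℤ ⊗ s (w - v) ⊕ -1ℤ ⊗ (s (w - v) ⊗ δ v)) ⊕ -1ℤ ⊗ (s (w - v) ⊗ s' v))
        ≡⟨ ∑-comb 1ℤ -1ℤ (λ v → 1ℤ ⊗ s (w - v) ⊕ -1ℤ ⊗ (s (w - v) ⊗ δ v)) (λ v → s (w - v) ⊗ s' v) ⟩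
      1ℤ ⊗ ∑ (λ v → 1ℤ ⊗ s (w - v) ⊕ -1ℤ ⊗ (s (w - v) ⊗ δ v)) ⊕ -1ℤ ⊗ N w
        ≡⟨ cong₂ (λ a b → 1ℤ ⊗ a ⊕ -1ℤ ⊗ b) (∑-comb 1ℤ -1ℤ (λ v → s (w - v)) (λ v → s (w - v) ⊗ δ v)) (trans (N-δ w) (cong (λ x → x ⊕ (ℤ.- x) ⊗ δ w) N-1)) ⟩
      1ℤ ⊗ (1ℤ ⊗ ∑ (λ v → s (w - v)) ⊕ -1ℤ ⊗ ∑ (λ v → s (w - v) ⊗ δ v)) ⊕ -1ℤ ⊗ (ρ ⊕ (ℤ.- ρ) ⊗ δ w)
        ≡⟨ cong₂ (λ a b → 1ℤ ⊗ (1ℤ ⊗ a ⊕ -1ℤ ⊗ b) ⊕ -1ℤ ⊗ (ρ ⊕ (ℤ.- ρ) ⊗ δ w)) (trans (∑-reflect w s) ∑s) at-0 ⟩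
      1ℤ ⊗ (1ℤ ⊗ (+ 2 ⊗ ρ) ⊕ -1ℤ ⊗ s w) ⊕ -1ℤ ⊗ (ρ ⊕ (ℤ.- ρ) ⊗ δ w) ≡⟨ id₂ ρ (s w) (δ w) ⟩
      ρ ⊖ s w ⊕ ρ ⊗ δ w ∎
      where
      open ≡-Reasoning
      at-0 : ∑ (λ v → s (w - v) ⊗ δ v) ≡ s w
      at-0 = trans (∑-single 0# (λ v → s (w - v) ⊗ δ v) (λ v v≢0 → trans (cong (s (w - v) ⊗_) (δ-≢0 v≢0)) (ℤ.*-zeroʳ (s (w - v)))))
        (trans (cong₂ _⊗_ (cong s (trans (cong (λ y → w + y) -0≡0) (+-identityʳ w))) δ-0) (ℤ.*-identityʳ (s w)))
      id₁ : ∀ a s d → a ⊗ s ≡ 1ℤ ⊗ (1ℤ ⊗ a ⊕ -1ℤ ⊗ (a ⊗ d)) ⊕ -1ℤ ⊗ (a ⊗ (1ℤ ⊖ d ⊖ s))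
      id₁ = solve-∀
      id₂ : ∀ ρ s d → 1ℤ ⊗ (1ℤ ⊗ (+ 2 ⊗ ρ) ⊕ -1ℤ ⊗ s) ⊕ -1ℤ ⊗ (ρ ⊕ (ℤ.- ρ) ⊗ d) ≡ ρ ⊖ s ⊕ ρ ⊗ d
      id₂ = solve-∀

    T² : ∀ u x → T (T u) x ≡ ρ ⊗ ∑ u ⊖ T u x ⊕ ρ ⊗ u x
    T² u x = begin
      ∑ (λ y → s (x - y) ⊗ ∑ (λ z → s (y - z) ⊗ u z)) ≡⟨ ∑-cong (λ y → sym (∑-*ˡ (s (x - y)) (λ z → s (y - z) ⊗ u z))) ⟩
      ∑ (λ y → ∑ (λ z → s (x - y) ⊗ (s (y - z) ⊗ u z))) ≡⟨ ∑-comm (λ y z → s (x - y) ⊗ (s (y - z) ⊗ u z)) ⟩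
      ∑ (λ z → ∑ (λ y → s (x - y) ⊗ (s (y - z) ⊗ u z))) ≡⟨ ∑-cong inner ⟩
      ∑ (λ z → 1ℤ ⊗ (ρ ⊗ u z ⊕ -1ℤ ⊗ (s (x - z) ⊗ u z)) ⊕ ρ ⊗ (δ (x - z) ⊗ u z))
        ≡⟨ ∑-comb 1ℤ ρ (λ z → ρ ⊗ u z ⊕ -1ℤ ⊗ (s (x - z) ⊗ u z)) (λ z → δ (x - z) ⊗ u z) ⟩
      1ℤ ⊗ ∑ (λ z → ρ ⊗ u z ⊕ -1ℤ ⊗ (s (x - z) ⊗ u z)) ⊕ ρ ⊗ ∑ (λ z → δ (x - z) ⊗ u z)
        ≡⟨ cong₂ (λ a b → 1ℤ ⊗ a ⊕ ρ ⊗ b) (∑-comb ρ -1ℤ u (λ z → s (x - z) ⊗ u z)) (δ-pick x u) ⟩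
      1ℤ ⊗ (ρ ⊗ ∑ u ⊕ -1ℤ ⊗ T u x) ⊕ ρ ⊗ u x ≡⟨ id₁ ρ (∑ u) (T u x) (u x) ⟩
      ρ ⊗ ∑ u ⊖ T u x ⊕ ρ ⊗ u x ∎
      where
      open ≡-Reasoning
      id₁ : ∀ ρ S t u → 1ℤ ⊗ (ρ ⊗ S ⊕ -1ℤ ⊗ t) ⊕ ρ ⊗ u ≡ ρ ⊗ S ⊖ t ⊕ ρ ⊗ u
      id₁ = solve-∀
      id₂ : ∀ a b u → a ⊗ (b ⊗ u) ≡ u ⊗ (a ⊗ b)
      id₂ = solve-∀
      id₃ : ∀ u ρ s d → u ⊗ (ρ ⊖ s ⊕ ρ ⊗ d) ≡ 1ℤ ⊗ (ρ ⊗ u ⊕ -1ℤ ⊗ (s ⊗ u)) ⊕ ρ ⊗ (d ⊗ u)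
      id₃ = solve-∀
      inner : ∀ z → ∑ (λ y → s (x - y) ⊗ (s (y - z) ⊗ u z)) ≡ 1ℤ ⊗ (ρ ⊗ u z ⊕ -1ℤ ⊗ (s (x - z) ⊗ u z)) ⊕ ρ ⊗ (δ (x - z) ⊗ u z)
      inner z = begin
        ∑ (λ y → s (x - y) ⊗ (s (y - z) ⊗ u z)) ≡⟨ ∑-cong (λ y → trans (id₂ (s (x - y)) (s (y - z)) (u z))
            (cong (λ a → u z ⊗ (s a ⊗ s (y - z))) (sym ([x-z]-[y-z]≡x-y x y z)))) ⟩
        ∑ (λ y → u z ⊗ (s (x - z - (y - z)) ⊗ s (y - z))) ≡⟨ ∑-*ˡ (u z) (λ y → s (x - z - (y - z)) ⊗ s (y - z)) ⟩
        u z ⊗ ∑ (λ y → s (x - z - (y - z)) ⊗ s (y - z)) ≡⟨ cong (u z ⊗_) (trans (∑-translate z (λ v → s (x - z - v) ⊗ s v)) (s*s (x - z))) ⟩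
        u z ⊗ (ρ ⊖ s (x - z) ⊕ ρ ⊗ δ (x - z)) ≡⟨ id₃ (u z) ρ (s (x - z)) (δ (x - z)) ⟩
        1ℤ ⊗ (ρ ⊗ u z ⊕ -1ℤ ⊗ (s (x - z) ⊗ u z)) ⊕ ρ ⊗ (δ (x - z) ⊗ u z) ∎

    𝓛 : (Carrier → ℤ) → Carrier → ℤ
    𝓛 u x = + 2 ⊗ ρ ⊗ u x ⊖ T u x

    L-entry : ∀ x y → L x y ≡ + 2 ⊗ ρ ⊗ δ (x - y) ⊖ s (x - y)
    L-entry x y = by-cases (x ≟ y) (InS'? β (x - y)) (s-def (x - y))
      where
      degree : + (4 ℕ.* r ℕ./ 2) ≡ + 2 ⊗ ρ
      degree = trans (cong +_ (trans (cong (ℕ._/ 2) (id₀ r)) (ℕ.m*n/n≡m (2 ℕ.* r) 2))) (ℤ.pos-* 2 r)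
        where
        id₀ : ∀ r → 4 ℕ.* r ≡ 2 ℕ.* r ℕ.* 2
        id₀ = ℕ-solve-∀
      id₁ : ∀ c → c ⊖ 0ℤ ≡ c ⊗ 1ℤ ⊖ 0ℤ
      id₁ = solve-∀
      id₂ : ∀ c a → 0ℤ ⊖ a ≡ c ⊗ 0ℤ ⊖ a
      id₂ = solve-∀
      by-cases : (d : Dec (x ≡ y)) (e : Dec (InS' β (x - y))) → s (x - y) ≡ (if does e then 1ℤ else 0ℤ) →
        (if does d then + (4 ℕ.* r ℕ./ 2) else + 0) ⊖ (if not (does d) ∧ does e then + 1 else + 0) ≡ + 2 ⊗ ρ ⊗ δ (x - y) ⊖ s (x - y)
      by-cases (yes refl) e _ = trans (trans (cong (_⊖ 0ℤ) degree) (id₁ (+ 2 ⊗ ρ)))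
        (sym (cong₂ (λ a b → + 2 ⊗ ρ ⊗ a ⊖ b) (trans (cong δ (-‿inverseʳ x)) δ-0) (trans (cong s (-‿inverseʳ x)) s-0)))
      by-cases (no x≢y) e se = trans (id₂ (+ 2 ⊗ ρ) (if does e then + 1 else + 0))
        (sym (cong₂ (λ a b → + 2 ⊗ ρ ⊗ a ⊖ b) (δ-≢0 (x≢y ∘ x-y≡0⇒x≡y x y)) se))

    applyL≡𝓛 : ∀ u x → applyL u x ≡ 𝓛 u x
    applyL≡𝓛 u x = begin
      applyL u x ≡⟨ ΣV≡sum (4 ℕ.* r) F β (λ y → L x y ⊗ u y) ⟩
      ℤ-Sum.sum (λ i → L x (to i) ⊗ u (to i)) ≡⟨ ℤ-Sum.sum-cong-≗ (λ i → cong (_⊗ u (to i)) (L-entry x (to i))) ⟩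
      ℤ-Sum.sum (λ i → (+ 2 ⊗ ρ ⊗ δ (x - to i) ⊖ s (x - to i)) ⊗ u (to i)) ≡⟨ ∑-def (λ y → (+ 2 ⊗ ρ ⊗ δ (x - y) ⊖ s (x - y)) ⊗ u y) ⟨
      ∑ (λ y → (+ 2 ⊗ ρ ⊗ δ (x - y) ⊖ s (x - y)) ⊗ u y) ≡⟨ ∑-cong (λ y → id₁ (+ 2 ⊗ ρ) (δ (x - y)) (s (x - y)) (u y)) ⟩
      ∑ (λ y → + 2 ⊗ ρ ⊗ (δ (x - y) ⊗ u y) ⊕ -1ℤ ⊗ (s (x - y) ⊗ u y))
        ≡⟨ ∑-comb (+ 2 ⊗ ρ) -1ℤ (λ y → δ (x - y) ⊗ u y) (λ y → s (x - y) ⊗ u y) ⟩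
      + 2 ⊗ ρ ⊗ ∑ (λ y → δ (x - y) ⊗ u y) ⊕ -1ℤ ⊗ T u x ≡⟨ cong (λ a → + 2 ⊗ ρ ⊗ a ⊕ -1ℤ ⊗ T u x) (δ-pick x u) ⟩
      + 2 ⊗ ρ ⊗ u x ⊕ -1ℤ ⊗ T u x ≡⟨ id₂ (+ 2 ⊗ ρ ⊗ u x) (T u x) ⟩
      𝓛 u x ∎
      where
      open ≡-Reasoning
      id₁ : ∀ c d s u → (c ⊗ d ⊖ s) ⊗ u ≡ c ⊗ (d ⊗ u) ⊕ -1ℤ ⊗ (s ⊗ u)
      id₁ = solve-∀
      id₂ : ∀ a b → a ⊕ -1ℤ ⊗ b ≡ a ⊖ b
      id₂ = solve-∀

    𝓛-comb : ∀ {u v w} a b → (∀ x → w x ≡ a ⊗ u x ⊕ b ⊗ v x) → ∀ x → 𝓛 w x ≡ a ⊗ 𝓛 u x ⊕ b ⊗ 𝓛 v x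
    𝓛-comb {u} {v} {w} a b e x = trans (cong₂ (λ y z → + 2 ⊗ ρ ⊗ y ⊖ z) (e x) (T-comb {u} {v} {w} a b e x))
      (id₁ (+ 2 ⊗ ρ) a b (u x) (v x) (T u x) (T v x))
      where
      id₁ : ∀ c a b u v x y → c ⊗ (a ⊗ u ⊕ b ⊗ v) ⊖ (a ⊗ x ⊕ b ⊗ y) ≡ a ⊗ (c ⊗ u ⊖ x) ⊕ b ⊗ (c ⊗ v ⊖ y)
      id₁ = solve-∀

    𝓛-cong : ∀ {u v} → u ≗ v → 𝓛 u ≗ 𝓛 v
    𝓛-cong e x = cong₂ (λ y z → + 2 ⊗ ρ ⊗ y ⊖ z) (e x) (∑-cong (λ y → cong (s (x - y) ⊗_) (e y)))

    -- Since L J = 0, this is L L' = r(q - J) multiplied out, with L' = q - J - L. The term in ∑ u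
    -- disappears on functions of sum zero.
    𝓛² : ∀ u x → 𝓛 (𝓛 u) x ≡ Q ⊗ 𝓛 u x ⊖ ρ ⊗ Q ⊗ u x ⊕ ρ ⊗ ∑ u
    𝓛² u x = begin
      + 2 ⊗ ρ ⊗ 𝓛 u x ⊖ T (𝓛 u) x ≡⟨ cong (λ y → + 2 ⊗ ρ ⊗ 𝓛 u x ⊖ y) (T-comb {u} {T u} (+ 2 ⊗ ρ) -1ℤ (λ y → id₁ (+ 2 ⊗ ρ ⊗ u y) (T u y)) x) ⟩
      + 2 ⊗ ρ ⊗ 𝓛 u x ⊖ (+ 2 ⊗ ρ ⊗ T u x ⊕ -1ℤ ⊗ T (T u) x) ≡⟨ cong (λ y → + 2 ⊗ ρ ⊗ 𝓛 u x ⊖ (+ 2 ⊗ ρ ⊗ T u x ⊕ -1ℤ ⊗ y)) (T² u x) ⟩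
      + 2 ⊗ ρ ⊗ 𝓛 u x ⊖ (+ 2 ⊗ ρ ⊗ T u x ⊕ -1ℤ ⊗ (ρ ⊗ ∑ u ⊖ T u x ⊕ ρ ⊗ u x)) ≡⟨ id₂ ρ (u x) (T u x) (∑ u) ⟩
      Q ⊗ 𝓛 u x ⊖ ρ ⊗ Q ⊗ u x ⊕ ρ ⊗ ∑ u ∎
      where
      open ≡-Reasoning
      id₁ : ∀ a b → a ⊖ b ≡ a ⊕ -1ℤ ⊗ b
      id₁ = solve-∀
      id₂ : ∀ ρ u t S → + 2 ⊗ ρ ⊗ (+ 2 ⊗ ρ ⊗ u ⊖ t) ⊖ (+ 2 ⊗ ρ ⊗ t ⊕ -1ℤ ⊗ (ρ ⊗ S ⊖ t ⊕ ρ ⊗ u))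
        ≡ (+ 4 ⊗ ρ ⊕ 1ℤ) ⊗ (+ 2 ⊗ ρ ⊗ u ⊖ t) ⊖ ρ ⊗ (+ 4 ⊗ ρ ⊕ 1ℤ) ⊗ u ⊕ ρ ⊗ S
      id₂ = solve-∀

    ∑𝓛≡0 : ∀ u → ∑ (𝓛 u) ≡ 0ℤ
    ∑𝓛≡0 u = begin
      ∑ (𝓛 u) ≡⟨ ∑-cong (λ x → id₁ (+ 2 ⊗ ρ ⊗ u x) (T u x)) ⟩
      ∑ (λ x → + 2 ⊗ ρ ⊗ u x ⊕ -1ℤ ⊗ T u x) ≡⟨ ∑-comb (+ 2 ⊗ ρ) -1ℤ u (T u) ⟩
      + 2 ⊗ ρ ⊗ ∑ u ⊕ -1ℤ ⊗ ∑ (T u) ≡⟨ cong (λ y → + 2 ⊗ ρ ⊗ ∑ u ⊕ -1ℤ ⊗ y) (trans (∑-comm (λ x y → s (x - y) ⊗ u y)) (trans (∑-cong column) (∑-*ˡ (+ 2 ⊗ ρ) u))) ⟩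
      + 2 ⊗ ρ ⊗ ∑ u ⊕ -1ℤ ⊗ (+ 2 ⊗ ρ ⊗ ∑ u) ≡⟨ id₂ (+ 2 ⊗ ρ ⊗ ∑ u) ⟩
      0ℤ ∎
      where
      open ≡-Reasoning
      id₁ : ∀ a b → a ⊖ b ≡ a ⊕ -1ℤ ⊗ b
      id₁ = solve-∀
      id₂ : ∀ a → a ⊕ -1ℤ ⊗ a ≡ 0ℤ
      id₂ = solve-∀
      column : ∀ y → ∑ (λ x → s (x - y) ⊗ u y) ≡ + 2 ⊗ ρ ⊗ u y
      column y = trans (∑-cong (λ x → ℤ.*-comm (s (x - y)) (u y))) (trans (∑-*ˡ (u y) (λ x → s (x - y)))
        (trans (cong (u y ⊗_) (trans (∑-translate y s) ∑s)) (ℤ.*-comm (u y) (+ 2 ⊗ ρ))))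

    𝓛-const : ∀ c x → 𝓛 (λ _ → c) x ≡ 0ℤ
    𝓛-const c x = trans (cong (λ y → + 2 ⊗ ρ ⊗ c ⊖ y) (trans (∑-cong (λ y → ℤ.*-comm (s (x - y)) c))
      (trans (∑-*ˡ c (λ y → s (x - y))) (cong (c ⊗_) (trans (∑-reflect x s) ∑s))))) (id₁ (+ 2 ⊗ ρ) c)
      where
      id₁ : ∀ a c → a ⊗ c ⊖ c ⊗ a ≡ 0ℤ
      id₁ = solve-∀

    -- Multiplication by β² carries the graph to its complement, whose Laplacian is Q − J − 𝓛.
    𝓛-β² : ∀ u x → 𝓛 u (β² * x) ≡ Q ⊗ u (β² * x) ⊖ 𝓛 (λ y → u (β² * y)) x ⊖ ∑ u
    𝓛-β² u x = sym (trans (cong (λ y → Q ⊗ u (β² * x) ⊖ (+ 2 ⊗ ρ ⊗ u (β² * x) ⊖ y) ⊖ ∑ u) T-β²) (id₁ ρ (u (β² * x)) (∑ u) (T u (β² * x))))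
      where
      open ≡-Reasoning
      id₁ : ∀ ρ u S t → (+ 4 ⊗ ρ ⊕ 1ℤ) ⊗ u ⊖ (+ 2 ⊗ ρ ⊗ u ⊖ (1ℤ ⊗ (1ℤ ⊗ S ⊕ -1ℤ ⊗ u) ⊕ -1ℤ ⊗ t)) ⊖ S ≡ + 2 ⊗ ρ ⊗ u ⊖ t
      id₁ = solve-∀
      id₂ : ∀ d s u → (1ℤ ⊖ d ⊖ s) ⊗ u ≡ 1ℤ ⊗ (1ℤ ⊗ u ⊕ -1ℤ ⊗ (d ⊗ u)) ⊕ -1ℤ ⊗ (s ⊗ u)
      id₂ = solve-∀
      z : Carrier
      z = β² * x
      T-β² : T (λ y → u (β² * y)) x ≡ 1ℤ ⊗ (1ℤ ⊗ ∑ u ⊕ -1ℤ ⊗ u z) ⊕ -1ℤ ⊗ T u z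
      T-β² = begin
        ∑ (λ y → s (x - y) ⊗ u (β² * y)) ≡⟨ ∑-cong (λ y → cong (_⊗ u (β² * y)) (trans (sym (s'-β² (x - y))) (cong s' (x[y-z]≈xy-xz β² x y)))) ⟩
        ∑ (λ y → s' (z - β² * y) ⊗ u (β² * y)) ≡⟨ ∑-β² (λ y → s' (z - y) ⊗ u y) ⟩
        ∑ (λ y → s' (z - y) ⊗ u y) ≡⟨ ∑-cong (λ y → id₂ (δ (z - y)) (s (z - y)) (u y)) ⟩
        ∑ (λ y → 1ℤ ⊗ (1ℤ ⊗ u y ⊕ -1ℤ ⊗ (δ (z - y) ⊗ u y)) ⊕ -1ℤ ⊗ (s (z - y) ⊗ u y))
          ≡⟨ ∑-comb 1ℤ -1ℤ (λ y → 1ℤ ⊗ u y ⊕ -1ℤ ⊗ (δ (z - y) ⊗ u y)) (λ y → s (z - y) ⊗ u y) ⟩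
        1ℤ ⊗ ∑ (λ y → 1ℤ ⊗ u y ⊕ -1ℤ ⊗ (δ (z - y) ⊗ u y)) ⊕ -1ℤ ⊗ T u z
          ≡⟨ cong (λ a → 1ℤ ⊗ a ⊕ -1ℤ ⊗ T u z) (trans (∑-comb 1ℤ -1ℤ u (λ y → δ (z - y) ⊗ u y)) (cong (λ b → 1ℤ ⊗ ∑ u ⊕ -1ℤ ⊗ b) (δ-pick z u))) ⟩
        1ℤ ⊗ (1ℤ ⊗ ∑ u ⊕ -1ℤ ⊗ u z) ⊕ -1ℤ ⊗ T u z ∎

-- Functions of sum zero as integer vectors of length 4r.

module Coordinates where

  open IntegerVectors
  open FieldArithmetic
  open Cyclotomy
  open Laplacian
  open import Data.Nat as ℕ using (ℕ; zero; suc; NonZero)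
  import Data.Nat.Properties as ℕ
  open import Data.Nat.Primality using (Prime)
  open import Data.Integer as ℤ using (ℤ; +_; 0ℤ; 1ℤ; -1ℤ) renaming (_+_ to infixl 6 _⊕_; _-_ to infixl 6 _⊖_; _*_ to infixl 7 _⊗_)
  import Data.Integer.Properties as ℤ
  open import Data.Integer.Tactic.RingSolver using (solve-∀)
  import Algebra.Properties.Semiring.Sum ℤ.+-*-semiring as ℤ-Sum
  open import Data.Fin using (Fin; zero; suc; fromℕ<)
  open import Data.Product using (_,_)
  open import Data.Vec.Functional using (Vector; _∷_)
  open import Function using (_∘_)
  open import Relation.Binary.PropositionalEquality using (_≡_; _≗_; refl; sym; trans; cong; cong₂; module ≡-Reasoning)

  module Reduced (r : ℕ) (r>1 : r ℕ.> 1) (r≢0 : NonZero r) (r' : ℕ) (r≡2r' : r ≡ 2 ℕ.* r')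
    (F : FiniteField (suc (4 ℕ.* r))) (β : FiniteField.Carrier F) (β-primitive : FiniteField.IsPrimitive F β)
    (p k t : ℕ) (p-prime : Prime p) (p≡4k+3 : p ≡ 4 ℕ.* k ℕ.+ 3) (q≡pᵗ : suc (4 ℕ.* r) ≡ p ℕ.^ suc t) where

    open Field F
    open Primitive β β-primitive
    open Summation F public
    open Indicator r r≢0 r' r≡2r' F β β-primitive p k t p-prime p≡4k+3 q≡pᵗ
    open Operator r r≢0 r' r≡2r' F β β-primitive p k t p-prime p≡4k+3 q≡pᵗ public

    -- Functions on V of sum zero are identified with ℤ⁴ʳ by forgetting the value at to zero.
    restrict : (Carrier → ℤ) → Vector ℤ (4 ℕ.* r)
    restrict v i = v (to (suc i))

    extend : Vector ℤ (4 ℕ.* r) → Carrier → ℤ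
    extend u x = ((ℤ.- ℤ-Sum.sum u) ∷ u) (from x)

    restrict-extend : ∀ u → restrict (extend u) ≗ u
    restrict-extend u i = cong ((ℤ.- ℤ-Sum.sum u) ∷ u) (from-to (suc i))

    ∑-extend : ∀ u → ∑ (extend u) ≡ 0ℤ
    ∑-extend u = trans (∑-def (extend u)) (trans (ℤ-Sum.sum-cong-≗ (λ i → cong ((ℤ.- ℤ-Sum.sum u) ∷ u) (from-to i))) (ℤ.+-inverseˡ (ℤ-Sum.sum u)))

    extend-restrict : ∀ v → ∑ v ≡ 0ℤ → extend (restrict v) ≗ v
    extend-restrict v ∑v≡0 x = trans (at (from x)) (cong v (to-from x))
      where
      total : v (to zero) ⊕ ℤ-Sum.sum (restrict v) ≡ 0ℤ
      total = trans (sym (∑-def v)) ∑v≡0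
      id₁ : ∀ a b → ℤ.- b ≡ a ⊖ (a ⊕ b)
      id₁ = solve-∀
      at : ∀ i → ((ℤ.- ℤ-Sum.sum (restrict v)) ∷ restrict v) i ≡ v (to i)
      at zero = trans (id₁ (v (to zero)) (ℤ-Sum.sum (restrict v))) (trans (cong (v (to zero) ⊖_) total) (ℤ.+-identityʳ (v (to zero))))
      at (suc i) = refl

    sum-comb : ∀ {n} {u v w : Vector ℤ n} a b → (∀ i → w i ≡ a ⊗ u i ⊕ b ⊗ v i) → ℤ-Sum.sum w ≡ a ⊗ ℤ-Sum.sum u ⊕ b ⊗ ℤ-Sum.sum v
    sum-comb {u = u} {v} a b e = trans (ℤ-Sum.sum-cong-≗ e) (trans (ℤ-Sum.∑-distrib-+ (λ i → a ⊗ u i) (λ i → b ⊗ v i))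
      (sym (cong₂ _⊕_ (ℤ-Sum.*-distribˡ-sum a u) (ℤ-Sum.*-distribˡ-sum b v))))

    extend-comb : ∀ {u v w} a b → (∀ i → w i ≡ a ⊗ u i ⊕ b ⊗ v i) → ∀ x → extend w x ≡ a ⊗ extend u x ⊕ b ⊗ extend v x
    extend-comb {u} {v} {w} a b e x = at (from x)
      where
      id₁ : ∀ a b x y → ℤ.- (a ⊗ x ⊕ b ⊗ y) ≡ a ⊗ (ℤ.- x) ⊕ b ⊗ (ℤ.- y)
      id₁ = solve-∀
      at : ∀ i → ((ℤ.- ℤ-Sum.sum w) ∷ w) i ≡ a ⊗ ((ℤ.- ℤ-Sum.sum u) ∷ u) i ⊕ b ⊗ ((ℤ.- ℤ-Sum.sum v) ∷ v) i
      at zero = trans (cong ℤ.-_ (sum-comb {u = u} {v} {w} a b e)) (id₁ a b (ℤ-Sum.sum u) (ℤ-Sum.sum v))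
      at (suc i) = e i

    ℓ : Vector ℤ (4 ℕ.* r) → Vector ℤ (4 ℕ.* r)
    ℓ u = restrict (𝓛 (extend u))

    ℓ-linear : Linear ℓ
    ℓ-linear = record { comb = λ {u} {v} {w} a b e i → 𝓛-comb {extend u} {extend v} a b (extend-comb {u} {v} {w} a b e) (to (suc i)) }

    extend-ℓ : ∀ u → extend (ℓ u) ≗ 𝓛 (extend u)
    extend-ℓ u = extend-restrict (𝓛 (extend u)) (∑𝓛≡0 (extend u))

    quadratic : ∀ u i → ℓ (ℓ u) i ≡ Q ⊗ ℓ u i ⊖ ρ ⊗ Q ⊗ u i
    quadratic u i = begin
      𝓛 (extend (ℓ u)) x ≡⟨ 𝓛-cong (extend-ℓ u) x ⟩
      𝓛 (𝓛 (extend u)) x ≡⟨ 𝓛² (extend u) x ⟩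
      Q ⊗ 𝓛 (extend u) x ⊖ ρ ⊗ Q ⊗ extend u x ⊕ ρ ⊗ ∑ (extend u)
        ≡⟨ cong₂ (λ a b → Q ⊗ 𝓛 (extend u) x ⊖ ρ ⊗ Q ⊗ a ⊕ ρ ⊗ b) (restrict-extend u i) (∑-extend u) ⟩
      Q ⊗ ℓ u i ⊖ ρ ⊗ Q ⊗ u i ⊕ ρ ⊗ 0ℤ ≡⟨ id₁ (Q ⊗ ℓ u i ⊖ ρ ⊗ Q ⊗ u i) ρ ⟩
      Q ⊗ ℓ u i ⊖ ρ ⊗ Q ⊗ u i ∎
      where
      open ≡-Reasoning
      x : Carrier
      x = to (suc i)
      id₁ : ∀ a b → a ⊕ b ⊗ 0ℤ ≡ a
      id₁ = solve-∀

    dilate : (Carrier → Carrier) → Vector ℤ (4 ℕ.* r) → Vector ℤ (4 ℕ.* r)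
    dilate m u = restrict (extend u ∘ m)

    dilate-linear : ∀ m → Linear (dilate m)
    dilate-linear m = record { comb = λ {u} {v} {w} a b e i → extend-comb {u} {v} {w} a b e (m (to (suc i))) }

    ∑-β⁻² : ∀ (f : Carrier → ℤ) → ∑ (λ x → f (β⁻² * x)) ≡ ∑ f
    ∑-β⁻² = ∑-reindex (β⁻² *_) (β² *_) β⁻²β² β²β⁻²

    τ σ⁻ : Vector ℤ (4 ℕ.* r) → Vector ℤ (4 ℕ.* r)
    τ = dilate (β² *_)
    σ⁻ = dilate (β⁻² *_)

    -- A dilation permutes the field, so the dilated function still has sum zero and the value
    -- forgotten by `restrict` can be recovered.
    τσ : ∀ u → τ (σ⁻ u) ≗ u
    τσ u i = trans (extend-restrict (λ x → extend u (β⁻² * x)) (trans (∑-β⁻² (extend u)) (∑-extend u)) (β² * to (suc i)))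
      (trans (cong (extend u) (β⁻²β² (to (suc i)))) (restrict-extend u i))

    στ : ∀ u → σ⁻ (τ u) ≗ u
    στ u i = trans (extend-restrict (λ x → extend u (β² * x)) (trans (∑-β² (extend u)) (∑-extend u)) (β⁻² * to (suc i)))
      (trans (cong (extend u) (β²β⁻² (to (suc i)))) (restrict-extend u i))

    τℓ : ∀ u i → τ (ℓ u) i ≡ Q ⊗ τ u i ⊖ ℓ (τ u) i
    τℓ u i = begin
      extend (ℓ u) (β² * x) ≡⟨ extend-ℓ u (β² * x) ⟩
      𝓛 (extend u) (β² * x) ≡⟨ 𝓛-β² (extend u) x ⟩
      Q ⊗ τ u i ⊖ 𝓛 (λ y → extend u (β² * y)) x ⊖ ∑ (extend u)
        ≡⟨ cong₂ (λ a b → Q ⊗ τ u i ⊖ a ⊖ b) (sym (𝓛-cong (extend-restrict (λ y → extend u (β² * y)) (trans (∑-β² (extend u)) (∑-extend u))) x)) (∑-extend u) ⟩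
      Q ⊗ τ u i ⊖ ℓ (τ u) i ⊖ 0ℤ ≡⟨ ℤ.+-identityʳ (Q ⊗ τ u i ⊖ ℓ (τ u) i) ⟩
      Q ⊗ τ u i ⊖ ℓ (τ u) i ∎
      where
      open ≡-Reasoning
      x : Carrier
      x = to (suc i)

    -- The point mass at `to zero`, the vertex whose value `restrict` forgets.
    e₀ : Carrier → ℤ
    e₀ x = (1ℤ ∷ (λ _ → 0ℤ)) (from x)

    g₀ w₀ : Vector ℤ (4 ℕ.* r)
    g₀ = restrict (𝓛 e₀)
    w₀ _ = -1ℤ

    -- q e₀ − 1 has sum zero, and 𝓛 kills constants.
    g₀-multiple : ∀ i → Q ⊗ g₀ i ≡ ℓ w₀ i
    g₀-multiple i = sym (trans (𝓛-comb {e₀} {λ _ → 1ℤ} Q -1ℤ (λ y → at (from y)) x)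
      (trans (cong (λ a → Q ⊗ 𝓛 e₀ x ⊕ -1ℤ ⊗ a) (𝓛-const 1ℤ x)) (ℤ.+-identityʳ (Q ⊗ 𝓛 e₀ x))))
      where
      x : Carrier
      x = to (suc i)
      sum-const : ∀ m → ℤ.- ℤ-Sum.sum {m} (λ _ → -1ℤ) ≡ + m
      sum-const zero = refl
      sum-const (suc m) = trans (id₁ (ℤ-Sum.sum {m} (λ _ → -1ℤ))) (cong (1ℤ ⊕_) (sum-const m))
        where
        id₁ : ∀ a → ℤ.- (-1ℤ ⊕ a) ≡ 1ℤ ⊕ (ℤ.- a)
        id₁ = solve-∀
      id₂ : ∀ a → a ≡ (a ⊕ 1ℤ) ⊗ 1ℤ ⊕ -1ℤ ⊗ 1ℤ
      id₂ = solve-∀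
      id₃ : ∀ a → -1ℤ ≡ a ⊗ 0ℤ ⊕ -1ℤ ⊗ 1ℤ
      id₃ = solve-∀
      at : ∀ j → ((ℤ.- ℤ-Sum.sum w₀) ∷ w₀) j ≡ Q ⊗ (1ℤ ∷ (λ _ → 0ℤ)) j ⊕ -1ℤ ⊗ 1ℤ
      at zero = trans (sum-const (4 ℕ.* r)) (trans (ℤ.pos-* 4 r) (id₂ (+ 4 ⊗ ρ)))
      at (suc j) = id₃ Q

    i₀ : Fin (4 ℕ.* r)
    i₀ = fromℕ< (ℕ.>-nonZero⁻¹ (4 ℕ.* r) {{ℕ.m*n≢0 4 r {{_}} {{r≢0}}}})

    open Spectral.Quadratic r r>1 ℓ ℓ-linear quadratic τ σ⁻ (dilate-linear (β² *_)) (dilate-linear (β⁻² *_)) τσ στ τℓ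
      g₀ w₀ g₀-multiple i₀ refl public hiding (ρ; Q)

    open Peisert F β using (InImL; applyL)

    InImL⇒∑≡0 : ∀ v → InImL v → ∑ v ≡ 0ℤ
    InImL⇒∑≡0 v (u , e) = trans (∑-cong (λ x → trans (e x) (applyL≡𝓛 u x))) (∑𝓛≡0 u)

    InImL⇒Image : ∀ v → InImL v → Image (restrict v)
    -- The coefficient of `e₀` has to be ∑ u, because the other summand has sum zero.
    InImL⇒Image v (u , e) = ∑ u , restrict u , λ i → begin
      v (to (suc i)) ≡⟨ trans (e _) (applyL≡𝓛 u _) ⟩
      𝓛 u (to (suc i)) ≡⟨ 𝓛-comb {e₀} {extend (restrict u)} (∑ u) 1ℤ split (to (suc i)) ⟩
      ∑ u ⊗ g₀ i ⊕ 1ℤ ⊗ ℓ (restrict u) i ≡⟨ cong (λ a → ∑ u ⊗ g₀ i ⊕ a) (ℤ.*-identityˡ (ℓ (restrict u) i)) ⟩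
      ∑ u ⊗ g₀ i ⊕ ℓ (restrict u) i ∎
      where
      open ≡-Reasoning
      id₁ : ∀ a b → a ≡ (a ⊕ b) ⊗ 1ℤ ⊕ 1ℤ ⊗ (ℤ.- b)
      id₁ = solve-∀
      id₂ : ∀ a b → b ≡ a ⊗ 0ℤ ⊕ 1ℤ ⊗ b
      id₂ = solve-∀
      at : ∀ i → u (to i) ≡ ∑ u ⊗ (1ℤ ∷ (λ _ → 0ℤ)) i ⊕ 1ℤ ⊗ ((ℤ.- ℤ-Sum.sum (restrict u)) ∷ restrict u) i
      at zero = trans (id₁ (u (to zero)) (ℤ-Sum.sum (restrict u)))
        (cong (λ S → S ⊗ 1ℤ ⊕ 1ℤ ⊗ (ℤ.- ℤ-Sum.sum (restrict u))) (sym (∑-def u)))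
      at (suc i) = id₂ (∑ u) (u (to (suc i)))
      split : ∀ x → u x ≡ ∑ u ⊗ e₀ x ⊕ 1ℤ ⊗ extend (restrict u) x
      split x = trans (cong u (sym (to-from x))) (at (from x))

    extend-cong : ∀ {u v} → u ≗ v → extend u ≗ extend v
    extend-cong {u} {v} e x = at (from x)
      where
      at : ∀ i → ((ℤ.- ℤ-Sum.sum u) ∷ u) i ≡ ((ℤ.- ℤ-Sum.sum v) ∷ v) i
      at zero = cong ℤ.-_ (ℤ-Sum.sum-cong-≗ e)
      at (suc i) = e i

    Image⇒InImL : ∀ v → ∑ v ≡ 0ℤ → Image (restrict v) → InImL v
    Image⇒InImL v ∑v≡0 (c , w , e) = u , λ x → begin
      v x ≡⟨ extend-restrict v ∑v≡0 x ⟨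
      extend (restrict v) x ≡⟨ extend-cong same x ⟩
      extend (restrict (𝓛 u)) x ≡⟨ extend-restrict (𝓛 u) (∑𝓛≡0 u) x ⟩
      𝓛 u x ≡⟨ applyL≡𝓛 u x ⟨
      applyL u x ∎
      where
      open ≡-Reasoning
      u : Carrier → ℤ
      u x = c ⊗ e₀ x ⊕ 1ℤ ⊗ extend w x
      same : restrict v ≗ restrict (𝓛 u)
      same i = trans (e i) (sym (trans (𝓛-comb {e₀} {extend w} c 1ℤ (λ _ → refl) (to (suc i)))
        (cong (λ a → c ⊗ g₀ i ⊕ a) (ℤ.*-identityˡ (ℓ w i)))))

-- The two parts of the critical group.

module CriticalGroup where

  open IntegerVectors
  open Coordinates
  open import Data.Nat as ℕ using (ℕ; zero; suc; NonZero; s≤s; z≤n)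
  import Data.Nat.Properties as ℕ
  import Data.Nat.DivMod as ℕ
  import Data.Nat.Divisibility as ℕ
  open import Data.Nat.GCD using (module Bézout)
  open import Data.Nat.Coprimality as Coprimality using (Coprime; coprime-Bézout; coprime-divisor)
  open import Data.Nat.Primality using (Prime; prime⇒nonZero; ¬prime[1])
  open import Data.Nat.Tactic.RingSolver using () renaming (solve-∀ to ℕ-solve-∀)
  open import Data.Integer as ℤ using (ℤ; +_; 0ℤ; 1ℤ; -1ℤ) renaming (_+_ to infixl 6 _⊕_; _-_ to infixl 6 _⊖_; _*_ to infixl 7 _⊗_)
  import Data.Integer.Properties as ℤ
  open import Data.Integer.Divisibility.Signed using (_∣_; divides; ∣⇒∣ᵤ; ∣ᵤ⇒∣)
  open import Data.Integer.Tactic.RingSolver using (solve-∀)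
  open import Data.Fin using (Fin; zero; suc)
  open import Data.Product using (∃-syntax; _×_; _,_; proj₁; proj₂)
  open import Data.Sum using (inj₁; inj₂)
  open import Data.Vec.Functional using (Vector)
  open import Relation.Nullary using (contradiction)
  open import Relation.Binary.PropositionalEquality using (_≡_; _≗_; refl; sym; trans; cong; cong₂; subst; module ≡-Reasoning)

  coprime-product : ∀ {a b c} → Coprime a c → Coprime b c → Coprime (a ℕ.* b) c
  coprime-product {a} {b} {c} ac bc {d} (d∣ab , d∣c) =
    bc (coprime-divisor {d} {a} {b} (λ { (e∣d , e∣a) → ac (e∣a , ℕ.∣-trans e∣d d∣c) }) d∣ab , d∣c)

  coprime-power : ∀ {n p} → Coprime n p → ∀ k → Coprime n (p ℕ.^ k)
  coprime-power c zero (_ , d∣1) = ℕ.∣1⇒≡1 d∣1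
  coprime-power {n} {p} c (suc k) = Coprimality.sym (coprime-product {p} {p ℕ.^ k} {n} (Coprimality.sym c) (Coprimality.sym (coprime-power c k)))

  bézout : ∀ m n → Coprime m n → ∃[ a ] ∃[ b ] a ⊗ + m ⊕ b ⊗ + n ≡ 1ℤ
  bézout m n c with coprime-Bézout c
  ... | Bézout.+- x y e = + x , ℤ.- + y , (begin
    + x ⊗ + m ⊕ (ℤ.- + y) ⊗ + n ≡⟨ cong (λ a → a ⊕ (ℤ.- + y) ⊗ + n) (trans (sym (ℤ.pos-* x m)) (trans (cong +_ (sym e)) (cong (1ℤ ⊕_) (ℤ.pos-* y n)))) ⟩
    1ℤ ⊕ + y ⊗ + n ⊕ (ℤ.- + y) ⊗ + n ≡⟨ id₁ (+ y) (+ n) ⟩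
    1ℤ ∎)
    where
    open ≡-Reasoning
    id₁ : ∀ y n → 1ℤ ⊕ y ⊗ n ⊕ (ℤ.- y) ⊗ n ≡ 1ℤ
    id₁ = solve-∀
  ... | Bézout.-+ x y e = ℤ.- + x , + y , (begin
    (ℤ.- + x) ⊗ + m ⊕ + y ⊗ + n ≡⟨ cong (λ a → (ℤ.- + x) ⊗ + m ⊕ a) (trans (sym (ℤ.pos-* y n)) (trans (cong +_ (sym e)) (cong (1ℤ ⊕_) (ℤ.pos-* x m)))) ⟩
    (ℤ.- + x) ⊗ + m ⊕ (1ℤ ⊕ + x ⊗ + m) ≡⟨ id₁ (+ x) (+ m) ⟩
    1ℤ ∎)
    where
    open ≡-Reasoning
    id₁ : ∀ x m → (ℤ.- x) ⊗ m ⊕ (1ℤ ⊕ x ⊗ m) ≡ 1ℤ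
    id₁ = solve-∀

  module _ (r : ℕ) (r>1 : r ℕ.> 1) (r≢0 : NonZero r) (r' : ℕ) (r≡2r' : r ≡ 2 ℕ.* r')
    (F : FiniteField (suc (4 ℕ.* r))) (β : FiniteField.Carrier F) (β-primitive : FiniteField.IsPrimitive F β)
    (p k t : ℕ) (p-prime : Prime p) (p≡4k+3 : p ≡ 4 ℕ.* k ℕ.+ 3) (q≡pᵗ : suc (4 ℕ.* r) ≡ p ℕ.^ suc t) where

    open FiniteField F using (Carrier)
    open Peisert F β using (InImL; InKp; InKp'; _∼_) renaming (_⊕_ to _⊞_)
    open Reduced r r>1 r≢0 r' r≡2r' F β β-primitive p k t p-prime p≡4k+3 q≡pᵗ

    -- A common divisor divides both 4r and q = 4r + 1.
    coprime-r-p : Coprime r p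
    coprime-r-p {d} (d∣r , d∣p) = ℕ.∣1⇒≡1 (ℕ.∣m+n∣m⇒∣n {d} {4 ℕ.* r} {1}
      (subst (d ℕ.∣_) (trans (sym q≡pᵗ) (ℕ.+-comm 1 (4 ℕ.* r))) (ℕ.∣m⇒∣m*n (p ℕ.^ t) d∣p)) (ℕ.∣n⇒∣m*n 4 d∣r))

    -- Values of L have sum zero, so n ∑ v = 0. Every torsion class of the cokernel therefore lies
    -- in the lattice of functions of sum zero.
    ∑-torsion : ∀ n .{{_ : NonZero n}} v → InImL (λ x → + n ⊗ v x) → ∑ v ≡ 0ℤ
    ∑-torsion n v im = ℤ.*-cancelˡ-≡ (+ n) (∑ v) 0ℤ (trans (sym (∑-*ˡ (+ n) v)) (trans (InImL⇒∑≡0 _ im) (sym (ℤ.*-zeroʳ (+ n)))))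

    ∑-minus : ∀ v w → ∑ v ≡ 0ℤ → ∑ w ≡ 0ℤ → ∑ (λ x → v x ⊖ w x) ≡ 0ℤ
    ∑-minus v w ∑v ∑w = trans (∑-cong (λ x → id₁ (v x) (w x))) (trans (∑-comb 1ℤ -1ℤ v w) (cong₂ (λ a b → 1ℤ ⊗ a ⊕ -1ℤ ⊗ b) ∑v ∑w))
      where
      id₁ : ∀ a b → a ⊖ b ≡ 1ℤ ⊗ a ⊕ -1ℤ ⊗ b
      id₁ = solve-∀

    p^≢0 : ∀ m → NonZero (p ℕ.^ m)
    p^≢0 m = ℕ.m^n≢0 p m {{prime⇒nonZero p-prime}}

    ∑-InKp : ∀ v → InKp p v → ∑ v ≡ 0ℤ
    ∑-InKp v (m , im) = ∑-torsion (p ℕ.^ m) {{p^≢0 m}} v im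

    ∑-InKp' : ∀ v → InKp' p v → ∑ v ≡ 0ℤ
    ∑-InKp' v (n , n≥1 , _ , im) = ∑-torsion n {{ℕ.>-nonZero n≥1}} v im

    -- A multiple pᵐ v lies in Im L, hence in Λ r, so r divides pᵐ ℓ' v; as r is prime to p, it
    -- divides ℓ' v.
    InKp⇒Λr : ∀ v → InKp p v → Λ r (restrict v)
    InKp⇒Λr v (m , im) i = ∣ᵤ⇒∣ (coprime-divisor (coprime-power coprime-r-p m)
      (subst (r ℕ.∣_) (ℤ.abs-* (+ (p ℕ.^ m)) (ℓ' (restrict v) i))
        (∣⇒∣ᵤ (subst (+ r ∣_) (f-scale ℓ'-linear (+ (p ℕ.^ m)) (restrict v) i) (Image⊆Λr _ (InImL⇒Image _ im) i)))))

    -- Λ r / Image is annihilated by q, which is prime to n.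
    Λr∩Kp' : ∀ n → Coprime n p → ∀ u → Image (λ i → + n ⊗ u i) → Λ r u → Image u
    Λr∩Kp' n c u im Λu with bézout n (p ℕ.^ suc t) (coprime-power c (suc t))
    ... | a , b , e = closed image-subgroup a b im (QΛr⊆Image u Λu) (λ i → begin
      u i ≡⟨ ℤ.*-identityˡ (u i) ⟨
      1ℤ ⊗ u i ≡⟨ cong (_⊗ u i) e ⟨
      (a ⊗ + n ⊕ b ⊗ + (p ℕ.^ suc t)) ⊗ u i ≡⟨ cong (λ y → (a ⊗ + n ⊕ b ⊗ y) ⊗ u i) (trans (cong +_ (sym q≡pᵗ)) +q≡Q) ⟩
      (a ⊗ + n ⊕ b ⊗ Q) ⊗ u i ≡⟨ id₁ a b (+ n) Q (u i) ⟩
      a ⊗ (+ n ⊗ u i) ⊕ b ⊗ (Q ⊗ u i) ∎)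
      where
      open ≡-Reasoning
      id₁ : ∀ a b n q u → (a ⊗ n ⊕ b ⊗ q) ⊗ u ≡ a ⊗ (n ⊗ u) ⊕ b ⊗ (q ⊗ u)
      id₁ = solve-∀

    φ : Vector ℤ (4 ℕ.* r) → Vector ℤ (2 ℕ.* r)
    φ = proj₁ Λr-free
    φ-linear : Linear φ
    φ-linear = proj₁ (proj₂ Λr-free)
    φ-onto : ∀ c → ∃[ u ] φ u ≗ c
    φ-onto = proj₁ (proj₂ (proj₂ Λr-free))
    Λr⇒φ : ∀ u → Λ r u → divisible (+ r) (φ u)
    Λr⇒φ = proj₁ (proj₂ (proj₂ (proj₂ Λr-free)))
    φ⇒Λr : ∀ u → divisible (+ r) (φ u) → Λ r u
    φ⇒Λr = proj₂ (proj₂ (proj₂ (proj₂ Λr-free)))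

    Kp'≅ : Kp'≅ZmodPow F β p r (2 ℕ.* r)
    Kp'≅ = f , well-defined , additive , injective , surjective
      where
      f : (Carrier → ℤ) → Fin (2 ℕ.* r) → ℤ
      f v = φ (restrict v)

      well-defined : ∀ v w → InKp' p v → InKp' p w → v ∼ w → f v ≡[mod r ]ᵥ f w
      well-defined v w _ _ im i = ∣⇒∣ᵤ (subst (+ r ∣_) (f-minus φ-linear (restrict v) (restrict w) i)
        (Λr⇒φ _ (Image⊆Λr _ (InImL⇒Image _ im)) i))

      additive : ∀ v w → InKp' p v → InKp' p w → f (v ⊞ w) ≡[mod r ]ᵥ (λ i → f v i ⊕ f w i)
      additive v w _ _ i = ∣⇒∣ᵤ {+ r} (divides 0ℤ (trans
        (cong (_⊖ (f v i ⊕ f w i)) (comb φ-linear {restrict v} {restrict w} 1ℤ 1ℤ (λ j → id₁ (v _) (w _)) i))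
        (id₂ (f v i) (f w i))))
        where
        id₁ : ∀ a b → a ⊕ b ≡ 1ℤ ⊗ a ⊕ 1ℤ ⊗ b
        id₁ = solve-∀
        id₂ : ∀ a b → 1ℤ ⊗ a ⊕ 1ℤ ⊗ b ⊖ (a ⊕ b) ≡ 0ℤ
        id₂ = solve-∀

      injective : ∀ v w → InKp' p v → InKp' p w → f v ≡[mod r ]ᵥ f w → v ∼ w
      injective v w v∈@(m , _ , cm , imv) w∈@(n , _ , cn , imw) e =
        -- The product m n of the two annihilators kills the difference and is still prime to p,
        -- while agreement under `φ` modulo r puts the difference in Λ r.
        Image⇒InImL _ (∑-minus v w (∑-InKp' v v∈) (∑-InKp' w w∈)) (Λr∩Kp' (m ℕ.* n) (coprime-product cm cn) u
          (closed image-subgroup (+ n) (ℤ.- + m) (InImL⇒Image _ imv) (InImL⇒Image _ imw)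
            (λ i → trans (cong (_⊗ u i) (ℤ.pos-* m n)) (id₁ (+ m) (+ n) (restrict v i) (restrict w i))))
          (φ⇒Λr u (λ i → subst (+ r ∣_) (sym (f-minus φ-linear (restrict v) (restrict w) i)) (∣ᵤ⇒∣ {+ r} (e i)))))
        where
        u : Vector ℤ (4 ℕ.* r)
        u = restrict v ⊝ restrict w
        id₁ : ∀ m n v w → m ⊗ n ⊗ (v ⊖ w) ≡ n ⊗ (m ⊗ v) ⊕ (ℤ.- m) ⊗ (n ⊗ w)
        id₁ = solve-∀

      surjective : ∀ c → ∃[ v ] (InKp' p v × f v ≡[mod r ]ᵥ c)
      -- A lift u of c may have a p-primary component. Multiplying by q removes it, since rq
      -- annihilates the quotient, and keeps `φ` u modulo r because q ≡ 1.
      surjective c = v , (r , ℕ.<⇒≤ r>1 , coprime-r-p , Image⇒InImL _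
          (trans (∑-*ˡ (+ r) v) (trans (cong (+ r ⊗_) (∑-extend Qu)) (ℤ.*-zeroʳ (+ r))))
          (respects image-subgroup (ρQ∈Image u) (λ i → trans (cong (+ r ⊗_) (restrict-extend Qu i)) (id₁ (+ r) Q (u i))))) ,
        λ i → ∣⇒∣ᵤ {+ r} (divides (+ 4 ⊗ c i) (begin
          φ (restrict v) i ⊖ c i ≡⟨ cong (_⊖ c i) (trans (f-cong φ-linear (restrict-extend Qu) i) (trans (f-scale φ-linear Q u i) (cong (Q ⊗_) (proj₂ (φ-onto c) i)))) ⟩
          Q ⊗ c i ⊖ c i ≡⟨ id₂ (+ r) (c i) ⟩
          + 4 ⊗ c i ⊗ + r ∎))
        where
        open ≡-Reasoning
        u Qu : Vector ℤ (4 ℕ.* r)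
        u = proj₁ (φ-onto c)
        Qu i = Q ⊗ u i
        v : Carrier → ℤ
        v = extend Qu
        id₁ : ∀ a b c → a ⊗ (b ⊗ c) ≡ a ⊗ b ⊗ c
        id₁ = solve-∀
        id₂ : ∀ r c → (+ 4 ⊗ r ⊕ 1ℤ) ⊗ c ⊖ c ≡ + 4 ⊗ c ⊗ r
        id₂ = solve-∀

    Kp-order : KpHasOrder F β p (suc (4 ℕ.* r) ℕ.^ (2 ℕ.* r ℕ.∸ 1))
    Kp-order = (λ i → extend (rep X i)) , in-Kp , distinct-classes , covered
      where
      X : Index (Λ r) Image (suc (4 ℕ.* r) ℕ.^ (2 ℕ.* r ℕ.∸ 1))
      X = index-Λr-Image

      in-Kp : ∀ i → InKp p (extend (rep X i))
      in-Kp i = suc t , Image⇒InImL _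
        (trans (∑-*ˡ (+ (p ℕ.^ suc t)) (extend (rep X i))) (trans (cong (+ (p ℕ.^ suc t) ⊗_) (∑-extend (rep X i))) (ℤ.*-zeroʳ (+ (p ℕ.^ suc t)))))
        (respects image-subgroup (QΛr⊆Image _ (rep∈ X i))
          (λ j → cong₂ _⊗_ (trans (cong +_ (sym q≡pᵗ)) +q≡Q) (restrict-extend (rep X i) j)))

      distinct-classes : ∀ i j → extend (rep X i) ∼ extend (rep X j) → i ≡ j
      distinct-classes i j im = distinct X i j (respects image-subgroup (InImL⇒Image _ im)
        (λ x → sym (cong₂ _⊖_ (restrict-extend (rep X i) x) (restrict-extend (rep X j) x))))

      covered : ∀ v → InKp p v → ∃[ i ] v ∼ extend (rep X i)
      covered v v∈ = let i , im = cover X (restrict v) (InKp⇒Λr v v∈) in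
        i , Image⇒InImL _ (∑-minus v (extend (rep X i)) (∑-InKp v v∈) (∑-extend (rep X i)))
          (respects image-subgroup im (λ x → cong (restrict v x ⊖_) (restrict-extend (rep X i) x)))

  -- The constant a comes from (4k + 3)² = 8a + 1, and (8a + 1)(8c + 1) = 8(a(1 + 8c) + c) + 1. That
  -- q ≡ 1 modulo 8 makes r even, which is what puts -1 in C₀ and makes adjacency symmetric.
  power-mod-8 : ∀ p k → p ≡ 4 ℕ.* k ℕ.+ 3 → ∀ t → ∃[ c ] p ℕ.^ (2 ℕ.* t) ≡ suc (4 ℕ.* (2 ℕ.* c))
  power-mod-8 p k e zero = 0 , refl
  power-mod-8 p k e (suc t) with power-mod-8 p k e t
  ... | c , e' = a ℕ.* (1 ℕ.+ 8 ℕ.* c) ℕ.+ c , (begin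
    p ℕ.^ (2 ℕ.* suc t) ≡⟨ cong (p ℕ.^_) (id₁ t) ⟩
    p ℕ.^ (2 ℕ.+ 2 ℕ.* t) ≡⟨ ℕ.^-distribˡ-+-* p 2 (2 ℕ.* t) ⟩
    p ℕ.^ 2 ℕ.* p ℕ.^ (2 ℕ.* t) ≡⟨ cong₂ (λ x y → x ℕ.^ 2 ℕ.* y) e e' ⟩
    (4 ℕ.* k ℕ.+ 3) ℕ.^ 2 ℕ.* suc (4 ℕ.* (2 ℕ.* c)) ≡⟨ cong (ℕ._* suc (4 ℕ.* (2 ℕ.* c))) (cong ((4 ℕ.* k ℕ.+ 3) ℕ.*_) (ℕ.*-identityʳ (4 ℕ.* k ℕ.+ 3))) ⟩
    (4 ℕ.* k ℕ.+ 3) ℕ.* (4 ℕ.* k ℕ.+ 3) ℕ.* suc (4 ℕ.* (2 ℕ.* c)) ≡⟨ id₂ k c ⟩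
    suc (4 ℕ.* (2 ℕ.* (a ℕ.* (1 ℕ.+ 8 ℕ.* c) ℕ.+ c))) ∎)
    where
    open ≡-Reasoning
    a : ℕ
    a = 2 ℕ.* k ℕ.* k ℕ.+ 3 ℕ.* k ℕ.+ 1
    id₁ : ∀ t → 2 ℕ.* suc t ≡ 2 ℕ.+ 2 ℕ.* t
    id₁ = ℕ-solve-∀
    id₂ : ∀ k c → (4 ℕ.* k ℕ.+ 3) ℕ.* (4 ℕ.* k ℕ.+ 3) ℕ.* suc (4 ℕ.* (2 ℕ.* c))
      ≡ suc (4 ℕ.* (2 ℕ.* ((2 ℕ.* k ℕ.* k ℕ.+ 3 ℕ.* k ℕ.+ 1) ℕ.* (1 ℕ.+ 8 ℕ.* c) ℕ.+ c)))
    id₂ = ℕ-solve-∀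

  -- Here q is a variable constrained by equations, so that the field can be rewritten as one of
  -- cardinality `suc (4 * r)` with r = 2c. The case c = 0 would mean q = 1; any other c gives r >
  -- 1.
  structure : ∀ {q} p k t c → Prime p → p ≡ 4 ℕ.* k ℕ.+ 3 → q ≡ p ℕ.^ suc t → q ≡ suc (4 ℕ.* (2 ℕ.* c)) →
              (F : FiniteField q) (β : FiniteField.Carrier F) → FiniteField.IsPrimitive F β →
              Kp'≅ZmodPow F β p ((q ℕ.∸ 1) ℕ./ 4) (2 ℕ.* ((q ℕ.∸ 1) ℕ./ 4)) × KpHasOrder F β p (q ℕ.^ ((q ℕ.∸ 3) ℕ./ 2))
  structure p k t zero pp _ q≡pᵗ refl _ _ _ with ℕ.m^n≡1⇒n≡0∨m≡1 p (suc t) (sym q≡pᵗ)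
  ... | inj₁ ()
  ... | inj₂ refl = contradiction pp ¬prime[1]
  structure p k t c@(suc c') pp p≡4k+3 q≡pᵗ refl F β β-primitive =
    subst (λ m → Kp'≅ZmodPow F β p m (2 ℕ.* m)) (sym r≡) (Kp'≅ r r>1 _ c refl F β β-primitive p k t pp p≡4k+3 q≡pᵗ) ,
    subst (λ m → KpHasOrder F β p (suc (4 ℕ.* r) ℕ.^ m)) (sym exponent≡) (Kp-order r r>1 _ c refl F β β-primitive p k t pp p≡4k+3 q≡pᵗ)
    where
    r : ℕ
    r = 2 ℕ.* c
    r>1 : r ℕ.> 1
    r>1 = ℕ.*-monoʳ-≤ 2 {1} {c} (s≤s z≤n)
    r≡ : 4 ℕ.* r ℕ./ 4 ≡ r
    r≡ = trans (cong (ℕ._/ 4) (ℕ.*-comm 4 r)) (ℕ.m*n/n≡m r 4)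
    exponent≡ : (4 ℕ.* r ℕ.∸ 2) ℕ./ 2 ≡ 2 ℕ.* r ℕ.∸ 1
    exponent≡ = trans (cong (λ m → (m ℕ.∸ 2) ℕ./ 2) (id₁ r)) (trans (cong (ℕ._/ 2) (sym (ℕ.*-distribʳ-∸ 2 (2 ℕ.* r) 1))) (ℕ.m*n/n≡m (2 ℕ.* r ℕ.∸ 1) 2))
      where
      id₁ : ∀ r → 4 ℕ.* r ≡ 2 ℕ.* r ℕ.* 2
      id₁ = ℕ-solve-∀

open import Data.Nat using (ℕ; suc; _^_; _*_; _∸_; _≥_; _%_; _+_)
open import Data.Nat.DivMod using (_/_; m≡m%n+[m/n]*n)
open import Data.Nat.Primality using (Prime)
open import Data.Nat.Properties using (+-comm; *-comm)
open import Data.Product using (_×_; _,_)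
open import Relation.Binary.PropositionalEquality using (_≡_; refl; trans; cong₂)

theorem3p2 : (p t : ℕ) → Prime p → p % 4 ≡ 3 → t ≥ 1 →
    (F : FiniteField (p ^ (2 * t))) →
    (β : FiniteField.Carrier F) → FiniteField.IsPrimitive F β →
    Kp'≅ZmodPow F β p ((p ^ (2 * t) ∸ 1) / 4) (2 * ((p ^ (2 * t) ∸ 1) / 4))
    × KpHasOrder F β p ((p ^ (2 * t)) ^ ((p ^ (2 * t) ∸ 3) / 2))
theorem3p2 p (suc t) p-prime p%4≡3 _ F β β-primitive =
  let c , q≡ = CriticalGroup.power-mod-8 p (p / 4) p≡4k+3 (suc t)
  -- `2 * suc t` unfolds to the successor of `t + 1 * suc t`, and `structure` expects the exponent
  -- of p lowered by one.
  in CriticalGroup.structure p (p / 4) (t + 1 * suc t) c p-prime p≡4k+3 refl q≡ F β β-primitive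
  where
  p≡4k+3 : p ≡ 4 * (p / 4) + 3
  p≡4k+3 = trans (m≡m%n+[m/n]*n p 4) (trans (cong₂ _+_ p%4≡3 (*-comm (p / 4) 4)) (+-comm 3 (4 * (p / 4))))
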